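{- Let $n=4m$ with $m\in\mathbb{N}$, $n=2r$, $a>0$, and let $K$ be the two-periodic Kasteleyn matrix with parameters $(a,1)$ on the Aztec diamond of size $n$ (see context). Let $G(a,1,\mathtt{w},\mathtt{b})=\sum_{x\in\mathtt{W}}\sum_{y\in\mathtt{B}}K^{ -1}(x,y)w_1^{x_1}w_2^{x_2}b_1^{y_1}b_2^{y_2}$. Then $$G(a,1,\mathtt{w},\mathtt{b})=\frac{d(\mathtt{w},\mathtt{b})}{c_\partial(w_1,w_2)}+\sum_{\epsilon,\delta\in\{0,1\}}\sum_{k,l\in\{0,2n\}}\sum_{(x_1,k)\in\mathtt{W}_\epsilon}\sum_{(l,y_2)\in\mathtt{B}_\delta}\frac{s_{\epsilon,k}(w_1,w_2)\,s_{\delta,l}(b_2,b_1)\,K^{ -1}((x_1,k),(l,y_2))}{c_\partial(w_1,w_2)\,c_\partial(b_1,b_2)}\,w_1^{x_1}b_2^{y_2},$$ and moreover, for all admissible $x_1$ (odd, $1\le x_1\le 2n-1$) and $y_2$ (odd, $1\le y_2\le 2n-1$), $$\begin{aligned}K^{ -1}((x_1,0),(0,y_2))&=L\big(a,1,\tfrac{x_1-1}{2},\tfrac{y_2-1}{2}\big),\\ K^{ -1}((x_1,0),(2n,y_2))&=\mathrm{i}^{2n-1-x_1+y_2}L\big(1,a,n-\tfrac{x_1+1}{2},\tfrac{y_2-1}{2}\big),\\ K^{ -1}((x_1,2n),(0,y_2))&=\mathrm{i}^{2n-1+x_1-y_2}L\big(1,a,\tfrac{x_1-1}{2},n-\tfrac{y_2+1}{2}\big),\\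 K^{ -1}((x_1,2n),(2n,y_2))&=L\big(a,1,n-\tfrac{x_1+1}{2},n-\tfrac{y_2+1}{2}\big).\end{aligned}$$
   Context: $\mathrm{i}=\sqrt{ -1}$. Aztec diamond of size $n$: $\mathtt{W}=\{(x_1,x_2): x_1\text{ odd},\ x_2\text{ even},\ 1\le x_1\le 2n-1,\ 0\le x_2\le 2n\}$, $\mathtt{B}=\{(x_1,x_2): x_1\text{ even},\ x_2\text{ odd},\ 0\le x_1\le 2n,\ 1\le x_2\le 2n-1\}$, $e_1=(1,1)$, $e_2=(-1,1)$. For $\epsilon\in\{0,1\}$: $\mathtt{W}_\epsilon=\{(x_1,x_2)\in\mathtt{W}:(x_1+x_2)\bmod 4=2\epsilon+1\}$, $\mathtt{B}_\epsilon=\{(x_1,x_2)\in\mathtt{B}:(x_1+x_2)\bmod4=2\epsilon+1\}$. For parameters $\alpha,\beta>0$, the two-periodic Kasteleyn matrix $K_{\alpha,\beta}$ (rows $\mathtt{B}$, columns $\mathtt{W}$) is: for $x\in\mathtt{B}_\epsilon$, $K_{\alpha,\beta}(x,x+e_1)=\alpha(1-\epsilon)+\beta\epsilon$, $K_{\alpha,\beta}(x,x+e_2)=(\alpha\epsilon+\beta(1-\epsilon))\mathrm{i}$, $K_{\alpha,\beta}(x,x-e_1)=\alpha\epsilon+\beta(1-\epsilon)$, $K_{\alpha,\beta}(x,x-e_2)=(\alpha(1-\epsilon)+\beta\epsilon)\mathrm{i}$ (when the neighbour lies in $\mathtt{W}$), and $0$ otherwise. $K=K_{a,1}$. $L(\alpha,\beta,i,j):=K_{\alpha,\beta}^{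 -1}((2i+1,0),(0,2j+1))$ on the Aztec diamond of size $n$. $f_k(t)=(1-t^k)/(1-t)$. $c_\partial(r_1,r_2)=2(1+a^2)+a(r_1^2+r_1^{ -2})(r_2^2+r_2^{ -2})$; $s_{\epsilon,0}(r_1,r_2)=-a(r_1^{ -2}r_2^{ -2}+r_1^2r_2^{ -2})-a\mathrm{i}r_1^2+a\mathrm{i}r_1^{ -2}-2a^{2\epsilon}$; $s_{\epsilon,2n}(r_1,r_2)=r_2^{2n}\big(-a(r_1^2r_2^2+r_1^{ -2}r_2^2)+a\mathrm{i}r_1^2-a\mathrm{i}r_1^{ -2}-2a^{2(1-\epsilon)}\big)$. $d_{\mathrm{sides}}(\mathtt{w},\mathtt{b})=s_{0,0}(w_1,w_2)\big(a(b_1^2-\mathrm{i})w_1b_2+w_1b_2^{ -1}(1-\mathrm{i}b_1^2)\big)+s_{1,0}(w_1,w_2)\big((b_1^2-\mathrm{i})w_1^3b_1^2b_2+aw_1^3b_1^2b_2^{ -1}(1-\mathrm{i}b_1^2)\big)+s_{0,2n}(w_1,w_2)\big((1-\mathrm{i}b_1^2)w_1b_2^{2n-1}+aw_1b_2^{2n+1}(b_1^2-\mathrm{i})\big)+s_{1,2n}(w_1,w_2)\big(a(1-\mathrm{i}b_1^2)w_1^3b_1^2b_2^{2n-1}+w_1^3b_1^2b_2^{2n+1}(b_1^2-\mathrm{i})\big)$. $d(\mathtt{w},\mathtt{b})=f_r(w_2^4b_2^4)f_r(w_1^4b_1^4)\,b_2w_1\big(a+w_1^2b_1^2+w_2^2b_2^2(1+aw_1^2b_1^2)\big)\big(w_2^2+b_1^2-\mathrm{i}(1+w_2^2b_1^2)\big)+\big((1-\mathrm{i}w_2^2)w_1^{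 -1}b_2(1+aw_2^2b_2^2)+(w_2^2-\mathrm{i})w_1^{2n+1}b_1^{2n}b_2(a+w_2^2b_2^2)\big)f_r(w_2^4b_2^4)-\frac{d_{\mathrm{sides}}(\mathtt{w},\mathtt{b})}{c_\partial(b_1,b_2)}f_r(w_1^4b_1^4)$. -}

module Defs where

open import Algebra.Bundles using (CommutativeRing)
open import Algebra.Apartness.Bundles using (HeytingField)
open import Algebra.Apartness.Structures using (IsHeytingField)
open import Algebra.Core using (Op₁; Op₂)
open import Data.Bool.Base using (Bool; true; false; if_then_else_; _∧_; T)
open import Data.Empty using (⊥-elim)
open import Data.Fin.Base as Fin using (Fin; zero; suc; toℕ)
open import Data.Fin.Patterns using (0F; 1F)
import Data.Fin.Properties as Fin
open import Data.Maybe.Base as Maybe using (Maybe)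
open import Data.Nat.Base as ℕ using (ℕ; zero; suc; _≡ᵇ_; _<ᵇ_; z≤n; s≤s)
open import Data.Nat.GeneralisedArithmetic using (fold)
import Data.Nat.DivMod as ℕ
import Data.Nat.Properties as ℕₚ
open import Data.Integer.Base as ℤ using (ℤ; +_; -[1+_])
import Data.Integer.Properties as ℤₚ
open import Data.Product.Base using (∃; ∃-syntax; _×_; _,_; proj₁; proj₂)
open import Data.Sum.Base as Sum using (_⊎_; inj₁; inj₂)
open import Level using (_⊔_) renaming (suc to lsuc)
open import Relation.Binary.Core using (Rel)
open import Relation.Binary.PropositionalEquality as ≡ using (_≡_)
open import Relation.Binary.Structures using (IsStrictPartialOrder; IsApartnessRelation)
open import Relation.Nullary using (¬_; contradiction)
open import Relation.Nullary.Decidable using (does; yes; no; dec⇒maybe)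

-- A complete Archimedean ordered field.  Constructively this is a Heyting
-- field with apartness "x < y or y < x" in which Cauchy sequences converge.
record RealNumbers c ℓ₁ ℓ₂ : Set (lsuc (c ⊔ ℓ₁ ⊔ ℓ₂)) where
  infix  8 -_
  infixl 7 _*_
  infixl 6 _+_
  infix  4 _≈_ _<_ _#_
  field
    Carrier : Set c
    _≈_     : Rel Carrier ℓ₁
    _<_     : Rel Carrier ℓ₂
    _+_     : Op₂ Carrier
    _*_     : Op₂ Carrier
    -_      : Op₁ Carrier
    0#      : Carrier
    1#      : Carrier

  _#_ : Rel Carrier ℓ₂
  x # y = x < y ⊎ y < x

  field
    isHeytingField       : IsHeytingField _≈_ _#_ _+_ _*_ -_ 0# 1#
    isStrictPartialOrder : IsStrictPartialOrder _≈_ _<_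
    +-monoˡ-<            : ∀ z {x y} → x < y → x + z < y + z
    *-pos                : ∀ {x y} → 0# < x → 0# < y → 0# < x * y

  fromℕ : ℕ → Carrier
  fromℕ = fold 0# (_+_ 1#)

  Cauchy : (ℕ → Carrier) → Set (c ⊔ ℓ₂)
  Cauchy u = ∀ ε → 0# < ε → ∃[ N ] ∀ m n → N ℕ.≤ m → N ℕ.≤ n → u m < u n + ε

  _⟶_ : (ℕ → Carrier) → Carrier → Set (c ⊔ ℓ₂)
  u ⟶ l = ∀ ε → 0# < ε → ∃[ N ] ∀ n → N ℕ.≤ n → u n < l + ε × l < u n + ε

  field
    archimedean : ∀ x → ∃[ n ] x < fromℕ n
    complete    : ∀ u → Cauchy u → ∃[ l ] u ⟶ l

  heytingField : HeytingField c ℓ₁ ℓ₂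
  heytingField = record { isHeytingField = isHeytingField }

  open IsHeytingField isHeytingField public

  commutativeRing : CommutativeRing c ℓ₁
  commutativeRing = record { isCommutativeRing = isCommutativeRing }

module IntegerCoefficients {c ℓ} (R : CommutativeRing c ℓ) where
  open CommutativeRing R
  open import Algebra.Properties.Ring ring
  open import Algebra.Properties.AbelianGroup +-abelianGroup using (⁻¹-∙-comm)
  open import Algebra.Properties.Semiring.Mult.TCOptimised semiring
    using (1+×; ×-homo-+; ×1-homo-*) renaming (_×_ to _×′_)
  open import Algebra.Solver.Ring.AlmostCommutativeRing
  open import Relation.Binary.Reasoning.Setoid setoid

  private
    ⟦_⟧ℤ : ℤ → Carrier
    ⟦ + n ⟧ℤ      = n ×′ 1#
    ⟦ -[1+ n ] ⟧ℤ = - (suc n ×′ 1#)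

    cancel₁ : ∀ x y → (1# + x) - (1# + y) ≈ x - y
    cancel₁ x y = begin
      (1# + x) - (1# + y)       ≈⟨ +-congˡ (⁻¹-∙-comm 1# y) ⟨
      (1# + x) + (- 1# + - y)   ≈⟨ +-congʳ (+-comm 1# x) ⟩
      (x + 1#) + (- 1# + - y)   ≈⟨ +-assoc x 1# _ ⟩
      x + (1# + (- 1# + - y))   ≈⟨ +-congˡ (+-assoc 1# _ _) ⟨
      x + ((1# + - 1#) + - y)   ≈⟨ +-congˡ (+-congʳ (-‿inverseʳ 1#)) ⟩
      x + (0# + - y)            ≈⟨ +-congˡ (+-identityˡ _) ⟩
      x - y                     ∎

    ⊖-homo : ∀ m n → ⟦ m ℤ.⊖ n ⟧ℤ ≈ m ×′ 1# - n ×′ 1#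
    ⊖-homo zero    zero    = sym (-‿inverseʳ 0#)
    ⊖-homo zero    (suc n) = sym (+-identityˡ _)
    ⊖-homo (suc m) zero    = sym (trans (+-congˡ -0#≈0#) (+-identityʳ _))
    ⊖-homo (suc m) (suc n) = begin
      ⟦ suc m ℤ.⊖ suc n ⟧ℤ                ≡⟨ ≡.cong ⟦_⟧ℤ (ℤₚ.[1+m]⊖[1+n]≡m⊖n m n) ⟩
      ⟦ m ℤ.⊖ n ⟧ℤ                        ≈⟨ ⊖-homo m n ⟩
      m ×′ 1# - n ×′ 1#                   ≈⟨ cancel₁ _ _ ⟨
      (1# + m ×′ 1#) - (1# + n ×′ 1#)     ≈⟨ +-cong (1+× m 1#) (-‿cong (1+× n 1#)) ⟨
      suc m ×′ 1# - suc n ×′ 1#           ∎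

    -‿homo : ∀ i → ⟦ ℤ.- i ⟧ℤ ≈ - ⟦ i ⟧ℤ
    -‿homo (+ zero)  = sym -0#≈0#
    -‿homo (+ suc n) = refl
    -‿homo -[1+ n ]  = sym (-‿involutive _)

    +-homo : ∀ i j → ⟦ i ℤ.+ j ⟧ℤ ≈ ⟦ i ⟧ℤ + ⟦ j ⟧ℤ
    +-homo (+ m)    (+ n)    = ×-homo-+ 1# m n
    +-homo (+ m)    -[1+ n ] = ⊖-homo m (suc n)
    +-homo -[1+ m ] (+ n)    = trans (⊖-homo n (suc m)) (+-comm _ _)
    +-homo -[1+ m ] -[1+ n ] = begin
      - (suc (suc (m ℕ.+ n)) ×′ 1#)       ≡⟨ ≡.cong (λ k → - (k ×′ 1#)) (≡.cong suc (ℕₚ.+-suc m n)) ⟨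
      - ((suc m ℕ.+ suc n) ×′ 1#)         ≈⟨ -‿cong (×-homo-+ 1# (suc m) (suc n)) ⟩
      - (suc m ×′ 1# + suc n ×′ 1#)       ≈⟨ ⁻¹-∙-comm _ _ ⟨
      - (suc m ×′ 1#) + - (suc n ×′ 1#)   ∎

    +*-homo : ∀ m j → ⟦ + m ℤ.* j ⟧ℤ ≈ (m ×′ 1#) * ⟦ j ⟧ℤ
    +*-homo m (+ n)    = begin
      ⟦ + m ℤ.* + n ⟧ℤ          ≡⟨ ≡.cong ⟦_⟧ℤ (ℤₚ.pos-* m n) ⟨
      (m ℕ.* n) ×′ 1#           ≈⟨ ×1-homo-* m n ⟩
      (m ×′ 1#) * (n ×′ 1#)     ∎
    +*-homo m -[1+ n ] = begin
      ⟦ + m ℤ.* -[1+ n ] ⟧ℤ          ≡⟨ ≡.cong ⟦_⟧ℤ (ℤₚ.neg-distribʳ-* (+ m) (+ suc n)) ⟨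
      ⟦ ℤ.- (+ m ℤ.* + suc n) ⟧ℤ     ≈⟨ -‿homo (+ m ℤ.* + suc n) ⟩
      - ⟦ + m ℤ.* + suc n ⟧ℤ         ≈⟨ -‿cong (+*-homo m (+ suc n)) ⟩
      - ((m ×′ 1#) * (suc n ×′ 1#))  ≈⟨ -‿distribʳ-* _ _ ⟩
      (m ×′ 1#) * - (suc n ×′ 1#)    ∎

    *-homo : ∀ i j → ⟦ i ℤ.* j ⟧ℤ ≈ ⟦ i ⟧ℤ * ⟦ j ⟧ℤ
    *-homo (+ m)    j = +*-homo m j
    *-homo -[1+ m ] j = begin
      ⟦ -[1+ m ] ℤ.* j ⟧ℤ           ≡⟨ ≡.cong ⟦_⟧ℤ (ℤₚ.neg-distribˡ-* (+ suc m) j) ⟨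
      ⟦ ℤ.- (+ suc m ℤ.* j) ⟧ℤ      ≈⟨ -‿homo (+ suc m ℤ.* j) ⟩
      - ⟦ + suc m ℤ.* j ⟧ℤ          ≈⟨ -‿cong (+*-homo (suc m) j) ⟩
      - ((suc m ×′ 1#) * ⟦ j ⟧ℤ)    ≈⟨ -‿distribˡ-* _ _ ⟩
      - (suc m ×′ 1#) * ⟦ j ⟧ℤ      ∎

    morphism : ℤ.+-*-rawRing -Raw-AlmostCommutative⟶ fromCommutativeRing R
    morphism = record
      { ⟦_⟧ = ⟦_⟧ℤ ; +-homo = +-homo ; *-homo = *-homo ; -‿homo = -‿homo
      ; 0-homo = refl ; 1-homo = refl }

    _≟_ : ∀ i j → Maybe (⟦ i ⟧ℤ ≈ ⟦ j ⟧ℤ)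
    i ≟ j = Maybe.map (λ i≡j → reflexive (≡.cong ⟦_⟧ℤ i≡j)) (dec⇒maybe (i ℤₚ.≟ j))

  open import Algebra.Solver.Ring _ _ morphism _≟_ public
    using (solve; _:=_; _:+_; _:*_; _:-_; :-_; con)

module OrderedFieldProperties {c ℓ₁ ℓ₂} (ℝ : RealNumbers c ℓ₁ ℓ₂) where
  open RealNumbers ℝ
  open IsStrictPartialOrder isStrictPartialOrder public
    using (<-resp-≈)
    renaming (irrefl to <-irrefl; trans to <-trans)
  open IntegerCoefficients commutativeRing
  open import Algebra.Properties.Ring (CommutativeRing.ring commutativeRing)
    using (-0#≈0#)
  open import Algebra.Definitions _≈_ using (Invertible)

  <-respʳ : ∀ {x y z} → y ≈ z → x < y → x < z
  <-respʳ = proj₁ <-resp-≈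

  <-respˡ : ∀ {x y z} → y ≈ z → y < x → z < x
  <-respˡ = proj₂ <-resp-≈

  #-resp : ∀ {x y z} → x ≈ y → x # z → y # z
  #-resp x≈y (inj₁ x<z) = inj₁ (<-respˡ x≈y x<z)
  #-resp x≈y (inj₂ z<x) = inj₂ (<-respʳ x≈y z<x)

  <-cotrans : ∀ {x y} → x < y → ∀ z → x < z ⊎ z < y
  <-cotrans x<y z with #-cotrans (inj₁ x<y) z
  ... | inj₁ (inj₁ x<z) = inj₁ x<z
  ... | inj₁ (inj₂ z<x) = inj₂ (<-trans z<x x<y)
  ... | inj₂ (inj₁ z<y) = inj₂ z<y
  ... | inj₂ (inj₂ y<z) = inj₁ (<-trans x<y y<z)

  invertible⇒#0 : ∀ {x} u → u * x ≈ 1# → x # 0#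
  invertible⇒#0 {x} u ux≈1 = invertible⇒# (u , left , trans (*-comm _ _) left)
    where
    left : u * (x - 0#) ≈ 1#
    left = trans (solve 2 (λ u x → u :* (x :- con (+ 0)) := u :* x) refl u x) ux≈1

  recip : ∀ {x} → x # 0# → ∃[ u ] u * x ≈ 1#
  recip {x} x#0 with #⇒invertible x#0
  ... | u , ux≈1 , _ = u , trans (solve 2 (λ u x → u :* x := u :* (x :- con (+ 0))) refl u x) ux≈1

  1#0 : 1# # 0#
  1#0 = invertible⇒#0 1# (*-identityˡ 1#)

  neg-pos : ∀ {x} → x < 0# → 0# < - x
  neg-pos {x} x<0 = <-respˡ (-‿inverseʳ x) (<-respʳ (+-identityˡ (- x)) (+-monoˡ-< (- x) x<0))

  square-pos : ∀ {x} → x # 0# → 0# < x * x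
  square-pos {x} (inj₁ x<0) =
    <-respʳ (solve 1 (λ x → :- x :* :- x := x :* x) refl x) (*-pos (neg-pos x<0) (neg-pos x<0))
  square-pos (inj₂ 0<x) = *-pos 0<x 0<x

  0<1 : 0# < 1#
  0<1 = <-respʳ (*-identityˡ 1#) (square-pos 1#0)

  +-pos : ∀ {x y} → 0# < x → 0# < y → 0# < x + y
  +-pos {x} {y} 0<x 0<y = <-trans 0<y (<-respˡ (+-identityˡ y) (+-monoˡ-< y 0<x))

  *-#0ʳ : ∀ {x y} → x * y # 0# → y # 0#
  *-#0ʳ {x} {y} xy#0 with recip xy#0
  ... | u , uxy≈1 = invertible⇒#0 (u * x) (trans (*-assoc u x y) uxy≈1)

  square-≮0 : ∀ x → ¬ x * x < 0#
  square-≮0 x xx<0 = <-irrefl refl (<-trans xx<0 (square-pos (*-#0ʳ (inj₁ xx<0))))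

  +-pos-≮0 : ∀ {x y} → 0# < x → ¬ y < 0# → 0# < x + y
  +-pos-≮0 {x} {y} 0<x y≮0 with <-cotrans 0<x (x + y)
  ... | inj₁ 0<x+y = 0<x+y
  ... | inj₂ x+y<x = contradiction y<0 y≮0
    where
    y<0 : y < 0#
    y<0 = <-respˡ (solve 2 (λ x y → x :+ y :+ :- x := y) refl x y)
            (<-respʳ (-‿inverseʳ x) (+-monoˡ-< (- x) x+y<x))

  recip-pos : ∀ {x} → 0# < x → ∃[ u ] (0# < u) × (u * x ≈ 1#)
  recip-pos {x} 0<x with recip (inj₂ 0<x)
  ... | u , ux≈1 with invertible⇒#0 x (trans (*-comm x u) ux≈1)
  ...   | inj₂ 0<u = u , 0<u , ux≈1
  ...   | inj₁ u<0 = contradiction (<-trans 0<1 1<0) (<-irrefl refl)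
    where
    1<0 : 1# < 0#
    1<0 = <-respʳ (-‿inverseˡ 1#) (<-respˡ (+-identityˡ 1#)
            (+-monoˡ-< 1# (<-respʳ (trans (solve 2 (λ u x → :- u :* x := :- (u :* x)) refl u x) (-‿cong ux≈1))
              (*-pos (neg-pos u<0) 0<x))))

module ComplexNumbers {c ℓ₁ ℓ₂} (ℝ : RealNumbers c ℓ₁ ℓ₂) where
  private
    module ℝ = RealNumbers ℝ
    module ℝₚ = OrderedFieldProperties ℝ
  open IntegerCoefficients ℝ.commutativeRing

  infixl 6 _+_
  infixl 7 _*_
  infix  8 -_
  infix  4 _≈_ _#_

  record ℂ : Set c where
    constructor _+i_
    field
      re im : ℝ.Carrier
  open ℂ public

  _≈_ : Rel ℂ ℓ₁
  z ≈ w = re z ℝ.≈ re w × im z ℝ.≈ im w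

  _#_ : Rel ℂ ℓ₂
  z # w = re z ℝ.# re w ⊎ im z ℝ.# im w

  _+_ _*_ : Op₂ ℂ
  z + w = (re z ℝ.+ re w) +i (im z ℝ.+ im w)
  z * w = (re z ℝ.* re w ℝ.- im z ℝ.* im w) +i (re z ℝ.* im w ℝ.+ im z ℝ.* re w)

  -_ : Op₁ ℂ
  - z = (ℝ.- re z) +i (ℝ.- im z)

  0# 1# 𝕚 : ℂ
  0# = ℝ.0# +i ℝ.0#
  1# = ℝ.1# +i ℝ.0#
  𝕚  = ℝ.0# +i ℝ.1#

  ⌜_⌝ : ℝ.Carrier → ℂ
  ⌜ x ⌝ = x +i ℝ.0#

  open import Algebra.Definitions _≈_ using (Invertible)
  open import Algebra.Structures _≈_ using (IsCommutativeRing)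

  isCommutativeRing : IsCommutativeRing _+_ _*_ -_ 0# 1#
  isCommutativeRing = record
    { isRing = record
      { +-isAbelianGroup = record
        { isGroup = record
          { isMonoid = record
            { isSemigroup = record
              { isMagma = record
                { isEquivalence = record
                  { refl  = ℝ.refl , ℝ.refl
                  ; sym   = λ (p , q) → ℝ.sym p , ℝ.sym q
                  ; trans = λ (p , q) (r , s) → ℝ.trans p r , ℝ.trans q s
                  }
                ; ∙-cong = λ (p , q) (r , s) → ℝ.+-cong p r , ℝ.+-cong q s
                }
              ; assoc = λ _ _ _ → ℝ.+-assoc _ _ _ , ℝ.+-assoc _ _ _
              }
            ; identity = (λ _ → ℝ.+-identityˡ _ , ℝ.+-identityˡ _)
                       , (λ _ → ℝ.+-identityʳ _ , ℝ.+-identityʳ _)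
            }
          ; inverse = (λ _ → ℝ.-‿inverseˡ _ , ℝ.-‿inverseˡ _)
                    , (λ _ → ℝ.-‿inverseʳ _ , ℝ.-‿inverseʳ _)
          ; ⁻¹-cong = λ (p , q) → ℝ.-‿cong p , ℝ.-‿cong q
          }
        ; comm = λ _ _ → ℝ.+-comm _ _ , ℝ.+-comm _ _
        }
      ; *-cong = λ (p , q) (r , s) →
          ℝ.+-cong (ℝ.*-cong p r) (ℝ.-‿cong (ℝ.*-cong q s)) , ℝ.+-cong (ℝ.*-cong p s) (ℝ.*-cong q r)
      ; *-assoc = λ (a +i b) (c +i d) (e +i f) →
          solve 6 (λ a b c d e f →
            (a :* c :- b :* d) :* e :- (a :* d :+ b :* c) :* f
              := a :* (c :* e :- d :* f) :- b :* (c :* f :+ d :* e)) ℝ.refl a b c d e f ,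
          solve 6 (λ a b c d e f →
            (a :* c :- b :* d) :* f :+ (a :* d :+ b :* c) :* e
              := a :* (c :* f :+ d :* e) :+ b :* (c :* e :- d :* f)) ℝ.refl a b c d e f
      ; *-identity =
          (λ (a +i b) →
            solve 2 (λ a b → con (+ 1) :* a :- con (+ 0) :* b := a) ℝ.refl a b ,
            solve 2 (λ a b → con (+ 1) :* b :+ con (+ 0) :* a := b) ℝ.refl a b) ,
          (λ (a +i b) →
            solve 2 (λ a b → a :* con (+ 1) :- b :* con (+ 0) := a) ℝ.refl a b ,
            solve 2 (λ a b → a :* con (+ 0) :+ b :* con (+ 1) := b) ℝ.refl a b)
      ; distrib =
          (λ (a +i b) (c +i d) (e +i f) →
            solve 6 (λ a b c d e f →
              a :* (c :+ e) :- b :* (d :+ f)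
                := (a :* c :- b :* d) :+ (a :* e :- b :* f)) ℝ.refl a b c d e f ,
            solve 6 (λ a b c d e f →
              a :* (d :+ f) :+ b :* (c :+ e)
                := (a :* d :+ b :* c) :+ (a :* f :+ b :* e)) ℝ.refl a b c d e f) ,
          (λ (a +i b) (c +i d) (e +i f) →
            solve 6 (λ a b c d e f →
              (c :+ e) :* a :- (d :+ f) :* b
                := (c :* a :- d :* b) :+ (e :* a :- f :* b)) ℝ.refl a b c d e f ,
            solve 6 (λ a b c d e f →
              (c :+ e) :* b :+ (d :+ f) :* a
                := (c :* b :+ d :* a) :+ (e :* b :+ f :* a)) ℝ.refl a b c d e f)
      }
    ; *-comm = λ (a +i b) (c +i d) →
        solve 4 (λ a b c d → a :* c :- b :* d := c :* a :- d :* b) ℝ.refl a b c d ,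
        solve 4 (λ a b c d → a :* d :+ b :* c := c :* b :+ d :* a) ℝ.refl a b c d
    }

  open IsCommutativeRing isCommutativeRing using (_-_)

  private
    isApartnessRelation : IsApartnessRelation _≈_ _#_
    isApartnessRelation = record
      { irrefl  = λ (p , q) → Sum.[ ℝ.#-irrefl p , ℝ.#-irrefl q ]
      ; sym     = Sum.map ℝ.#-sym ℝ.#-sym
      ; cotrans = λ where
          (inj₁ p) z → Sum.map inj₁ inj₁ (ℝ.#-cotrans p (re z))
          (inj₂ q) z → Sum.map inj₂ inj₂ (ℝ.#-cotrans q (im z))
      }

    norm-pos : ∀ x y → x ℝ.# ℝ.0# ⊎ y ℝ.# ℝ.0# → ℝ.0# ℝ.< x ℝ.* x ℝ.+ y ℝ.* y
    norm-pos x y (inj₁ x#0) = ℝₚ.+-pos-≮0 (ℝₚ.square-pos x#0) (ℝₚ.square-≮0 y)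
    norm-pos x y (inj₂ y#0) =
      ℝₚ.<-respʳ (ℝ.+-comm _ _) (ℝₚ.+-pos-≮0 (ℝₚ.square-pos y#0) (ℝₚ.square-≮0 x))

    #⇒-#0 : ∀ {x y} → x ℝ.# y → x ℝ.- y ℝ.# ℝ.0#
    #⇒-#0 x#y with ℝ.#⇒invertible x#y
    ... | u , ud≈1 , _ = ℝₚ.invertible⇒#0 u ud≈1

    -#0⇒# : ∀ {x y} → x ℝ.- y ℝ.# ℝ.0# → x ℝ.# y
    -#0⇒# d#0 with ℝₚ.recip d#0
    ... | u , ud≈1 = ℝ.invertible⇒# (u , ud≈1 , ℝ.trans (ℝ.*-comm _ _) ud≈1)

    #⇒invertible : ∀ {z w} → z # w → Invertible 1# _*_ (z - w)
    #⇒invertible {z} {w} z#w =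
      v , left , IsCommutativeRing.trans isCommutativeRing
                   (IsCommutativeRing.*-comm isCommutativeRing (z - w) v) left
      where
      x = re (z - w)
      y = im (z - w)
      inverse = ℝₚ.recip (inj₂ (norm-pos x y (Sum.map #⇒-#0 #⇒-#0 z#w)))
      u = proj₁ inverse
      v = (u ℝ.* x) +i (ℝ.- (u ℝ.* y))
      left : v * (z - w) ≈ 1#
      left =
        ℝ.trans (solve 3 (λ u x y → u :* x :* x :- (:- (u :* y)) :* y
                            := u :* (x :* x :+ y :* y)) ℝ.refl u x y) (proj₂ inverse) ,
        solve 3 (λ u x y → u :* x :* y :+ (:- (u :* y)) :* x := con (+ 0)) ℝ.refl u x y

    invertible⇒# : ∀ {z w} → Invertible 1# _*_ (z - w) → z # w
    invertible⇒# {z} {w} (v , (p , _) , _)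
      with ℝ.#-cotrans (ℝₚ.#-resp (ℝ.sym p) ℝₚ.1#0) (ℝ.- (im v ℝ.* im (z - w)))
    ... | inj₂ q = inj₂ (-#0⇒# (ℝₚ.*-#0ʳ (ℝₚ.#-resp (ℝ.sym (solve 2 (λ a b → :- a :* b := :- (a :* b)) ℝ.refl (im v) (im (z - w)))) q)))
    ... | inj₁ q = inj₁ (-#0⇒# (ℝₚ.*-#0ʳ (ℝₚ.#-resp
                     (solve 2 (λ s t → s :+ :- t :- (:- t) := s) ℝ.refl (re v ℝ.* re (z - w)) (im v ℝ.* im (z - w)))
                     (#⇒-#0 q))))

  heytingField : HeytingField c ℓ₁ ℓ₂
  heytingField = record
    { isHeytingField = record
      { isHeytingCommutativeRing = record
        { isCommutativeRing   = isCommutativeRing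
        ; isApartnessRelation = isApartnessRelation
        ; #⇒invertible        = #⇒invertible
        ; invertible⇒#        = invertible⇒#
        }
      ; tight = λ z w →
          (λ ¬z#w → proj₁ (ℝ.tight _ _) (λ p → ¬z#w (inj₁ p)) , proj₁ (ℝ.tight _ _) (λ q → ¬z#w (inj₂ q))) ,
          (λ (p , q) → Sum.[ ℝ.#-irrefl p , ℝ.#-irrefl q ])
      }
    }

-- Abstract positive weights whose face determinants are again invertible.
record WeightSystem {c ℓ} (R : CommutativeRing c ℓ) p : Set (c ⊔ ℓ ⊔ lsuc p) where
  open CommutativeRing R
  infixl 7 _*₊_
  field
    Weight : Set p
    ⟨_⟩    : Weight → Carrier
    𝕚      : Carrier
    _*₊_   : Weight → Weight → Weight
    ⟨*⟩    : ∀ x y → ⟨ x *₊ y ⟩ ≈ ⟨ x ⟩ * ⟨ y ⟩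
    δ      : (a b c d : Weight) → Weight
    det    : ∀ a b c d → ⟨ δ a b c d ⟩ * (⟨ a ⟩ * ⟨ c ⟩ - (𝕚 * ⟨ d ⟩) * (𝕚 * ⟨ b ⟩)) ≈ 1#

-- Kasteleyn matrices of Aztec diamonds are invertible because eliminating
-- the faces centred at odd points (urban renewal) turns such a matrix with
-- positive weights on the diamond of size n + 1 into one on the diamond of
-- size n.  The edges of the face centred at (2i+1 , 2j+1) join its left
-- vertex to its top and bottom ones with weights A, 𝕚D, and its right vertex
-- to its top and bottom ones with weights 𝕚B, C.
module UrbanRenewal {c ℓ} (R : CommutativeRing c ℓ) {p} (S : WeightSystem R p) where
  private module S = WeightSystem S
  open S using (Weight; ⟨_⟩; 𝕚; _*₊_; ⟨*⟩)
  open CommutativeRing R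
  open IntegerCoefficients R
  open import Relation.Binary.Reasoning.Setoid setoid

  infix 3 _when_
  _when_ : Carrier → Bool → Carrier
  z when b = if b then z else 0#

  record Weights : Set p where
    field
      A B C D : ℕ → ℕ → Weight

  module Face (W : Weights) (i j : ℕ) where
    module W = Weights W

    δ : Weight
    δ = S.δ (W.A i j) (W.B i j) (W.C i j) (W.D i j)

    a b c′ d e : Carrier
    a  = ⟨ W.A i j ⟩
    b  = 𝕚 * ⟨ W.B i j ⟩
    c′ = ⟨ W.C i j ⟩
    d  = 𝕚 * ⟨ W.D i j ⟩
    e  = ⟨ δ ⟩

    det : e * (a * c′ - d * b) ≈ 1#
    det = S.det (W.A i j) (W.B i j) (W.C i j) (W.D i j)

    top bot : Carrier → Carrier → Carrier
    top p q = e * (c′ * p - d * q)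
    bot p q = e * (a * q - b * p)

    top-cong : ∀ {p p′ q q′} → p ≈ p′ → q ≈ q′ → top p q ≈ top p′ q′
    top-cong p≈ q≈ = *-congˡ (+-cong (*-congˡ p≈) (-‿cong (*-congˡ q≈)))

    bot-cong : ∀ {p p′ q q′} → p ≈ p′ → q ≈ q′ → bot p q ≈ bot p′ q′
    bot-cong p≈ q≈ = *-congˡ (+-cong (*-congˡ q≈) (-‿cong (*-congˡ p≈)))

    left right : Carrier → Carrier → Carrier
    left  s t = a * s + d * t
    right s t = b * s + c′ * t

    by-det : ∀ z → (e * (a * c′ - d * b)) * z ≈ z
    by-det z = trans (*-congʳ det) (*-identityˡ z)

    left-inverse : ∀ p q → left (top p q) (bot p q) ≈ p
    left-inverse p q = trans
      (solve 7 (λ a b c d e p q →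
        a :* (e :* (c :* p :- d :* q)) :+ d :* (e :* (a :* q :- b :* p)) := (e :* (a :* c :- d :* b)) :* p)
        refl a b c′ d e p q)
      (by-det p)

    right-inverse : ∀ p q → right (top p q) (bot p q) ≈ q
    right-inverse p q = trans
      (solve 7 (λ a b c d e p q →
        b :* (e :* (c :* p :- d :* q)) :+ c :* (e :* (a :* q :- b :* p)) := (e :* (a :* c :- d :* b)) :* q)
        refl a b c′ d e p q)
      (by-det q)

    top-inverse : ∀ s t → top (left s t) (right s t) ≈ s
    top-inverse s t = trans
      (solve 7 (λ a b c d e s t →
        e :* (c :* (a :* s :+ d :* t) :- d :* (b :* s :+ c :* t)) := (e :* (a :* c :- d :* b)) :* s)
        refl a b c′ d e s t)
      (by-det s)

    bot-inverse : ∀ s t → bot (left s t) (right s t) ≈ t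
    bot-inverse s t = trans
      (solve 7 (λ a b c d e s t →
        e :* (a :* (b :* s :+ c :* t) :- b :* (a :* s :+ d :* t)) := (e :* (a :* c :- d :* b)) :* t)
        refl a b c′ d e s t)
      (by-det t)

  leftOf rightOf rightBefore : Weights → (ℕ → ℕ → Carrier) → ℕ → ℕ → Carrier
  leftOf  W f i j = Face.left  W i j (f i (suc j)) (f i j)
  rightOf W f i j = Face.right W i j (f i (suc j)) (f i j)
  rightBefore W f zero    j = 0#
  rightBefore W f (suc i) j = rightOf W f i j

  row : ℕ → Weights → (ℕ → ℕ → Carrier) → ℕ → ℕ → Carrier
  row n W f i j = rightBefore W f i j + (leftOf W f i j when i <ᵇ n)

  renewed : Weights → Weights
  renewed W = record
    { A = λ i j → W.A i (suc j) *₊ δ i (suc j)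
    ; B = λ i j → W.B (suc i) (suc j) *₊ δ (suc i) (suc j)
    ; C = λ i j → W.C (suc i) j *₊ δ (suc i) j
    ; D = λ i j → W.D i j *₊ δ i j
    }
    where
    module W = Weights W
    δ = Face.δ W

  leftOf-renewed : ∀ W v i j →
    leftOf (renewed W) v i j
      ≈ (Face.a W i (suc j) * Face.e W i (suc j)) * v i (suc j) + (Face.d W i j * Face.e W i j) * v i j
  leftOf-renewed W v i j =
    +-cong (*-congʳ (⟨*⟩ (Weights.A W i (suc j)) (Face.δ W i (suc j))))
           (*-congʳ (trans (*-congˡ (⟨*⟩ (Weights.D W i j) (Face.δ W i j))) (sym (*-assoc _ _ _))))

  rightOf-renewed : ∀ W v i j →
    rightOf (renewed W) v i j
      ≈ (Face.b W (suc i) (suc j) * Face.e W (suc i) (suc j)) * v i (suc j)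
        + (Face.c′ W (suc i) j * Face.e W (suc i) j) * v i j
  rightOf-renewed W v i j =
    +-cong (*-congʳ (trans (*-congˡ (⟨*⟩ (Weights.B W (suc i) (suc j)) (Face.δ W (suc i) (suc j)))) (sym (*-assoc _ _ _))))
           (*-congʳ (⟨*⟩ (Weights.C W (suc i) j) (Face.δ W (suc i) j)))

  when-cong : ∀ b {z w} → (T b → z ≈ w) → (z when b) ≈ (w when b)
  when-cong true  z≈w = z≈w _
  when-cong false z≈w = refl

  module Solve (m : ℕ) (W : Weights) (g v : ℕ → ℕ → Carrier) where
    module F = Face W

    gˡ : ℕ → ℕ → Carrier
    gˡ zero    j = (F.c′ 0 j * F.e 0 j) * g 0 j + (F.b 0 (suc j) * F.e 0 (suc j)) * g 0 (suc j)
    gˡ (suc i) j = 0#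

    gʳ : ℕ → ℕ → Carrier
    gʳ i j = (F.d i j * F.e i j) * g (suc i) j + (F.a i (suc j) * F.e i (suc j)) * g (suc i) (suc j)

    rhs : ℕ → ℕ → Carrier
    rhs i j = gʳ i j - gˡ i j

    uˡ uʳ : ℕ → ℕ → Carrier
    uˡ zero    j = g 0 j
    uˡ (suc i) j = v i j
    uʳ i j = g (suc i) j - (v i j when i <ᵇ m)

    top bot : ℕ → ℕ → Carrier
    top i j = F.top i j (uˡ i j) (uʳ i j)
    bot i j = F.bot i j (uˡ i j) (uʳ i j)

    f : ℕ → ℕ → Carrier
    f i zero    = bot i 0
    f i (suc j) = top i j

    left-part : ∀ i j →
      (F.c′ i j * F.e i j) * uˡ i j + (F.b i (suc j) * F.e i (suc j)) * uˡ i (suc j)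
        ≈ rightBefore (renewed W) v i j + gˡ i j
    left-part zero    j = sym (+-identityˡ _)
    left-part (suc i) j = trans (+-comm _ _) (trans (sym (rightOf-renewed W v i j)) (sym (+-identityʳ _)))

    right-part : ∀ i j b →
      (F.d i j * F.e i j) * (v i j when b) + (F.a i (suc j) * F.e i (suc j)) * (v i (suc j) when b)
        ≈ (leftOf (renewed W) v i j when b)
    right-part i j true  = trans (+-comm _ _) (sym (leftOf-renewed W v i j))
    right-part i j false = solve 2 (λ x y → x :* con (+ 0) :+ y :* con (+ 0) := con (+ 0)) refl _ _

    consistent : ∀ i j → row m (renewed W) v i j ≈ rhs i j → top i j ≈ bot i (suc j)
    consistent i j eq = begin
      top i j
        ≈⟨ solve 14 (λ a b c d e a′ b′ e′ p p′ g g′ v v′ →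
             e :* (c :* p :- d :* (g :- v))
               := e′ :* (a′ :* (g′ :- v′) :- b′ :* p′)
                  :+ (((c :* e) :* p :+ (b′ :* e′) :* p′) :+ ((d :* e) :* v :+ (a′ :* e′) :* v′)
                      :- ((d :* e) :* g :+ (a′ :* e′) :* g′)))
             refl (F.a i j) (F.b i j) (F.c′ i j) (F.d i j) (F.e i j)
                  (F.a i (suc j)) (F.b i (suc j)) (F.e i (suc j))
                  (uˡ i j) (uˡ i (suc j)) (g (suc i) j) (g (suc i) (suc j))
                  (v i j when i <ᵇ m) (v i (suc j) when i <ᵇ m) ⟩
      bot i (suc j) + (_ + _ - gʳ i j)
        ≈⟨ +-congˡ (+-congʳ (+-cong (left-part i j) (right-part i j (i <ᵇ m)))) ⟩
      bot i (suc j) + (rightBefore (renewed W) v i j + gˡ i j + (leftOf (renewed W) v i j when i <ᵇ m) - gʳ i j)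
        ≈⟨ +-congˡ (solve 4 (λ r l x y → r :+ x :+ l :- y := (r :+ l) :+ x :- y) refl _ _ _ _) ⟩
      bot i (suc j) + (row m (renewed W) v i j + gˡ i j - gʳ i j)
        ≈⟨ +-congˡ (+-congʳ (+-congʳ eq)) ⟩
      bot i (suc j) + (gʳ i j - gˡ i j + gˡ i j - gʳ i j)
        ≈⟨ solve 3 (λ z x y → z :+ (y :- x :+ x :- y) := z) refl _ _ _ ⟩
      bot i (suc j) ∎

    module _ (eq : ∀ i j → i ℕ.≤ m → j ℕ.< m → row m (renewed W) v i j ≈ rhs i j) where

      f≈bot : ∀ i j → i ℕ.≤ m → j ℕ.≤ m → f i j ≈ bot i j
      f≈bot i zero    i≤m j≤m = refl
      f≈bot i (suc j) i≤m j<m = consistent i j (eq i j i≤m j<m)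

      leftOf-f : ∀ i j → i ℕ.≤ m → j ℕ.≤ m → leftOf W f i j ≈ uˡ i j
      leftOf-f i j i≤m j≤m = trans (+-congˡ (*-congˡ (f≈bot i j i≤m j≤m))) (F.left-inverse i j _ _)

      rightOf-f : ∀ i j → i ℕ.≤ m → j ℕ.≤ m → rightOf W f i j ≈ uʳ i j
      rightOf-f i j i≤m j≤m = trans (+-congˡ (*-congˡ (f≈bot i j i≤m j≤m))) (F.right-inverse i j _ _)

      row-f : ∀ i j → i ℕ.≤ suc m → j ℕ.≤ m → row (suc m) W f i j ≈ g i j
      row-f zero    j _         j≤m = trans (+-identityˡ _) (leftOf-f 0 j z≤n j≤m)
      row-f (suc i) j (s≤s i≤m) j≤m = begin
        rightOf W f i j + (leftOf W f (suc i) j when i <ᵇ m)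
          ≈⟨ +-cong (rightOf-f i j i≤m j≤m)
                    (when-cong (i <ᵇ m) (λ i<m → leftOf-f (suc i) j (ℕₚ.<ᵇ⇒< i m i<m) j≤m)) ⟩
        g (suc i) j - (v i j when i <ᵇ m) + (v i j when i <ᵇ m)
          ≈⟨ solve 2 (λ x y → x :- y :+ y := x) refl _ _ ⟩
        g (suc i) j ∎

  existence : ∀ n W (g : ℕ → ℕ → Carrier) → ∃[ f ] ∀ i j → i ℕ.≤ n → j ℕ.< n → row n W f i j ≈ g i j
  existence zero    W g = (λ _ _ → 0#) , λ _ _ _ ()
  existence (suc m) W g with existence m (renewed W) (Solve.rhs m W g (λ _ _ → 0#))
  ... | v , eq = Solve.f m W g v , λ i j i≤n j<n → Solve.row-f m W g v eq i j i≤n (ℕₚ.≤-pred j<n)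

  zero-combination : ∀ x y {s t} → s ≈ 0# → t ≈ 0# → x * s - y * t ≈ 0#
  zero-combination x y s≈0 t≈0 =
    trans (+-cong (*-congˡ s≈0) (-‿cong (*-congˡ t≈0)))
          (solve 2 (λ x y → x :* con (+ 0) :- y :* con (+ 0) := con (+ 0)) refl x y)

  uniqueness : ∀ n W f → (∀ i j → i ℕ.≤ n → j ℕ.< n → row n W f i j ≈ 0#) →
               ∀ i j → i ℕ.< n → j ℕ.≤ n → f i j ≈ 0#
  uniqueness zero    W f eq i j () j≤n
  uniqueness (suc m) W f eq = f≈0
    where
    module F = Face W

    v : ℕ → ℕ → Carrier
    v i j = leftOf W f (suc i) j

    u : ℕ → ℕ → Carrier
    u i j = - (v i j when i <ᵇ m)

    leftOf-zero : ∀ j → j ℕ.≤ m → leftOf W f 0 j ≈ 0#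
    leftOf-zero j j≤m = trans (sym (+-identityˡ _)) (eq 0 j z≤n (s≤s j≤m))

    rightOf≈u : ∀ i j → i ℕ.≤ m → j ℕ.≤ m → rightOf W f i j ≈ u i j
    rightOf≈u i j i≤m j≤m = begin
      rightOf W f i j
        ≈⟨ solve 2 (λ x y → x := x :+ y :- y) refl _ _ ⟩
      row (suc m) W f (suc i) j - (v i j when i <ᵇ m)
        ≈⟨ +-congʳ (eq (suc i) j (s≤s i≤m) (s≤s j≤m)) ⟩
      0# - (v i j when i <ᵇ m)
        ≈⟨ +-identityˡ _ ⟩
      u i j ∎

    rightBefore-v : ∀ i j → j ℕ.< m →
      rightBefore (renewed W) v i j
        ≈ (F.c′ i j * F.e i j) * leftOf W f i j + (F.b i (suc j) * F.e i (suc j)) * leftOf W f i (suc j)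
    rightBefore-v (suc i) j j<m = trans (rightOf-renewed W v i j) (+-comm _ _)
    rightBefore-v zero    j j<m = sym (trans
      (+-cong (*-congˡ (leftOf-zero j (ℕₚ.<⇒≤ j<m))) (*-congˡ (leftOf-zero (suc j) j<m)))
      (solve 2 (λ x y → x :* con (+ 0) :+ y :* con (+ 0) := con (+ 0)) refl _ _))

    leftOf-v : ∀ i j b →
      (leftOf (renewed W) v i j when b)
        ≈ (F.d i j * F.e i j) * (v i j when b) + (F.a i (suc j) * F.e i (suc j)) * (v i (suc j) when b)
    leftOf-v i j true  = trans (leftOf-renewed W v i j) (+-comm _ _)
    leftOf-v i j false = solve 2 (λ x y → con (+ 0) := x :* con (+ 0) :+ y :* con (+ 0)) refl _ _

    renewed-eq : ∀ i j → i ℕ.≤ m → j ℕ.< m → row m (renewed W) v i j ≈ 0#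
    renewed-eq i j i≤m j<m = begin
      row m (renewed W) v i j
        ≈⟨ +-cong (rightBefore-v i j j<m) (leftOf-v i j (i <ᵇ m)) ⟩
      _
        ≈⟨ solve 11 (λ c d e a′ b′ e′ p p′ v v′ z →
             ((c :* e) :* p :+ (b′ :* e′) :* p′) :+ ((d :* e) :* v :+ (a′ :* e′) :* v′)
               := e :* (c :* p :- d :* :- v) :- e′ :* (a′ :* :- v′ :- b′ :* p′))
             refl (F.c′ i j) (F.d i j) (F.e i j)
                  (F.a i (suc j)) (F.b i (suc j)) (F.e i (suc j))
                  (leftOf W f i j) (leftOf W f i (suc j))
                  (v i j when i <ᵇ m) (v i (suc j) when i <ᵇ m) 0# ⟩
      F.top i j (leftOf W f i j) (u i j) - F.bot i (suc j) (leftOf W f i (suc j)) (u i (suc j))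
        ≈⟨ +-cong (F.top-cong i j refl (rightOf≈u i j i≤m (ℕₚ.<⇒≤ j<m)))
                  (-‿cong (F.bot-cong i (suc j) refl (rightOf≈u i (suc j) i≤m j<m))) ⟨
      F.top i j (leftOf W f i j) (rightOf W f i j)
        - F.bot i (suc j) (leftOf W f i (suc j)) (rightOf W f i (suc j))
        ≈⟨ +-cong (F.top-inverse i j _ _) (-‿cong (F.bot-inverse i (suc j) _ _)) ⟩
      f i (suc j) - f i (suc j)
        ≈⟨ -‿inverseʳ _ ⟩
      0# ∎

    v≈0 : ∀ i j → i ℕ.< m → j ℕ.≤ m → v i j ≈ 0#
    v≈0 = uniqueness m (renewed W) v renewed-eq

    leftOf≈0 : ∀ i j → i ℕ.≤ m → j ℕ.≤ m → leftOf W f i j ≈ 0#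
    leftOf≈0 zero    j _   j≤m = leftOf-zero j j≤m
    leftOf≈0 (suc i) j i<m j≤m = v≈0 i j i<m j≤m

    when-zero : ∀ b → (0# when b) ≈ 0#
    when-zero true  = refl
    when-zero false = refl

    rightOf≈0 : ∀ i j → i ℕ.≤ m → j ℕ.≤ m → rightOf W f i j ≈ 0#
    rightOf≈0 i j i≤m j≤m = begin
      rightOf W f i j           ≈⟨ rightOf≈u i j i≤m j≤m ⟩
      - (v i j when i <ᵇ m)     ≈⟨ -‿cong (trans (when-cong (i <ᵇ m) (λ i<m → v≈0 i j (ℕₚ.<ᵇ⇒< i m i<m) j≤m)) (when-zero (i <ᵇ m))) ⟩
      - 0#                      ≈⟨ solve 0 (:- con (+ 0) := con (+ 0)) refl ⟩
      0#                        ∎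

    times-zero : ∀ x {z} → z ≈ 0# → x * z ≈ 0#
    times-zero x z≈0 = trans (*-congˡ z≈0) (zeroʳ x)

    f≈0 : ∀ i j → i ℕ.< suc m → j ℕ.≤ suc m → f i j ≈ 0#
    f≈0 i zero    (s≤s i≤m) _ = trans (sym (F.bot-inverse i 0 _ _))
      (times-zero _ (zero-combination _ _ (rightOf≈0 i 0 i≤m z≤n) (leftOf≈0 i 0 i≤m z≤n)))
    f≈0 i (suc j) (s≤s i≤m) (s≤s j≤m) = trans (sym (F.top-inverse i j _ _))
      (times-zero _ (zero-combination _ _ (leftOf≈0 i j i≤m j≤m) (rightOf≈0 i j i≤m j≤m)))

module TwoPeriodicAztec {c ℓ₁ ℓ₂} (ℝ : RealNumbers c ℓ₁ ℓ₂) where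
  private
    module ℝ = RealNumbers ℝ
    module ℝₚ = OrderedFieldProperties ℝ
    module ℂ = ComplexNumbers ℝ

  -- Sealed so that real and imaginary parts are only seen where asked for.
  opaque
    ℂ-heytingField : HeytingField c ℓ₁ ℓ₂
    ℂ-heytingField = ℂ.heytingField

  open HeytingField ℂ-heytingField public
    renaming (Carrier to ℂ; zero to *-zero)
    hiding (heytingCommutativeRing; isHeytingField)

  opaque
    unfolding ℂ-heytingField

    𝕚 : ℂ
    𝕚 = ℂ.𝕚

    ⌜_⌝ : ℝ.Carrier → ℂ
    ⌜_⌝ = ℂ.⌜_⌝

  ℂ-commutativeRing : CommutativeRing c ℓ₁
  ℂ-commutativeRing = record { isCommutativeRing = isCommutativeRing }

  private
    module ℂᴿ = CommutativeRing ℂ-commutativeRing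

  open import Algebra.Properties.Semiring.Exp ℂᴿ.semiring public using (_^_)
  open import Algebra.Properties.Semiring.Sum ℂᴿ.semiring public using (sum-syntax)

  ℝ₊ : Set (c ⊔ ℓ₂)
  ℝ₊ = ∃[ x ] ℝ.0# ℝ.< x

  1₊ : ℝ₊
  1₊ = ℝ.1# , ℝₚ.0<1

  infix 3 _when_
  _when_ : ℂ → Bool → ℂ
  z when b = if b then z else 0#

  -- Vertices are numbered so that the constraints on their coordinates hold
  -- automatically: (i , j) is the white vertex (2i+1 , 2j), and likewise for
  -- the black vertex (2i , 2j+1).
  White Black : ℕ → Set
  White n = Fin n × Fin (suc n)
  Black n = Fin (suc n) × Fin n

  posᵂ : ∀ {n} → White n → ℕ × ℕ
  posᵂ (i , j) = 2 ℕ.* toℕ i ℕ.+ 1 , 2 ℕ.* toℕ j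

  posᴮ : ∀ {n} → Black n → ℕ × ℕ
  posᴮ (i , j) = 2 ℕ.* toℕ i , 2 ℕ.* toℕ j ℕ.+ 1

  ∑ₓ : ∀ {k l} → (Fin k × Fin l → ℂ) → ℂ
  ∑ₓ {k} {l} f = ∑[ i < k ] ∑[ j < l ] f (i , j)

  sumᵂ-syntax : ∀ n → (White n → ℂ) → ℂ
  sumᵂ-syntax _ = ∑ₓ

  sumᴮ-syntax : ∀ n → (Black n → ℂ) → ℂ
  sumᴮ-syntax _ = ∑ₓ

  infixl 10 sumᵂ-syntax sumᴮ-syntax
  syntax sumᵂ-syntax n (λ x → z) = ∑[ x ∈W n ] z
  syntax sumᴮ-syntax n (λ x → z) = ∑[ x ∈B n ] z

  -- Membership in W_ε or B_ε.
  _∈ᵇ_ : ℕ × ℕ → Fin 2 → Bool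
  (x₁ , x₂) ∈ᵇ ε = (x₁ ℕ.+ x₂) ℕ.% 4 ≡ᵇ 2 ℕ.* toℕ ε ℕ.+ 1

  -- The ε with x ∈ W_ε or x ∈ B_ε; the coordinate sum of a vertex is odd.
  class : ℕ × ℕ → Fin 2
  class x = if x ∈ᵇ 1F then 1F else 0F

  _==_ : ℕ × ℕ → ℕ × ℕ → Bool
  (x₁ , x₂) == (y₁ , y₂) = (x₁ ≡ᵇ y₁) ∧ (x₂ ≡ᵇ y₂)

  ι : Fin 2 → ℝ.Carrier
  ι 0F = ℝ.0#
  ι 1F = ℝ.1#

  -- At most one of the four conditions holds.  They say that y is x + e₁,
  -- x + e₂, x - e₁, x - e₂ respectively, rearranged so as not to subtract
  -- natural numbers.
  K : ∀ n → ℝ₊ → ℝ₊ → Black n → White n → ℂ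
  K n (α , _) (β , _) x y =
      (⌜ α ℝ.* (ℝ.1# ℝ.- ε) ℝ.+ β ℝ.* ε ⌝     when (x₁ ℕ.+ 1 , x₂ ℕ.+ 1) == (y₁ , y₂))
    + (⌜ α ℝ.* ε ℝ.+ β ℝ.* (ℝ.1# ℝ.- ε) ⌝ * 𝕚 when (x₁ , x₂ ℕ.+ 1) == (y₁ ℕ.+ 1 , y₂))
    + (⌜ α ℝ.* ε ℝ.+ β ℝ.* (ℝ.1# ℝ.- ε) ⌝     when (x₁ , x₂) == (y₁ ℕ.+ 1 , y₂ ℕ.+ 1))
    + (⌜ α ℝ.* (ℝ.1# ℝ.- ε) ℝ.+ β ℝ.* ε ⌝ * 𝕚 when (x₁ ℕ.+ 1 , x₂) == (y₁ , y₂ ℕ.+ 1))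
    where
    x₁ = proj₁ (posᴮ x)
    x₂ = proj₂ (posᴮ x)
    y₁ = proj₁ (posᵂ y)
    y₂ = proj₂ (posᵂ y)
    ε  = ι (class (posᴮ x))

  𝟙 : ∀ {k l} → Fin k × Fin l → Fin k × Fin l → ℂ
  𝟙 (i , j) (i′ , j′) = 1# when does (i Fin.≟ i′) ∧ does (j Fin.≟ j′)

  IsInverse : ∀ {n} → (Black n → White n → ℂ) → (White n → Black n → ℂ) → Set ℓ₁
  IsInverse {n} A A⁻¹ =
    (∀ x z → ∑[ y ∈W n ] (A x y * A⁻¹ y z) ≈ 𝟙 x z) ×
    (∀ x z → ∑[ y ∈B n ] (A⁻¹ x y * A y z) ≈ 𝟙 x z)

  module Invertibility where
    open import Algebra.Properties.Semiring.Sum ℂᴿ.semiring public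
      using (sum-cong-≋; ∑-comm; ∑-distrib-+; *-distribˡ-sum; *-distribʳ-sum; sum-replicate-zero)
    open IntegerCoefficients ℂ-commutativeRing public
    module R = IntegerCoefficients ℝ.commutativeRing
    open import Relation.Binary.Reasoning.Setoid ℂᴿ.setoid public

    recip₊ : ℝ₊ → ℝ₊
    recip₊ (x , 0<x) = proj₁ (ℝₚ.recip-pos 0<x) , proj₁ (proj₂ (ℝₚ.recip-pos 0<x))

    _*₊_ _+₊_ : ℝ₊ → ℝ₊ → ℝ₊
    (x , 0<x) *₊ (y , 0<y) = x ℝ.* y , ℝ.*-pos 0<x 0<y
    (x , 0<x) +₊ (y , 0<y) = x ℝ.+ y , ℝₚ.+-pos 0<x 0<y

    Δ : (a b c d : ℝ₊) → ℝ₊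
    Δ a b c d = (a *₊ c) +₊ (b *₊ d)

    opaque
      unfolding ⌜_⌝

      ⌜*⌝ : ∀ x y → ⌜ x ℝ.* y ⌝ ≈ ⌜ x ⌝ * ⌜ y ⌝
      ⌜*⌝ x y =
        R.solve 2 (λ x y → x R.:* y R.:= x R.:* y R.:- R.con (+ 0) R.:* R.con (+ 0)) ℝ.refl x y ,
        R.solve 2 (λ x y → R.con (+ 0) R.:= x R.:* R.con (+ 0) R.:+ R.con (+ 0) R.:* y) ℝ.refl x y

      det : ∀ a b c d → ⌜ proj₁ (recip₊ (Δ a b c d)) ⌝
              * (⌜ proj₁ a ⌝ * ⌜ proj₁ c ⌝ - (𝕚 * ⌜ proj₁ d ⌝) * (𝕚 * ⌜ proj₁ b ⌝)) ≈ 1#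
      det (a , 0<a) (b , 0<b) (c , 0<c) (d , 0<d) =
        ℝ.trans (R.solve 5 (λ a b c d e →
            let o = R.con (+ 0) ; l = R.con (+ 1)
                ac = a R.:* c R.:- o R.:* o
                ac′ = a R.:* o R.:+ o R.:* c
                re′ = λ x → o R.:* x R.:- l R.:* o
                im′ = λ x → o R.:* o R.:+ l R.:* x
                re″ = ac R.:+ (R.:- (re′ d R.:* re′ b R.:- im′ d R.:* im′ b))
                im″ = ac′ R.:+ (R.:- (re′ d R.:* im′ b R.:+ im′ d R.:* re′ b))
            in e R.:* re″ R.:- o R.:* im″ R.:= e R.:* (a R.:* c R.:+ b R.:* d)) ℝ.refl a b c d e)
          (proj₂ (proj₂ (ℝₚ.recip-pos (proj₂ (Δ (a , 0<a) (b , 0<b) (c , 0<c) (d , 0<d)))))) ,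
        R.solve 5 (λ a b c d e →
            let o = R.con (+ 0) ; l = R.con (+ 1)
                ac = a R.:* c R.:- o R.:* o
                ac′ = a R.:* o R.:+ o R.:* c
                re′ = λ x → o R.:* x R.:- l R.:* o
                im′ = λ x → o R.:* o R.:+ l R.:* x
                re″ = ac R.:+ (R.:- (re′ d R.:* re′ b R.:- im′ d R.:* im′ b))
                im″ = ac′ R.:+ (R.:- (re′ d R.:* im′ b R.:+ im′ d R.:* re′ b))
            in e R.:* im″ R.:+ o R.:* re″ R.:= R.con (+ 0)) ℝ.refl a b c d e
        where
        e : ℝ.Carrier
        e = proj₁ (recip₊ (Δ (a , 0<a) (b , 0<b) (c , 0<c) (d , 0<d)))

    weightSystem : WeightSystem ℂ-commutativeRing (c ⊔ ℓ₂)
    weightSystem = record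
      { Weight = ℝ₊
      ; ⟨_⟩    = λ x → ⌜ proj₁ x ⌝
      ; 𝕚      = 𝕚
      ; _*₊_   = _*₊_
      ; ⟨*⟩    = λ x y → ⌜*⌝ (proj₁ x) (proj₁ y)
      ; δ      = λ a b c d → recip₊ (Δ a b c d)
      ; det    = det
      }

    open UrbanRenewal ℂ-commutativeRing weightSystem public
      using (Weights; row; existence; uniqueness; rightBefore; leftOf; rightOf)

    when-cong : ∀ b {z w} → z ≈ w → (z when b) ≈ (w when b)
    when-cong true  z≈w = z≈w
    when-cong false z≈w = refl

    when-≡ : ∀ {b b′} z → b ≡ b′ → (z when b) ≈ (z when b′)
    when-≡ z ≡.refl = refl

    when-*ʳ : ∀ b z w → (z when b) * w ≈ (z * w when b)
    when-*ʳ true  z w = refl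
    when-*ʳ false z w = ℂᴿ.zeroˡ w

    when-*ˡ : ∀ b z w → w * (z when b) ≈ (w * z when b)
    when-*ˡ true  z w = refl
    when-*ˡ false z w = ℂᴿ.zeroʳ w

    when-+ : ∀ b z w → (z when b) + (w when b) ≈ (z + w when b)
    when-+ true  z w = refl
    when-+ false z w = +-identityˡ 0#

    sum-cong : ∀ {k} {f g : Fin k → ℂ} → (∀ i → f i ≈ g i) → sum-syntax k f ≈ sum-syntax k g
    sum-cong = sum-cong-≋

    ∑ₓ-cong : ∀ {k l} {f g : Fin k × Fin l → ℂ} → (∀ x → f x ≈ g x) → ∑ₓ f ≈ ∑ₓ g
    ∑ₓ-cong f≈g = sum-cong (λ i → sum-cong (λ j → f≈g (i , j)))

    ∑ₓ-+ : ∀ {k l} (f g : Fin k × Fin l → ℂ) → ∑ₓ (λ x → f x + g x) ≈ ∑ₓ f + ∑ₓ g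
    ∑ₓ-+ {k} {l} f g = trans
      (sum-cong {k} (λ i → ∑-distrib-+ (λ j → f (i , j)) (λ j → g (i , j))))
      (∑-distrib-+ (λ i → ∑[ j < l ] f (i , j)) (λ i → ∑[ j < l ] g (i , j)))

    ∑ₓ-*ˡ : ∀ {k l} z (f : Fin k × Fin l → ℂ) → z * ∑ₓ f ≈ ∑ₓ (λ x → z * f x)
    ∑ₓ-*ˡ {k} {l} z f = trans (*-distribˡ-sum z (λ i → ∑[ j < l ] f (i , j)))
                              (sum-cong (λ i → *-distribˡ-sum z (λ j → f (i , j))))

    ∑ₓ-*ʳ : ∀ {k l} z (f : Fin k × Fin l → ℂ) → ∑ₓ f * z ≈ ∑ₓ (λ x → f x * z)
    ∑ₓ-*ʳ z f = trans (*-comm _ _) (trans (∑ₓ-*ˡ z f) (∑ₓ-cong (λ x → *-comm z (f x))))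

    ∑ₓ-neg : ∀ {k l} (f : Fin k × Fin l → ℂ) → ∑ₓ (λ x → - f x) ≈ - ∑ₓ f
    ∑ₓ-neg f = trans (∑ₓ-cong (λ x → solve 1 (λ x → :- x := :- con (+ 1) :* x) refl (f x)))
                 (trans (sym (∑ₓ-*ˡ (- 1#) f)) (solve 1 (λ x → :- con (+ 1) :* x := :- x) refl (∑ₓ f)))

    ∑ₓ-comm : ∀ {k l k′ l′} (f : Fin k × Fin l → Fin k′ × Fin l′ → ℂ) →
              ∑ₓ (λ x → ∑ₓ (f x)) ≈ ∑ₓ (λ y → ∑ₓ (λ x → f x y))
    ∑ₓ-comm {k} {l} {k′} {l′} f = trans
      (swap (λ x i′ → ∑[ j′ < l′ ] f x (i′ , j′)))
      (sum-cong (λ i′ → swap (λ x j′ → f x (i′ , j′))))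
      where
      swap : ∀ {n} (g : Fin k × Fin l → Fin n → ℂ) →
             ∑ₓ (λ x → ∑[ i < n ] g x i) ≈ ∑[ i < n ] ∑ₓ (λ x → g x i)
      swap g = trans (sum-cong (λ i → ∑-comm (λ j → g (i , j)))) (∑-comm (λ i i′ → ∑[ j < l ] g (i , j) i′))

    ∑-pick : ∀ n (F : ℕ → ℂ) k → ∑[ t < n ] (F (toℕ t) when k ≡ᵇ toℕ t) ≈ (F k when k <ᵇ n)
    ∑-pick zero    F k       = refl
    ∑-pick (suc n) F zero    = trans (+-congˡ (sum-replicate-zero n)) (+-identityʳ _)
    ∑-pick (suc n) F (suc k) = trans (+-identityˡ _) (∑-pick n (λ t → F (suc t)) k)

    ∑ₓ-pick : ∀ k l (F : ℕ → ℕ → ℂ) s t →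
      ∑ₓ {k} {l} (λ (i , j) → F (toℕ i) (toℕ j) when (s ≡ᵇ toℕ i) ∧ (t ≡ᵇ toℕ j))
        ≈ (F s t when (s <ᵇ k) ∧ (t <ᵇ l))
    ∑ₓ-pick k l F s t = begin
      ∑ₓ {k} {l} (λ (i , j) → F (toℕ i) (toℕ j) when (s ≡ᵇ toℕ i) ∧ (t ≡ᵇ toℕ j))
        ≈⟨ sum-cong {k} (λ i → inner (toℕ i) (s ≡ᵇ toℕ i)) ⟩
      ∑[ i < k ] ((F (toℕ i) t when t <ᵇ l) when s ≡ᵇ toℕ i)
        ≈⟨ ∑-pick k (λ i → F i t when t <ᵇ l) s ⟩
      ((F s t when t <ᵇ l) when s <ᵇ k)
        ≈⟨ merge (s <ᵇ k) ⟩
      (F s t when (s <ᵇ k) ∧ (t <ᵇ l)) ∎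
      where
      merge : ∀ b → ((F s t when t <ᵇ l) when b) ≈ (F s t when b ∧ (t <ᵇ l))
      merge true  = refl
      merge false = refl
      inner : ∀ i b → ∑[ j < l ] (F i (toℕ j) when b ∧ (t ≡ᵇ toℕ j)) ≈ ((F i t when t <ᵇ l) when b)
      inner i true  = ∑-pick l (F i) t
      inner i false = sum-replicate-zero l

    ≟-≡ᵇ : ∀ {n} (i j : Fin n) → does (i Fin.≟ j) ≡ (toℕ i ≡ᵇ toℕ j)
    ≟-≡ᵇ zero    zero    = ≡.refl
    ≟-≡ᵇ zero    (suc j) = ≡.refl
    ≟-≡ᵇ (suc i) zero    = ≡.refl
    ≟-≡ᵇ (suc i) (suc j) = ≟-≡ᵇ i j

    <ᵇ-true : ∀ {m n} → m ℕ.< n → (m <ᵇ n) ≡ true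
    <ᵇ-true {zero}  {suc n} _         = ≡.refl
    <ᵇ-true {suc m} {suc n} (s≤s m<n) = <ᵇ-true m<n

    extend : ∀ {k l} → (Fin k × Fin l → ℂ) → ℕ → ℕ → ℂ
    extend {k} {l} f s t with s ℕₚ.<? k | t ℕₚ.<? l
    ... | yes s<k | yes t<l = f (Fin.fromℕ< s<k , Fin.fromℕ< t<l)
    ... | _       | _       = 0#

    extend-≡ : ∀ {k l} (f : Fin k × Fin l → ℂ) i j → extend f (toℕ i) (toℕ j) ≡ f (i , j)
    extend-≡ {k} {l} f i j with toℕ i ℕₚ.<? k | toℕ j ℕₚ.<? l
    ... | yes i<k | yes j<l = ≡.cong₂ (λ i j → f (i , j)) (Fin.fromℕ<-toℕ i i<k) (Fin.fromℕ<-toℕ j j<l)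
    ... | no i≮k  | _       = contradiction (Fin.toℕ<n i) i≮k
    ... | yes _   | no j≮l  = contradiction (Fin.toℕ<n j) j≮l

    𝟙-pick : ∀ {k l} (f : Fin k × Fin l → ℂ) x → ∑ₓ (λ y → 𝟙 x y * f y) ≈ f x
    𝟙-pick {k} {l} f x@(i , j) = begin
      ∑ₓ (λ y → 𝟙 x y * f y)
        ≈⟨ ∑ₓ-cong (λ (i′ , j′) → trans (when-*ʳ (does (i Fin.≟ i′) ∧ does (j Fin.≟ j′)) 1# (f (i′ , j′)))
             (trans (when-≡ _ (≡.cong₂ _∧_ (≟-≡ᵇ i i′) (≟-≡ᵇ j j′)))
               (when-cong ((toℕ i ≡ᵇ toℕ i′) ∧ (toℕ j ≡ᵇ toℕ j′))
                 (trans (*-identityˡ _) (ℂᴿ.reflexive (≡.sym (extend-≡ f i′ j′))))))) ⟩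
      ∑ₓ {k} {l} (λ (i′ , j′) → extend f (toℕ i′) (toℕ j′) when (toℕ i ≡ᵇ toℕ i′) ∧ (toℕ j ≡ᵇ toℕ j′))
        ≈⟨ ∑ₓ-pick k l (extend f) (toℕ i) (toℕ j) ⟩
      (extend f (toℕ i) (toℕ j) when (toℕ i <ᵇ k) ∧ (toℕ j <ᵇ l))
        ≈⟨ when-≡ _ (≡.cong₂ _∧_ (<ᵇ-true (Fin.toℕ<n i)) (<ᵇ-true (Fin.toℕ<n j))) ⟩
      extend f (toℕ i) (toℕ j)
        ≡⟨ extend-≡ f i j ⟩
      f x ∎

    T-ext : ∀ {b b′} → (T b → T b′) → (T b′ → T b) → b ≡ b′
    T-ext {true}  {true}  _ _ = ≡.refl
    T-ext {false} {false} _ _ = ≡.refl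
    T-ext {true}  {false} f _ = ⊥-elim (f _)
    T-ext {false} {true}  _ g = ⊥-elim (g _)

    ≡ᵇ-injective : ∀ (φ : ℕ → ℕ) → (∀ {m n} → φ m ≡ φ n → m ≡ n) → ∀ m n → (φ m ≡ᵇ φ n) ≡ (m ≡ᵇ n)
    ≡ᵇ-injective φ inj m n = T-ext
      (λ p → ℕₚ.≡⇒≡ᵇ m n (inj (ℕₚ.≡ᵇ⇒≡ (φ m) (φ n) p)))
      (λ p → ℕₚ.≡⇒≡ᵇ (φ m) (φ n) (≡.cong φ (ℕₚ.≡ᵇ⇒≡ m n p)))

    even-even : ∀ m n → (2 ℕ.* m ≡ᵇ 2 ℕ.* n) ≡ (m ≡ᵇ n)
    even-even = ≡ᵇ-injective (2 ℕ.*_) (ℕₚ.*-cancelˡ-≡ _ _ 2)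

    odd-odd : ∀ m n → (2 ℕ.* m ℕ.+ 1 ≡ᵇ 2 ℕ.* n ℕ.+ 1) ≡ (m ≡ᵇ n)
    odd-odd = ≡ᵇ-injective (λ m → 2 ℕ.* m ℕ.+ 1) (λ eq → ℕₚ.*-cancelˡ-≡ _ _ 2 (ℕₚ.+-cancelʳ-≡ 1 _ _ eq))

    odd+1 : ∀ m → 2 ℕ.* m ℕ.+ 1 ℕ.+ 1 ≡ 2 ℕ.* suc m
    odd+1 m = ≡.trans (ℕₚ.+-assoc (2 ℕ.* m) 1 1) (≡.trans (ℕₚ.+-comm (2 ℕ.* m) 2) (≡.sym (ℕₚ.*-suc 2 m)))

    odd+1-even : ∀ m n → (2 ℕ.* m ℕ.+ 1 ℕ.+ 1 ≡ᵇ 2 ℕ.* n) ≡ (suc m ≡ᵇ n)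
    odd+1-even m n = ≡.trans (≡.cong (_≡ᵇ 2 ℕ.* n) (odd+1 m)) (even-even (suc m) n)

    even-odd+1 : ∀ m n → (2 ℕ.* m ≡ᵇ 2 ℕ.* n ℕ.+ 1 ℕ.+ 1) ≡ (m ≡ᵇ suc n)
    even-odd+1 m n = ≡.trans (≡.cong (2 ℕ.* m ≡ᵇ_) (odd+1 n)) (even-even m (suc n))

    module _ (n : ℕ) (α β : ℝ₊) where

      mixed : ℝ₊ → ℝ₊ → Fin 2 → ℝ.Carrier
      mixed (x , _) (y , _) ε = x ℝ.* (ℝ.1# ℝ.- ι ε) ℝ.+ y ℝ.* ι ε

      mixed′ : ℝ₊ → ℝ₊ → Fin 2 → ℝ.Carrier
      mixed′ (x , _) (y , _) ε = x ℝ.* ι ε ℝ.+ y ℝ.* (ℝ.1# ℝ.- ι ε)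

      mixed-pos : ∀ x y ε → ℝ.0# ℝ.< mixed x y ε
      mixed-pos (x , 0<x) (y , 0<y) 0F = ℝₚ.<-respʳ
        (R.solve 2 (λ x y → x R.:= x R.:* (R.con (+ 1) R.:- R.con (+ 0)) R.:+ y R.:* R.con (+ 0)) ℝ.refl x y) 0<x
      mixed-pos (x , 0<x) (y , 0<y) 1F = ℝₚ.<-respʳ
        (R.solve 2 (λ x y → y R.:= x R.:* (R.con (+ 1) R.:- R.con (+ 1)) R.:+ y R.:* R.con (+ 1)) ℝ.refl x y) 0<y

      mixed′-pos : ∀ x y ε → ℝ.0# ℝ.< mixed′ x y ε
      mixed′-pos x y ε = ℝₚ.<-respʳ (ℝ.+-comm _ _) (mixed-pos y x ε)

      classAt : ℕ → ℕ → Fin 2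
      classAt i j = class (2 ℕ.* i , 2 ℕ.* j ℕ.+ 1)

      outer inner : ℕ → ℕ → ℝ₊
      outer i j = mixed  α β (classAt i j) , mixed-pos  α β (classAt i j)
      inner i j = mixed′ α β (classAt i j) , mixed′-pos α β (classAt i j)

      weights : Weights
      weights = record { A = outer ; B = λ i → inner (suc i) ; C = λ i → inner (suc i) ; D = outer }

      K-row : ∀ (f : ℕ → ℕ → ℂ) x →
        ∑[ y ∈W n ] (K n α β x y * f (toℕ (proj₁ y)) (toℕ (proj₂ y)))
          ≈ row n weights f (toℕ (proj₁ x)) (toℕ (proj₂ x))
      K-row f x@(i , j) = begin
        ∑ₓ (λ y → K n α β x y * F y)
          ≈⟨ ∑ₓ-cong (λ y → let k = proj₁ y ; l = proj₂ y in trans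
               (solve 5 (λ a b c d f → (a :+ b :+ c :+ d) :* f := a :* f :+ b :* f :+ c :* f :+ d :* f) refl _ _ _ _ (F y))
               (+-cong (+-cong (+-cong
                 (move (p ⟨·⟩ y) (≡.cong₂ _∧_ (odd-odd I (toℕ k)) (odd+1-even J (toℕ l))))
                 (move (p′𝕚 ⟨·⟩ y) (≡.cong₂ _∧_ (even-odd+1 I (toℕ k)) (odd+1-even J (toℕ l)))))
                 (move (p′ ⟨·⟩ y) (≡.cong₂ _∧_ (even-odd+1 I (toℕ k)) (odd-odd J (toℕ l)))))
                 (move (p𝕚 ⟨·⟩ y) (≡.cong₂ _∧_ (odd-odd I (toℕ k)) (odd-odd J (toℕ l))))) ) ⟩
        ∑ₓ (λ y → t₁ y + t₂ y + t₃ y + t₄ y)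
          ≈⟨ trans (∑ₓ-+ (λ y → t₁ y + t₂ y + t₃ y) t₄)
               (+-congʳ (trans (∑ₓ-+ (λ y → t₁ y + t₂ y) t₃) (+-congʳ (∑ₓ-+ t₁ t₂)))) ⟩
        ∑ₓ t₁ + ∑ₓ t₂ + ∑ₓ t₃ + ∑ₓ t₄
          ≈⟨ +-cong (+-cong (+-cong
               (pick p I (suc J) (s≤s J<n))
               (before p′𝕚 (suc J) (s≤s J<n)))
               (before p′ J (ℕₚ.m<n⇒m<1+n J<n)))
               (pick p𝕚 I J (ℕₚ.m<n⇒m<1+n J<n)) ⟩
        (p * f I (suc J) when I <ᵇ n) + prev p′𝕚 (suc J) I + prev p′ J I + (p𝕚 * f I J when I <ᵇ n)
          ≈⟨ solve 4 (λ a b c d → a :+ b :+ c :+ d := (b :+ c) :+ (a :+ d)) refl _ _ _ _ ⟩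
        (prev p′𝕚 (suc J) I + prev p′ J I) + ((p * f I (suc J) when I <ᵇ n) + (p𝕚 * f I J when I <ᵇ n))
          ≈⟨ +-cong (rightBefore≈ I ≡.refl) (trans (when-+ (I <ᵇ n) _ _)
               (when-cong (I <ᵇ n) (+-congˡ (*-congʳ (*-comm _ _))))) ⟩
        row n weights f I J ∎
        where
        I = toℕ i
        J = toℕ j
        J<n = Fin.toℕ<n j
        I<1+n = Fin.toℕ<n i
        F : White n → ℂ
        F y = f (toℕ (proj₁ y)) (toℕ (proj₂ y))
        p p𝕚 p′ p′𝕚 : ℂ
        p   = ⌜ proj₁ (outer I J) ⌝
        p𝕚  = ⌜ proj₁ (outer I J) ⌝ * 𝕚
        p′  = ⌜ proj₁ (inner I J) ⌝
        p′𝕚 = ⌜ proj₁ (inner I J) ⌝ * 𝕚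
        _⟨·⟩_ : ℂ → White n → ℂ × ℂ
        z ⟨·⟩ y = z , F y
        move : ∀ (zw : ℂ × ℂ) {b b′} → b ≡ b′ → (proj₁ zw when b) * proj₂ zw ≈ (proj₁ zw * proj₂ zw when b′)
        move (z , w) {b} ≡.refl = when-*ʳ b z w
        t₁ t₂ t₃ t₄ : White n → ℂ
        t₁ (k , l) = p   * F (k , l) when (I ≡ᵇ toℕ k)       ∧ (suc J ≡ᵇ toℕ l)
        t₂ (k , l) = p′𝕚 * F (k , l) when (I ≡ᵇ suc (toℕ k)) ∧ (suc J ≡ᵇ toℕ l)
        t₃ (k , l) = p′  * F (k , l) when (I ≡ᵇ suc (toℕ k)) ∧ (J ≡ᵇ toℕ l)
        t₄ (k , l) = p𝕚  * F (k , l) when (I ≡ᵇ toℕ k)       ∧ (J ≡ᵇ toℕ l)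
        prev : ℂ → ℕ → ℕ → ℂ
        prev z t zero    = 0#
        prev z t (suc s) = z * f s t
        ∧-true : ∀ b {b′} → b′ ≡ true → (b ∧ b′) ≡ b
        ∧-true true  eq = eq
        ∧-true false eq = ≡.refl
        pick : ∀ z s t → t ℕ.< suc n →
          ∑ₓ {n} {suc n} (λ (k , l) → z * F (k , l) when (s ≡ᵇ toℕ k) ∧ (t ≡ᵇ toℕ l))
            ≈ (z * f s t when s <ᵇ n)
        pick z s t t<1+n = trans (∑ₓ-pick n (suc n) (λ k l → z * f k l) s t)
          (when-≡ _ (∧-true (s <ᵇ n) (<ᵇ-true t<1+n)))
        before′ : ∀ z t → t ℕ.< suc n → ∀ s → s ℕ.< suc n →
          ∑ₓ {n} {suc n} (λ (k , l) → z * F (k , l) when (s ≡ᵇ suc (toℕ k)) ∧ (t ≡ᵇ toℕ l))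
            ≈ prev z t s
        before′ z t t<1+n zero    _         =
          trans (sum-cong {n} (λ _ → sum-replicate-zero (suc n))) (sum-replicate-zero n)
        before′ z t t<1+n (suc s) (s≤s s<n) = trans (pick z s t t<1+n) (when-≡ _ (<ᵇ-true s<n))
        before : ∀ z t → t ℕ.< suc n →
          ∑ₓ {n} {suc n} (λ (k , l) → z * F (k , l) when (I ≡ᵇ suc (toℕ k)) ∧ (t ≡ᵇ toℕ l))
            ≈ prev z t I
        before z t t<1+n = before′ z t t<1+n I I<1+n
        rightBefore≈ : ∀ s → s ≡ I → prev p′𝕚 (suc J) s + prev p′ J s ≈ rightBefore weights f s J
        rightBefore≈ zero    _  = +-identityˡ _
        rightBefore≈ (suc s) eq = +-cong
          (*-congʳ (trans (*-comm _ _) (ℂᴿ.reflexive (≡.cong (λ s → 𝕚 * ⌜ proj₁ (inner s J) ⌝) (≡.sym eq)))))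
          (*-congʳ (ℂᴿ.reflexive (≡.cong (λ s → ⌜ proj₁ (inner s J) ⌝) (≡.sym eq))))

      K-injective : ∀ (f : White n → ℂ) → (∀ x → ∑[ y ∈W n ] (K n α β x y * f y) ≈ 0#) → ∀ y → f y ≈ 0#
      K-injective f Kf≈0 (k , l) = trans (ℂᴿ.reflexive (≡.sym (extend-≡ f k l)))
        (uniqueness n weights (extend f) rows (toℕ k) (toℕ l) (Fin.toℕ<n k) (ℕₚ.≤-pred (Fin.toℕ<n l)))
        where
        rowsFin : ∀ x → row n weights (extend f) (toℕ (proj₁ x)) (toℕ (proj₂ x)) ≈ 0#
        rowsFin x = begin
          row n weights (extend f) (toℕ (proj₁ x)) (toℕ (proj₂ x))
            ≈⟨ K-row (extend f) x ⟨
          ∑[ y ∈W n ] (K n α β x y * extend f (toℕ (proj₁ y)) (toℕ (proj₂ y)))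
            ≈⟨ ∑ₓ-cong (λ (k , l) → *-congˡ {K n α β x (k , l)} (ℂᴿ.reflexive (extend-≡ f k l))) ⟩
          ∑[ y ∈W n ] (K n α β x y * f y)
            ≈⟨ Kf≈0 x ⟩
          0# ∎
        rows : ∀ i j → i ℕ.≤ n → j ℕ.< n → row n weights (extend f) i j ≈ 0#
        rows i j i≤n j<n = ≡.subst₂ (λ i j → row n weights (extend f) i j ≈ 0#)
          (Fin.toℕ-fromℕ< (s≤s i≤n)) (Fin.toℕ-fromℕ< j<n)
          (rowsFin (Fin.fromℕ< (s≤s i≤n) , Fin.fromℕ< j<n))

      column : (x : Black n) → ∃[ f ] ∀ i j → i ℕ.≤ n → j ℕ.< n → row n weights f i j ≈ extend (λ z → 𝟙 z x) i j
      column x = existence n weights (extend (λ z → 𝟙 z x))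

      inverse : White n → Black n → ℂ
      inverse (k , l) x = proj₁ (column x) (toℕ k) (toℕ l)

      right-inverse : ∀ x z → ∑[ y ∈W n ] (K n α β x y * inverse y z) ≈ 𝟙 x z
      right-inverse x@(i , j) z = begin
        ∑[ y ∈W n ] (K n α β x y * inverse y z)
          ≈⟨ K-row (proj₁ (column z)) x ⟩
        row n weights (proj₁ (column z)) (toℕ i) (toℕ j)
          ≈⟨ proj₂ (column z) (toℕ i) (toℕ j) (ℕₚ.≤-pred (Fin.toℕ<n i)) (Fin.toℕ<n j) ⟩
        extend (λ w → 𝟙 w z) (toℕ i) (toℕ j)
          ≡⟨ extend-≡ (λ w → 𝟙 w z) i j ⟩
        𝟙 x z ∎

      left-inverse : ∀ x z → ∑[ y ∈B n ] (inverse x y * K n α β y z) ≈ 𝟙 x z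
      left-inverse x z = begin
        ∑[ y ∈B n ] (inverse x y * K n α β y z)
          ≈⟨ solve 2 (λ p q → p := p :- q :+ q) refl (P x) (𝟙 x z) ⟩
        P x - 𝟙 x z + 𝟙 x z
          ≈⟨ +-congʳ (K-injective (λ w → P w - 𝟙 w z) K-kills x) ⟩
        0# + 𝟙 x z
          ≈⟨ +-identityˡ _ ⟩
        𝟙 x z ∎
        where
        P : White n → ℂ
        P w = ∑[ y ∈B n ] (inverse w y * K n α β y z)
        𝟙-sym : ∀ {k l} (u v : Fin k × Fin l) → 𝟙 u v ≈ 𝟙 v u
        𝟙-sym (i , j) (i′ , j′) = when-≡ 1# (≡.cong₂ _∧_ (flip i i′) (flip j j′))
          where
          flip : ∀ {n} (i j : Fin n) → does (i Fin.≟ j) ≡ does (j Fin.≟ i)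
          flip i j with i Fin.≟ j | j Fin.≟ i
          ... | yes _   | yes _   = ≡.refl
          ... | no _    | no _    = ≡.refl
          ... | yes i≡j | no j≢i  = contradiction (≡.sym i≡j) j≢i
          ... | no i≢j  | yes j≡i = contradiction (≡.sym j≡i) i≢j
        K-kills : ∀ x → ∑[ w ∈W n ] (K n α β x w * (P w - 𝟙 w z)) ≈ 0#
        K-kills x = begin
          ∑[ w ∈W n ] (K n α β x w * (P w - 𝟙 w z))
            ≈⟨ ∑ₓ-cong expand ⟩
          ∑[ w ∈W n ] (∑ₓ (product w) + - (𝟙 z w * K n α β x w))
            ≈⟨ trans (∑ₓ-+ (λ w → ∑ₓ (product w)) (λ w → - (𝟙 z w * K n α β x w)))
                 (+-congˡ (∑ₓ-neg (λ w → 𝟙 z w * K n α β x w))) ⟩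
          ∑[ w ∈W n ] ∑ₓ (product w) - ∑[ w ∈W n ] (𝟙 z w * K n α β x w)
            ≈⟨ +-cong (trans (∑ₓ-comm product) (∑ₓ-cong collect)) (-‿cong (𝟙-pick (λ w → K n α β x w) z)) ⟩
          ∑[ y ∈B n ] (𝟙 x y * K n α β y z) - K n α β x z
            ≈⟨ +-congʳ (𝟙-pick (λ y → K n α β y z) x) ⟩
          K n α β x z - K n α β x z
            ≈⟨ ℂᴿ.-‿inverseʳ _ ⟩
          0# ∎
          where
          product : White n → Black n → ℂ
          product w y = (K n α β x w * inverse w y) * K n α β y z
          expand : ∀ w → K n α β x w * (P w - 𝟙 w z) ≈ ∑ₓ (product w) + - (𝟙 z w * K n α β x w)
          expand w = trans
            (solve 3 (λ k p q → k :* (p :- q) := k :* p :+ :- (q :* k)) refl (K n α β x w) (P w) (𝟙 w z))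
            (+-cong
              (trans (∑ₓ-*ˡ (K n α β x w) (λ y → inverse w y * K n α β y z))
                     (∑ₓ-cong (λ y → sym (*-assoc (K n α β x w) (inverse w y) (K n α β y z)))))
              (-‿cong (*-congʳ (𝟙-sym w z))))
          collect : ∀ y → ∑ₓ (λ w → product w y) ≈ 𝟙 x y * K n α β y z
          collect y = trans (sym (∑ₓ-*ʳ (K n α β y z) (λ w → K n α β x w * inverse w y)))
                            (*-congʳ (right-inverse x y))

  abstract
    K-invertible : ∀ n α β → ∃[ K⁻¹ ] IsInverse (K n α β) K⁻¹
    K-invertible n α β = Invertibility.inverse n α β , Invertibility.right-inverse n α β , Invertibility.left-inverse n α β

  K⁻¹ : ∀ n → ℝ₊ → ℝ₊ → White n → Black n → ℂ
  K⁻¹ n α β = proj₁ (K-invertible n α β)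

  K⁻¹-isInverse : ∀ n α β → IsInverse (K n α β) (K⁻¹ n α β)
  K⁻¹-isInverse n α β = proj₂ (K-invertible n α β)

  -- The indices are those of (2i+1 , 0) and (0 , 2j+1), so 0 ≤ i , j < n.  For
  -- x₁ = 2i+1 the index n - (x₁+1)/2 is opposite i.
  L : ∀ n → ℝ₊ → ℝ₊ → Fin n → Fin n → ℂ
  L n α β i j = K⁻¹ n α β (i , zero) (zero , j)

  -- A side κ stands for the coordinate 2nκ: sideᵂ κ i is (2i+1 , 2nκ) and
  -- sideᴮ κ j is (2nκ , 2j+1).
  sideᵂ : ∀ {n} → Fin 2 → Fin n → White n
  sideᵂ     0F i = i , zero
  sideᵂ {n} 1F i = i , Fin.fromℕ n

  sideᴮ : ∀ {n} → Fin 2 → Fin n → Black n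
  sideᴮ     0F j = zero , j
  sideᴮ {n} 1F j = Fin.fromℕ n , j

  record NonZero (z : ℂ) : Set ℓ₂ where
    constructor nonZero
    field
      z#0 : z # 0#

  infix  8 _⁻¹
  infixl 7 _/_
  infixr 8 _^-_

  _⁻¹ : ∀ z → ⦃ NonZero z ⦄ → ℂ
  (z ⁻¹) ⦃ nonZero z#0 ⦄ = proj₁ (#⇒invertible z#0)

  _/_ : ∀ z w → ⦃ NonZero w ⦄ → ℂ
  z / w = z * w ⁻¹

  _^-_ : ∀ z → ⦃ NonZero z ⦄ → ℕ → ℂ
  z ^- k = (z ⁻¹) ^ k

  ⁻¹-inverseˡ : ∀ z → ⦃ _ : NonZero z ⦄ → z ⁻¹ * z ≈ 1#
  ⁻¹-inverseˡ z ⦃ nonZero z#0 ⦄ = trans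
    (Invertibility.solve 2 (λ u z → u Invertibility.:* z Invertibility.:= u Invertibility.:* (z Invertibility.:- Invertibility.con (+ 0))) refl _ z)
    (proj₁ (proj₂ (#⇒invertible z#0)))

  instance
    *-nonZero : ∀ {z w} → ⦃ NonZero z ⦄ → ⦃ NonZero w ⦄ → NonZero (z * w)
    *-nonZero {z} {w} = nonZero (invertible⇒# (z ⁻¹ * w ⁻¹ , left , trans (*-comm _ _) left))
      where
      open Invertibility using (solve; _:*_; _:-_; _:=_; con)
      left : z ⁻¹ * w ⁻¹ * (z * w - 0#) ≈ 1#
      left = trans
        (solve 4 (λ z w u v → u :* v :* (z :* w :- con (+ 0)) := (u :* z) :* (v :* w)) refl z w (z ⁻¹) (w ⁻¹))
        (trans (*-cong (⁻¹-inverseˡ z) (⁻¹-inverseˡ w)) (*-identityˡ 1#))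

  X₁ : ∀ {n} → White n → ℕ
  X₁ x = proj₁ (posᵂ x)

  X₂ : ∀ {n} → White n → ℕ
  X₂ x = proj₂ (posᵂ x)

  Y₁ : ∀ {n} → Black n → ℕ
  Y₁ y = proj₁ (posᴮ y)

  Y₂ : ∀ {n} → Black n → ℕ
  Y₂ y = proj₂ (posᴮ y)

  G : ∀ n → ℝ₊ → ℝ₊ → (w₁ w₂ b₁ b₂ : ℂ) → ℂ
  G n α β w₁ w₂ b₁ b₂ =
    ∑[ x ∈W n ] ∑[ y ∈B n ] (K⁻¹ n α β x y * w₁ ^ X₁ x * w₂ ^ X₂ x * b₁ ^ Y₁ y * b₂ ^ Y₂ y)

  2# : ℂ
  2# = 1# + 1#

  f : ℕ → (t : ℂ) → ⦃ NonZero (1# - t) ⦄ → ℂ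
  f k t = (1# - t ^ k) / (1# - t)

  module Formulas (n r : ℕ) (a₊ : ℝ₊) where
    private
      a : ℂ
      a = ⌜ proj₁ a₊ ⌝

      2n : ℕ
      2n = 2 ℕ.* n

    c∂ : (r₁ r₂ : ℂ) → ⦃ NonZero r₁ ⦄ → ⦃ NonZero r₂ ⦄ → ℂ
    c∂ r₁ r₂ = 2# * (1# + a ^ 2) + a * (r₁ ^ 2 + r₁ ^- 2) * (r₂ ^ 2 + r₂ ^- 2)

    -- s ε κ is s_{ε,2nκ}.
    s : Fin 2 → Fin 2 → (r₁ r₂ : ℂ) → ⦃ NonZero r₁ ⦄ → ⦃ NonZero r₂ ⦄ → ℂ
    s ε 0F r₁ r₂ =
      - a * (r₁ ^- 2 * r₂ ^- 2 + r₁ ^ 2 * r₂ ^- 2)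
        - a * 𝕚 * r₁ ^ 2 + a * 𝕚 * r₁ ^- 2 - 2# * a ^ (2 ℕ.* toℕ ε)
    s ε 1F r₁ r₂ =
      r₂ ^ 2n * (- a * (r₁ ^ 2 * r₂ ^ 2 + r₁ ^- 2 * r₂ ^ 2)
        + a * 𝕚 * r₁ ^ 2 - a * 𝕚 * r₁ ^- 2 - 2# * a ^ (2 ℕ.* (1 ℕ.∸ toℕ ε)))

    module _ (w₁ w₂ b₁ b₂ : ℂ)
             ⦃ _ : NonZero w₁ ⦄ ⦃ _ : NonZero w₂ ⦄ ⦃ _ : NonZero b₁ ⦄ ⦃ _ : NonZero b₂ ⦄ where

      -- The truncated subtraction only matters for n = 0, where d multiplies
      -- d-sides by f 0 _ = 0 (as n = 2r).
      d-sides : ℂ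
      d-sides =
          s 0F 0F w₁ w₂ * (a * (b₁ ^ 2 - 𝕚) * w₁ * b₂ + w₁ * b₂ ^- 1 * (1# - 𝕚 * b₁ ^ 2))
        + s 1F 0F w₁ w₂ * ((b₁ ^ 2 - 𝕚) * w₁ ^ 3 * b₁ ^ 2 * b₂
                           + a * w₁ ^ 3 * b₁ ^ 2 * b₂ ^- 1 * (1# - 𝕚 * b₁ ^ 2))
        + s 0F 1F w₁ w₂ * ((1# - 𝕚 * b₁ ^ 2) * w₁ * b₂ ^ (2n ℕ.∸ 1)
                           + a * w₁ * b₂ ^ (2n ℕ.+ 1) * (b₁ ^ 2 - 𝕚))
        + s 1F 1F w₁ w₂ * (a * (1# - 𝕚 * b₁ ^ 2) * w₁ ^ 3 * b₁ ^ 2 * b₂ ^ (2n ℕ.∸ 1)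
                           + w₁ ^ 3 * b₁ ^ 2 * b₂ ^ (2n ℕ.+ 1) * (b₁ ^ 2 - 𝕚))

      d : ⦃ NonZero (c∂ b₁ b₂) ⦄ →
          ⦃ NonZero (1# - w₁ ^ 4 * b₁ ^ 4) ⦄ → ⦃ NonZero (1# - w₂ ^ 4 * b₂ ^ 4) ⦄ → ℂ
      d =
          f r (w₂ ^ 4 * b₂ ^ 4) * f r (w₁ ^ 4 * b₁ ^ 4) * b₂ * w₁
            * (a + w₁ ^ 2 * b₁ ^ 2 + w₂ ^ 2 * b₂ ^ 2 * (1# + a * w₁ ^ 2 * b₁ ^ 2))
            * (w₂ ^ 2 + b₁ ^ 2 - 𝕚 * (1# + w₂ ^ 2 * b₁ ^ 2))
        + ((1# - 𝕚 * w₂ ^ 2) * w₁ ^- 1 * b₂ * (1# + a * w₂ ^ 2 * b₂ ^ 2)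
            + (w₂ ^ 2 - 𝕚) * w₁ ^ (2n ℕ.+ 1) * b₁ ^ 2n * b₂ * (a + w₂ ^ 2 * b₂ ^ 2))
            * f r (w₂ ^ 4 * b₂ ^ 4)
        - d-sides / c∂ b₁ b₂ * f r (w₁ ^ 4 * b₁ ^ 4)

module Submission where

-- Applying K to the conjugate weights times monomials, V = K* b, multiplies the
-- monomial b^y by c∂(b), except on the sides y₁ ∈ {0 , 2n}, where the neighbours
-- outside the diamond are missing and s appears: K V = c∂(b) b^y + s.  Since K is
-- invariant under exchanging the coordinates, the same holds for rows:
-- U K = c∂(w) w^x + s, with U = w K* .  Hence, up to the factors c∂,
--   w K⁻¹ b = (U K - s) K⁻¹ b = U b - s K⁻¹ b  and  K⁻¹ b = V - K⁻¹ s ,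
-- where U b and s V are geometric sums, which make up d, and s K⁻¹ s is the sum
-- over the sides.  The relations between the sides follow from the exchange of
-- coordinates and from the reflection x₁ ↦ 2n - x₁, which turns K_{α,β} into a
-- gauge transform of K_{β,α}.

open import Algebra.Bundles using (CommutativeRing)
open import Data.Bool.Base using (true; false; T; _∧_; if_then_else_)
open import Data.Bool.Properties using (∧-comm)
open import Data.Fin.Base using (Fin; zero; suc; toℕ; fromℕ; opposite)
open import Data.Fin.Patterns using (0F; 1F)
open import Data.Fin.Permutation using (reverse)
import Data.Fin.Properties as Fin
open import Data.Integer.Base using (+_)
open import Data.Nat.Base as ℕ using (ℕ; zero; suc; _∸_; _≡ᵇ_; _<ᵇ_; s≤s)
import Data.Nat.DivMod as ℕ
import Data.Nat.Properties as ℕₚ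
open import Data.Nat.Tactic.RingSolver using (solve-∀)
open import Data.Product.Base using (_×_; _,_; proj₁; proj₂; swap)
open import Data.Sum.Base using (inj₁; inj₂)
open import Function.Bundles using (mk⇔)
open import Relation.Binary.PropositionalEquality as ≡ using (_≡_)
open import Relation.Nullary.Decidable using (does; yes; no; does-⇔)
open import Defs

-- On the full lattice `K K*` acts on monomials by a single scalar, although the weights depend on
-- the class. Two black vertices that differ by two in one coordinate only are joined by two paths
-- through white vertices, and these cancel by the Kasteleyn signs. If they differ by two in both
-- coordinates there is one path, and its weights multiply to `a` for either class. The squared
-- weights around a black vertex sum to `2 (1 + a²)`. Together this is `c∂`. All white neighbours of
-- a black vertex have second coordinate between 0 and 2n. Letting `V` count black neighbours
-- outside the diamond therefore makes the rows nearest the bottom and the top exact, and only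
-- `y₁ = 0` and `y₁ = 2n` need corrections. Evenness of `n` enters twice: the geometric sums have
-- coefficients of period two, and the reflection has to preserve classes.

-- Parities of index sums and reversal of indices

parity : ℕ → Fin 2
parity zero    = 0F
parity (suc n) = opposite (parity n)

parity-2+ : ∀ n → parity (2 ℕ.+ n) ≡ parity n
parity-2+ n = Fin.opposite-involutive (parity n)

parity-+-suc : ∀ m n → parity (m ℕ.+ suc n) ≡ opposite (parity (m ℕ.+ n))
parity-+-suc m n = ≡.cong parity (ℕₚ.+-suc m n)

parity-+-double : ∀ m r → parity (m ℕ.+ 2 ℕ.* r) ≡ parity m
parity-+-double m zero    = ≡.cong parity (ℕₚ.+-identityʳ m)
parity-+-double m (suc r) = ≡.trans
  (≡.cong parity (lemma m r))
  (≡.trans (parity-2+ (m ℕ.+ 2 ℕ.* r)) (parity-+-double m r))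
  where
  lemma : ∀ m r → m ℕ.+ 2 ℕ.* suc r ≡ 2 ℕ.+ (m ℕ.+ 2 ℕ.* r)
  lemma = solve-∀

-- Vertices have coordinate sum `2m + 1` with `m` the sum of their indices, so classes modulo 4
-- become parities, which flip at each unit step of an index.
residue : ∀ m → (2 ℕ.* m ℕ.+ 1) ℕ.% 4 ≡ 2 ℕ.* toℕ (parity m) ℕ.+ 1
residue zero          = ≡.refl
residue (suc zero)    = ≡.refl
residue (suc (suc m)) = ≡.trans (≡.cong (ℕ._% 4) (lemma m))
  (≡.trans (ℕ.[m+n]%n≡m%n (2 ℕ.* m ℕ.+ 1) 4)
    (≡.trans (residue m) (≡.cong (λ ε → 2 ℕ.* toℕ ε ℕ.+ 1) (≡.sym (parity-2+ m)))))
  where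
  lemma : ∀ m → 2 ℕ.* suc (suc m) ℕ.+ 1 ≡ 2 ℕ.* m ℕ.+ 1 ℕ.+ 4
  lemma = solve-∀

≡ᵇ-true : ∀ n → (n ≡ᵇ n) ≡ true
≡ᵇ-true zero    = ≡.refl
≡ᵇ-true (suc n) = ≡ᵇ-true n

<ᵇ-false : ∀ n → (n <ᵇ n) ≡ false
<ᵇ-false zero    = ≡.refl
<ᵇ-false (suc n) = <ᵇ-false n

≡ᵇ-false : ∀ {m n} → m ℕ.< n → (m ≡ᵇ n) ≡ false
≡ᵇ-false {zero}  {suc n} _         = ≡.refl
≡ᵇ-false {suc m} {suc n} (s≤s m<n) = ≡ᵇ-false m<n

≡ᵇ-⇔ : ∀ {m n k l} → (m ≡ n → k ≡ l) → (k ≡ l → m ≡ n) → (m ≡ᵇ n) ≡ (k ≡ᵇ l)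
≡ᵇ-⇔ {m} {n} {k} {l} f g = does-⇔ (mk⇔ f g) (m ℕₚ.≟ n) (k ℕₚ.≟ l)

≟-sym : ∀ {n} (i j : Fin n) → does (i Fin.≟ j) ≡ does (j Fin.≟ i)
≟-sym i j = does-⇔ (mk⇔ ≡.sym ≡.sym) (i Fin.≟ j) (j Fin.≟ i)

opposite-+ : ∀ {n} (i : Fin n) → toℕ (opposite i) ℕ.+ suc (toℕ i) ≡ n
opposite-+ {n} i = ≡.trans (≡.cong (ℕ._+ suc (toℕ i)) (Fin.opposite-prop i)) (ℕₚ.m∸n+n≡m (Fin.toℕ<n i))

opposite-+′ : ∀ {n} (i : Fin (suc n)) → toℕ (opposite i) ℕ.+ toℕ i ≡ n
opposite-+′ i = ℕₚ.suc-injective (≡.trans (≡.sym (ℕₚ.+-suc (toℕ (opposite i)) (toℕ i))) (opposite-+ i))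

opposite-fromℕ : ∀ n → opposite (fromℕ n) ≡ zero
opposite-fromℕ n = Fin.opposite-involutive {suc n} zero

cancelˡ-by : ∀ {x y m n} → x ℕ.+ m ≡ y ℕ.+ n → x ≡ y → m ≡ n
cancelˡ-by {x} eq ≡.refl = ℕₚ.+-cancelˡ-≡ x _ _ eq

cancelʳ-by : ∀ {x y m n} → m ℕ.+ x ≡ n ℕ.+ y → x ≡ y → m ≡ n
cancelʳ-by {x} eq ≡.refl = ℕₚ.+-cancelʳ-≡ x _ _ eq

module Proof {c ℓ₁ ℓ₂} (ℝ : RealNumbers c ℓ₁ ℓ₂) where
  open TwoPeriodicAztec ℝ
  open Invertibility
  private
    module ℝ = RealNumbers ℝ
    module ℂᴿ = CommutativeRing ℂ-commutativeRing
  open import Algebra.Properties.Semiring.Exp ℂᴿ.semiring using (^-homo-*; ^-assocʳ; ^-congˡ)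
  open import Algebra.Properties.CommutativeSemiring.Exp ℂᴿ.commutativeSemiring using (^-distrib-*)
  open import Algebra.Properties.CommutativeMonoid.Sum ℂᴿ.+-commutativeMonoid using (∑-permute)

  -- Arithmetic of the imaginary unit, classes of vertices and edge weights

  opaque
    unfolding ⌜_⌝

    𝕚*𝕚+1 : 𝕚 * 𝕚 + 1# ≈ 0#
    𝕚*𝕚+1 = R.solve 0 (R.con (+ 0) R.:* R.con (+ 0) R.:- R.con (+ 1) R.:* R.con (+ 1) R.:+ R.con (+ 1) R.:= R.con (+ 0)) ℝ.refl
          , R.solve 0 (R.con (+ 0) R.:* R.con (+ 1) R.:+ R.con (+ 1) R.:* R.con (+ 0) R.:+ R.con (+ 0) R.:= R.con (+ 0)) ℝ.refl

    ⌜⌝-cong : ∀ {x y} → x ℝ.≈ y → ⌜ x ⌝ ≈ ⌜ y ⌝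
    ⌜⌝-cong x≈y = x≈y , ℝ.refl

    ⌜1⌝ : ⌜ ℝ.1# ⌝ ≈ 1#
    ⌜1⌝ = ℝ.refl , ℝ.refl

  𝕚*𝕚 : 𝕚 * 𝕚 ≈ - 1#
  𝕚*𝕚 = trans (solve 1 (λ z → z := z :+ con (+ 1) :+ :- con (+ 1)) refl (𝕚 * 𝕚)) (trans (+-congʳ 𝕚*𝕚+1) (+-identityˡ _))

  -- An identity modulo relations yᵢ ≈ 0, certified by cofactors sᵢ so that the
  -- remaining equation is an identity of polynomials.
  modulo : ∀ {x y₁ y₂ z} s₁ s₂ → y₁ ≈ 0# → y₂ ≈ 0# → x ≈ z + s₁ * y₁ + s₂ * y₂ → x ≈ z
  modulo {z = z} s₁ s₂ y₁≈0 y₂≈0 eq = trans eq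
    (trans (+-cong (+-congˡ (*-congˡ y₁≈0)) (*-congˡ y₂≈0))
      (solve 3 (λ z s t → z :+ s :* con (+ 0) :+ t :* con (+ 0) := z) refl z s₁ s₂))

  ∈ᵇ-parity : ∀ x m → proj₁ x ℕ.+ proj₂ x ≡ 2 ℕ.* m ℕ.+ 1 →
              ∀ ε → (x ∈ᵇ ε) ≡ (2 ℕ.* toℕ (parity m) ℕ.+ 1 ≡ᵇ 2 ℕ.* toℕ ε ℕ.+ 1)
  ∈ᵇ-parity x m eq ε = ≡.cong (_≡ᵇ 2 ℕ.* toℕ ε ℕ.+ 1) (≡.trans (≡.cong (ℕ._% 4) eq) (residue m))

  class-parity : ∀ x m → proj₁ x ℕ.+ proj₂ x ≡ 2 ℕ.* m ℕ.+ 1 → class x ≡ parity m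
  class-parity x m eq = ≡.trans (≡.cong (if_then 1F else 0F) (∈ᵇ-parity x m eq 1F)) (cases (parity m))
    where
    cases : ∀ ε → (if 2 ℕ.* toℕ ε ℕ.+ 1 ≡ᵇ 3 then 1F else 0F) ≡ ε
    cases 0F = ≡.refl
    cases 1F = ≡.refl

  position-sum : ∀ i j → 2 ℕ.* i ℕ.+ (2 ℕ.* j ℕ.+ 1) ≡ 2 ℕ.* (i ℕ.+ j) ℕ.+ 1
  position-sum = solve-∀

  ∑-class : ∀ x m → proj₁ x ℕ.+ proj₂ x ≡ 2 ℕ.* m ℕ.+ 1 →
            ∀ (g : Fin 2 → ℂ) → ∑[ ε < 2 ] (g ε when x ∈ᵇ ε) ≈ g (parity m)
  ∑-class x m eq g = trans
    (sum-cong (λ ε → when-≡ (g ε) (∈ᵇ-parity x m eq ε)))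
    (cases (parity m))
    where
    cases : ∀ η → ∑[ ε < 2 ] (g ε when 2 ℕ.* toℕ η ℕ.+ 1 ≡ᵇ 2 ℕ.* toℕ ε ℕ.+ 1) ≈ g η
    cases 0F = solve 1 (λ z → z :+ (con (+ 0) :+ con (+ 0)) := z) refl (g 0F)
    cases 1F = solve 1 (λ z → con (+ 0) :+ (z :+ con (+ 0)) := z) refl (g 1F)

  even-power : ∀ z k → (z ^ 2) ^ k ≈ z ^ (2 ℕ.* k)
  even-power z k = ^-assocʳ z 2 k

  odd-power : ∀ z k → (z ^ 2) ^ k * z ≈ z ^ (2 ℕ.* k ℕ.+ 1)
  odd-power z k = sym (trans (^-homo-* z (2 ℕ.* k) 1)
    (*-cong (sym (even-power z k)) (*-identityʳ z)))

  ∑-first : ∀ n (g : Fin (suc n) → ℂ) → ∑[ i < suc n ] (g i when toℕ i ≡ᵇ 0) ≈ g zero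
  ∑-first n g = trans (+-congˡ (sum-replicate-zero n)) (+-identityʳ _)

  ∑-last : ∀ n (g : Fin (suc n) → ℂ) → ∑[ i < suc n ] (g i when toℕ i ≡ᵇ n) ≈ g (fromℕ n)
  ∑-last zero    g = +-identityʳ _
  ∑-last (suc n) g = trans (+-identityˡ _) (∑-last n (λ i → g (suc i)))

  cls : ℕ → ℕ → Fin 2
  cls i j = class (2 ℕ.* i , 2 ℕ.* j ℕ.+ 1)

  cls-parity : ∀ i j → cls i j ≡ parity (i ℕ.+ j)
  cls-parity i j = class-parity (2 ℕ.* i , 2 ℕ.* j ℕ.+ 1) (i ℕ.+ j) (position-sum i j)

  cls-comm : ∀ i j → cls i j ≡ cls j i
  cls-comm i j = ≡.trans (cls-parity i j) (≡.trans (≡.cong parity (ℕₚ.+-comm i j)) (≡.sym (cls-parity j i)))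

  cls-sucˡ : ∀ i j → cls (suc i) j ≡ opposite (cls i j)
  cls-sucˡ i j = ≡.trans (cls-parity (suc i) j) (≡.cong opposite (≡.sym (cls-parity i j)))

  cls-sucʳ : ∀ i j → cls i (suc j) ≡ opposite (cls i j)
  cls-sucʳ i j = ≡.trans (cls-comm i (suc j)) (≡.trans (cls-sucˡ j i) (≡.cong opposite (cls-comm j i)))

  mixed-0 : ∀ x y → x ℝ.* (ℝ.1# ℝ.- ℝ.0#) ℝ.+ y ℝ.* ℝ.0# ℝ.≈ x
  mixed-0 x y = R.solve 2 (λ x y → x R.:* (R.con (+ 1) R.:- R.con (+ 0)) R.:+ y R.:* R.con (+ 0) R.:= x) ℝ.refl x y

  mixed-1 : ∀ x y → x ℝ.* (ℝ.1# ℝ.- ℝ.1#) ℝ.+ y ℝ.* ℝ.1# ℝ.≈ y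
  mixed-1 x y = R.solve 2 (λ x y → x R.:* (R.con (+ 1) R.:- R.con (+ 1)) R.:+ y R.:* R.con (+ 1) R.:= y) ℝ.refl x y

  mixed′-0 : ∀ x y → x ℝ.* ℝ.0# ℝ.+ y ℝ.* (ℝ.1# ℝ.- ℝ.0#) ℝ.≈ y
  mixed′-0 x y = ℝ.trans (ℝ.+-comm _ _) (mixed-0 y x)

  mixed′-1 : ∀ x y → x ℝ.* ℝ.1# ℝ.+ y ℝ.* (ℝ.1# ℝ.- ℝ.1#) ℝ.≈ x
  mixed′-1 x y = ℝ.trans (ℝ.+-comm _ _) (mixed-1 y x)

  -- The action of K on monomials

  module Boundary (n r : ℕ) (a₊ : ℝ₊) where
    open Formulas n r a₊

    a : ℂ
    a = ⌜ proj₁ a₊ ⌝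

    -- At a black vertex of class `ε` this is the modulus of the weights in the directions `e₂` and
    -- `-e₁`; the other two edges carry `ν (opposite ε)`.
    ν : Fin 2 → ℂ
    ν 0F = 1#
    ν 1F = a

    1#≈1#² : 1# ≈ 1# ^ 2
    1#≈1#² = solve 0 (con (+ 1) := con (+ 1) :* (con (+ 1) :* con (+ 1))) refl

    a^2ε≈ν² : ∀ ε → a ^ (2 ℕ.* toℕ ε) ≈ ν ε ^ 2
    a^2ε≈ν² 0F = 1#≈1#²
    a^2ε≈ν² 1F = refl

    a^2[1-ε]≈ν² : ∀ ε → a ^ (2 ℕ.* (1 ∸ toℕ ε)) ≈ ν (opposite ε) ^ 2
    a^2[1-ε]≈ν² 0F = refl
    a^2[1-ε]≈ν² 1F = 1#≈1#²

    1+a²≈ν² : ∀ ε → 1# + a ^ 2 ≈ ν (opposite ε) ^ 2 + ν ε ^ 2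
    1+a²≈ν² 0F = trans (+-comm _ _) (+-congˡ 1#≈1#²)
    1+a²≈ν² 1F = +-congʳ 1#≈1#²

    inner≈ν : ∀ i j → ⌜ proj₁ (inner n a₊ 1₊ i j) ⌝ ≈ ν (parity (i ℕ.+ j))
    inner≈ν i j = trans
      (ℂᴿ.reflexive (≡.cong (λ ε → ⌜ mixed′ n a₊ 1₊ a₊ 1₊ ε ⌝) (cls-parity i j)))
      (cases (parity (i ℕ.+ j)))
      where
      cases : ∀ ε → ⌜ mixed′ n a₊ 1₊ a₊ 1₊ ε ⌝ ≈ ν ε
      cases 0F = trans (⌜⌝-cong (mixed′-0 (proj₁ a₊) ℝ.1#)) ⌜1⌝
      cases 1F = ⌜⌝-cong (mixed′-1 (proj₁ a₊) ℝ.1#)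

    outer≈ν : ∀ i j → ⌜ proj₁ (outer n a₊ 1₊ i j) ⌝ ≈ ν (opposite (parity (i ℕ.+ j)))
    outer≈ν i j = trans
      (ℂᴿ.reflexive (≡.cong (λ ε → ⌜ mixed n a₊ 1₊ a₊ 1₊ ε ⌝) (cls-parity i j)))
      (cases (parity (i ℕ.+ j)))
      where
      cases : ∀ ε → ⌜ mixed n a₊ 1₊ a₊ 1₊ ε ⌝ ≈ ν (opposite ε)
      cases 0F = ⌜⌝-cong (mixed-0 (proj₁ a₊) ℝ.1#)
      cases 1F = trans (⌜⌝-cong (mixed-1 (proj₁ a₊) ℝ.1#)) ⌜1⌝

    module Monomials (b₁ b₂ : ℂ) ⦃ _ : NonZero b₁ ⦄ ⦃ _ : NonZero b₂ ⦄ where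
      -- The factors contributed to K K* at the black vertex (2i , 2j+1) of class ε by
      -- its white neighbours with x₁ = 2i+1, respectively x₁ = 2i-1.
      Bᴸ Bᴿ : Fin 2 → ℂ
      Bᴸ ε = 2# * ν (opposite ε) ^ 2 + a * (b₂ ^ 2 * (b₁ ^ 2 - 𝕚) + b₂ ^- 2 * (b₁ ^ 2 + 𝕚))
      Bᴿ ε = 2# * ν ε ^ 2 + a * (b₂ ^ 2 * (b₁ ^- 2 + 𝕚) + b₂ ^- 2 * (b₁ ^- 2 - 𝕚))

      -- The terms with `𝕚` belong to vertical displacements and cancel between the two halves. The
      -- squares of the two weights sum to `1 + a²` in either order, so the class disappears.
      c∂≈Bᴸ+Bᴿ : ∀ ε → c∂ b₁ b₂ ≈ Bᴸ ε + Bᴿ ε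
      c∂≈Bᴸ+Bᴿ ε = trans (+-congʳ (*-congˡ (1+a²≈ν² ε)))
        (solve 8 (λ o² q² a i x² x⁻² y² y⁻² → let two = con (+ 1) :+ con (+ 1) in
          two :* (o² :+ q²) :+ a :* (x² :+ x⁻²) :* (y² :+ y⁻²)
            := (two :* o² :+ a :* (y² :* (x² :- i) :+ y⁻² :* (x² :+ i)))
               :+ (two :* q² :+ a :* (y² :* (x⁻² :+ i) :+ y⁻² :* (x⁻² :- i))))
          refl (ν (opposite ε) ^ 2) (ν ε ^ 2) a 𝕚 (b₁ ^ 2) (b₁ ^- 2) (b₂ ^ 2) (b₂ ^- 2))

      -- On the side `y₁ = 0` the white neighbours with `x₁ = -1` are missing, and `s` takes back
      -- what they would contribute. The first argument of `s` belongs to the coordinate along the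
      -- side, hence `b₂` before `b₁`.
      s₀≈-Bᴿ : ∀ ε → s ε 0F b₂ b₁ ≈ - Bᴿ ε
      s₀≈-Bᴿ ε = trans (+-congˡ (-‿cong (*-congˡ (a^2ε≈ν² ε))))
        (solve 6 (λ q² a i x⁻² y² y⁻² → let two = con (+ 1) :+ con (+ 1) in
          :- a :* (y⁻² :* x⁻² :+ y² :* x⁻²) :- a :* i :* y² :+ a :* i :* y⁻² :- two :* q²
            := :- (two :* q² :+ a :* (y² :* (x⁻² :+ i) :+ y⁻² :* (x⁻² :- i))))
          refl (ν ε ^ 2) a 𝕚 (b₁ ^- 2) (b₂ ^ 2) (b₂ ^- 2))

      s₁≈-Bᴸ : ∀ ε → s ε 1F b₂ b₁ ≈ b₁ ^ (2 ℕ.* n) * - Bᴸ ε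
      s₁≈-Bᴸ ε = *-congˡ (trans (+-congˡ (-‿cong (*-congˡ (a^2[1-ε]≈ν² ε))))
        (solve 6 (λ o² a i x² y² y⁻² → let two = con (+ 1) :+ con (+ 1) in
          :- a :* (y² :* x² :+ y⁻² :* x²) :+ a :* i :* y² :- a :* i :* y⁻² :- two :* o²
            := :- (two :* o² :+ a :* (y² :* (x² :- i) :+ y⁻² :* (x² :+ i))))
          refl (ν (opposite ε) ^ 2) a 𝕚 (b₁ ^ 2) (b₂ ^ 2) (b₂ ^- 2)))

      -- The conjugate weights around a white vertex of index parity `ε`, each times the shift to
      -- its neighbour: `b₂ ⁻¹` for the two below, `b₂` for the two above, `b₁ ^ 2` for those on the
      -- right. The factor `- 𝕚` is the conjugate of the `𝕚` in the directions `±e₂`.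
      core : Fin 2 → ℂ
      core ε = ν ε * b₂ ⁻¹ * (1# - 𝕚 * b₁ ^ 2) + ν (opposite ε) * b₂ * (b₁ ^ 2 - 𝕚)

      -- V k l is the sum of b^y times the conjugate weight over all four neighbours y
      -- of the white vertex (2k+1 , 2l), also those outside the diamond.
      V : ℕ → ℕ → ℂ
      V k l = (b₁ ^ 2) ^ k * (b₂ ^ 2) ^ l * core (parity (k ℕ.+ l))

      monomial : ℕ → ℕ → ℂ
      monomial i j = (b₁ ^ 2) ^ i * ((b₂ ^ 2) ^ j * b₂)

      ν*ν : ∀ ε → ν (opposite ε) * ν ε ≈ a
      ν*ν 0F = *-identityʳ a
      ν*ν 1F = *-identityˡ a

      b₂*b₂⁻¹-1 : b₂ * b₂ ⁻¹ - 1# ≈ 0#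
      b₂*b₂⁻¹-1 = trans (+-congʳ (trans (*-comm _ _) (⁻¹-inverseˡ b₂))) (ℂᴿ.-‿inverseʳ 1#)

      b₁²*b₁⁻²-1 : b₁ ^ 2 * b₁ ^- 2 - 1# ≈ 0#
      b₁²*b₁⁻²-1 = trans (+-congʳ (trans
        (solve 2 (λ x u → x :* (x :* con (+ 1)) :* (u :* (u :* con (+ 1))) := (u :* x) :* (u :* x)) refl b₁ (b₁ ⁻¹))
        (trans (*-cong (⁻¹-inverseˡ b₁) (⁻¹-inverseˡ b₁)) (*-identityˡ 1#)))) (ℂᴿ.-‿inverseʳ 1#)

      -- The white vertices above and below on the right of a black vertex give two paths back to
      -- it, hence `2 o²`; their two paths to the next black vertex in the row cancel because `𝕚`
      -- meets `- 𝕚`; the four remaining paths use both weights, hence `o q`.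
      left-identity : ∀ o q M₁ M₂ →
        o * (M₁ * (b₂ ^ 2 * M₂) * (o * b₂ ⁻¹ * (1# - 𝕚 * b₁ ^ 2) + q * b₂ * (b₁ ^ 2 - 𝕚)))
          + (𝕚 * o) * (M₁ * M₂ * (q * b₂ ⁻¹ * (1# - 𝕚 * b₁ ^ 2) + o * b₂ * (b₁ ^ 2 - 𝕚)))
          ≈ M₁ * (M₂ * b₂) * (2# * o ^ 2 + (o * q) * (b₂ ^ 2 * (b₁ ^ 2 - 𝕚) + b₂ ^- 2 * (b₁ ^ 2 + 𝕚)))
      left-identity o q M₁ M₂ = modulo
        (- (M₁ * M₂ * (o * q * b₂ ⁻¹ * b₁ ^ 2 + o * o * b₂)))
        (M₁ * M₂ * (b₂ * o * o * (1# - 𝕚 * b₁ ^ 2) - o * q * b₂ ⁻¹ * (b₁ ^ 2 + 𝕚)))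
        𝕚*𝕚+1 b₂*b₂⁻¹-1
        (solve 8 (λ o q M₁ M₂ i B y v →
          let l = con (+ 1) ; y² = y :* (y :* l) ; v² = v :* (v :* l) in
          o :* (M₁ :* (y² :* M₂) :* (o :* v :* (l :- i :* B) :+ q :* y :* (B :- i)))
            :+ (i :* o) :* (M₁ :* M₂ :* (q :* v :* (l :- i :* B) :+ o :* y :* (B :- i)))
            := M₁ :* (M₂ :* y) :* ((l :+ l) :* (o :* (o :* l)) :+ (o :* q) :* (y² :* (B :- i) :+ v² :* (B :+ i)))
               :+ (:- (M₁ :* M₂ :* (o :* q :* v :* B :+ o :* o :* y))) :* (i :* i :+ l)
               :+ (M₁ :* M₂ :* (y :* o :* o :* (l :- i :* B) :- o :* q :* v :* (B :+ i))) :* (y :* v :- l))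
          refl o q M₁ M₂ 𝕚 (b₁ ^ 2) b₂ (b₂ ⁻¹))

      right-identity : ∀ o q M₁ M₂ →
        (𝕚 * q) * (M₁ * (b₂ ^ 2 * M₂) * (q * b₂ ⁻¹ * (1# - 𝕚 * b₁ ^ 2) + o * b₂ * (b₁ ^ 2 - 𝕚)))
          + q * (M₁ * M₂ * (o * b₂ ⁻¹ * (1# - 𝕚 * b₁ ^ 2) + q * b₂ * (b₁ ^ 2 - 𝕚)))
          ≈ b₁ ^ 2 * M₁ * (M₂ * b₂) * (2# * q ^ 2 + (o * q) * (b₂ ^ 2 * (b₁ ^- 2 + 𝕚) + b₂ ^- 2 * (b₁ ^- 2 - 𝕚)))
      right-identity o q M₁ M₂ = trans
        (modulo
          (- (M₁ * M₂ * (q * q * b₂ * b₁ ^ 2 + o * q * b₂ * b₂ * b₂)))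
          (M₁ * M₂ * (q * q * b₂ * (𝕚 - 𝕚 * 𝕚 * b₁ ^ 2) - o * q * b₂ ⁻¹ * (1# - 𝕚 * b₁ ^ 2)))
          𝕚*𝕚+1 b₂*b₂⁻¹-1
          (solve 8 (λ o q M₁ M₂ i B y v →
            let l = con (+ 1) ; y² = y :* (y :* l) ; v² = v :* (v :* l) in
            (i :* q) :* (M₁ :* (y² :* M₂) :* (q :* v :* (l :- i :* B) :+ o :* y :* (B :- i)))
              :+ q :* (M₁ :* M₂ :* (o :* v :* (l :- i :* B) :+ q :* y :* (B :- i)))
              := M₁ :* (M₂ :* y) :* ((l :+ l) :* (q :* (q :* l)) :* B :+ (o :* q) :* (y² :* (l :+ i :* B) :+ v² :* (l :- i :* B)))
                 :+ (:- (M₁ :* M₂ :* (q :* q :* y :* B :+ o :* q :* y :* y :* y))) :* (i :* i :+ l)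
                 :+ (M₁ :* M₂ :* (q :* q :* y :* (i :- i :* i :* B) :- o :* q :* v :* (l :- i :* B))) :* (y :* v :- l))
            refl o q M₁ M₂ 𝕚 (b₁ ^ 2) b₂ (b₂ ⁻¹)))
        -- The third relation is needed only now: `b₁ ^- 2` appears when the factor `b₁ ^ 2` of the
        -- next monomial is taken out.
        (modulo 0# (- (M₁ * (M₂ * b₂) * (o * q) * (b₂ ^ 2 + b₂ ^- 2))) 𝕚*𝕚+1 b₁²*b₁⁻²-1
          (solve 10 (λ o q M₁ M₂ i B D y y² v² →
            let l = con (+ 1) in
            M₁ :* (M₂ :* y) :* ((l :+ l) :* (q :* (q :* l)) :* B :+ (o :* q) :* (y² :* (l :+ i :* B) :+ v² :* (l :- i :* B)))
              := B :* M₁ :* (M₂ :* y) :* ((l :+ l) :* (q :* (q :* l)) :+ (o :* q) :* (y² :* (D :+ i) :+ v² :* (D :- i)))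
                 :+ con (+ 0) :* (i :* i :+ l)
                 :+ (:- (M₁ :* (M₂ :* y) :* (o :* q) :* (y² :+ v²))) :* (B :* D :- l))
            refl o q M₁ M₂ 𝕚 (b₁ ^ 2) (b₁ ^- 2) b₂ (b₂ ^ 2) (b₂ ^- 2)))

      W : Weights
      W = weights n a₊ 1₊

      leftOf-V : ∀ i j → leftOf W V i j ≈ monomial i j * Bᴸ (parity (i ℕ.+ j))
      leftOf-V i j = trans
        (+-cong
          (*-cong (outer≈ν i j) (*-congˡ (core-opposite ε (parity-+-suc i j))))
          (*-congʳ (*-congˡ (outer≈ν i j))))
        (trans (left-identity (ν (opposite ε)) (ν ε) _ _)
          (*-congˡ (+-congˡ (*-congʳ (ν*ν ε)))))
        where
        ε = parity (i ℕ.+ j)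
        core-opposite : ∀ ε {η} → η ≡ opposite ε →
          core η ≈ ν (opposite ε) * b₂ ⁻¹ * (1# - 𝕚 * b₁ ^ 2) + ν ε * b₂ * (b₁ ^ 2 - 𝕚)
        core-opposite ε ≡.refl = +-congˡ (*-congʳ (*-congʳ (ℂᴿ.reflexive (≡.cong ν (Fin.opposite-involutive ε)))))

      rightOf-V : ∀ i j → rightOf W V i j ≈ monomial (suc i) j * Bᴿ (parity (suc i ℕ.+ j))
      rightOf-V i j = trans
        (+-cong
          (*-cong (*-congˡ (inner≈ν (suc i) j)) (*-congˡ (ℂᴿ.reflexive (≡.cong core (parity-+-suc i j)))))
          (*-cong (inner≈ν (suc i) j) (*-congˡ (+-congʳ (*-congʳ (*-congʳ (ℂᴿ.reflexive (≡.cong ν (≡.sym (Fin.opposite-involutive (parity (i ℕ.+ j))))))))))))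
        (trans (right-identity (ν (opposite ε)) (ν ε) _ _)
          (*-congˡ (+-congˡ (*-congʳ (ν*ν ε)))))
        where
        ε = parity (suc i ℕ.+ j)

      boundaryTerm : Fin 2 → ℕ → ℕ → ℂ
      boundaryTerm κ i j = s (parity (i ℕ.+ j)) κ b₂ b₁ * b₂ ^ (2 ℕ.* j ℕ.+ 1)

      boundary : ℕ → ℕ → ℂ
      boundary i j = (boundaryTerm 0F i j when i ≡ᵇ 0) + (boundaryTerm 1F i j when i ≡ᵇ n)

      first-term : ∀ j → boundaryTerm 0F 0 j ≈ - (monomial 0 j * Bᴿ (parity j))
      first-term j = trans (*-cong (s₀≈-Bᴿ (parity j)) (sym (odd-power b₂ j)))
        (solve 2 (λ x y → :- x :* y := :- (con (+ 1) :* y :* x)) refl (Bᴿ (parity j)) ((b₂ ^ 2) ^ j * b₂))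

      last-term : ∀ j → boundaryTerm 1F n j ≈ - (monomial n j * Bᴸ (parity (n ℕ.+ j)))
      last-term j = trans
        (*-cong (trans (s₁≈-Bᴸ (parity (n ℕ.+ j))) (*-congʳ (sym (even-power b₁ n)))) (sym (odd-power b₂ j)))
        (solve 3 (λ x y z → x :* :- z :* y := :- (x :* y :* z)) refl ((b₁ ^ 2) ^ n) ((b₂ ^ 2) ^ j * b₂) (Bᴸ (parity (n ℕ.+ j))))

      -- An interior vertex receives both halves `Bᴸ` and `Bᴿ` of `c∂`; on a side one half is
      -- missing and `boundary` is its negative. The hypothesis `0 < n` keeps the two sides apart.
      row-V : ∀ i j → 0 ℕ.< n → i ℕ.≤ n → row n W V i j ≈ c∂ b₁ b₂ * monomial i j + boundary i j
      row-V zero j 0<n _ = begin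
        0# + (leftOf W V 0 j when 0 <ᵇ n)
          ≈⟨ trans (+-identityˡ _) (when-≡ _ (<ᵇ-true 0<n)) ⟩
        leftOf W V 0 j
          ≈⟨ leftOf-V 0 j ⟩
        monomial 0 j * Bᴸ ε
          ≈⟨ solve 3 (λ m x y → m :* x := (x :+ y) :* m :+ (:- (m :* y) :+ con (+ 0))) refl (monomial 0 j) (Bᴸ ε) (Bᴿ ε) ⟩
        (Bᴸ ε + Bᴿ ε) * monomial 0 j + (- (monomial 0 j * Bᴿ ε) + 0#)
          ≈⟨ +-cong (*-congʳ (sym (c∂≈Bᴸ+Bᴿ ε))) (+-cong (sym (first-term j)) (when-≡ _ (≡.sym (≡ᵇ-false 0<n)))) ⟩
        c∂ b₁ b₂ * monomial 0 j + boundary 0 j ∎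
        where ε = parity j
      row-V (suc i) j 0<n i<n with ℕₚ.m≤n⇒m<n∨m≡n i<n
      ... | inj₁ 1+i<n = begin
        rightOf W V i j + (leftOf W V (suc i) j when suc i <ᵇ n)
          ≈⟨ +-cong (rightOf-V i j) (trans (when-≡ _ (<ᵇ-true 1+i<n)) (leftOf-V (suc i) j)) ⟩
        monomial (suc i) j * Bᴿ ε + monomial (suc i) j * Bᴸ ε
          ≈⟨ solve 3 (λ m x y → m :* y :+ m :* x := (x :+ y) :* m :+ (con (+ 0) :+ con (+ 0))) refl (monomial (suc i) j) (Bᴸ ε) (Bᴿ ε) ⟩
        (Bᴸ ε + Bᴿ ε) * monomial (suc i) j + (0# + 0#)
          ≈⟨ +-cong (*-congʳ (sym (c∂≈Bᴸ+Bᴿ ε))) (+-congˡ (when-≡ _ (≡.sym (≡ᵇ-false 1+i<n)))) ⟩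
        c∂ b₁ b₂ * monomial (suc i) j + boundary (suc i) j ∎
        where ε = parity (suc i ℕ.+ j)
      ... | inj₂ ≡.refl = begin
        rightOf W V i j + (leftOf W V (suc i) j when suc i <ᵇ suc i)
          ≈⟨ +-cong (rightOf-V i j) (when-≡ _ (<ᵇ-false (suc i))) ⟩
        monomial (suc i) j * Bᴿ ε + 0#
          ≈⟨ solve 3 (λ m x y → m :* y :+ con (+ 0) := (x :+ y) :* m :+ (con (+ 0) :+ :- (m :* x))) refl (monomial (suc i) j) (Bᴸ ε) (Bᴿ ε) ⟩
        (Bᴸ ε + Bᴿ ε) * monomial (suc i) j + (0# + - (monomial (suc i) j * Bᴸ ε))
          ≈⟨ +-cong (*-congʳ (sym (c∂≈Bᴸ+Bᴿ ε)))
               (+-congˡ (trans (sym (last-term j)) (when-≡ _ (≡.sym (≡ᵇ-true (suc i)))))) ⟩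
        c∂ b₁ b₂ * monomial (suc i) j + boundary (suc i) j ∎
        where ε = parity (suc i ℕ.+ j)

      Vᵂ : White n → ℂ
      Vᵂ (k , l) = V (toℕ k) (toℕ l)

      boundaryᴮ : Black n → ℂ
      boundaryᴮ (i , j) = boundary (toℕ i) (toℕ j)

      K-V : ∀ x → ∑[ y ∈W n ] (K n a₊ 1₊ x y * Vᵂ y)
                    ≈ c∂ b₁ b₂ * (b₁ ^ Y₁ x * b₂ ^ Y₂ x) + boundaryᴮ x
      K-V x@(i , j) = trans (K-row n a₊ 1₊ V x) (trans
        -- The index `j` of a black vertex witnesses `0 < n`.
        (row-V (toℕ i) (toℕ j) (ℕₚ.≤-<-trans ℕ.z≤n (Fin.toℕ<n j)) (ℕₚ.≤-pred (Fin.toℕ<n i)))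
        (+-congʳ (*-congˡ (*-cong (even-power b₁ (toℕ i)) (odd-power b₂ (toℕ j))))))

      boundary-sum : ∀ (h : Black n → ℂ) →
        ∑[ x ∈B n ] (boundaryᴮ x * h x)
          ≈ ∑[ κ < 2 ] ∑[ j < n ] (boundaryTerm κ (toℕ (proj₁ (sideᴮ κ j))) (toℕ j) * h (sideᴮ κ j))
      boundary-sum h = begin
        ∑[ x ∈B n ] (boundaryᴮ x * h x)
          ≈⟨ ∑ₓ-cong split ⟩
        ∑[ x ∈B n ] ((t 0F x when toℕ (proj₁ x) ≡ᵇ 0) + (t 1F x when toℕ (proj₁ x) ≡ᵇ n))
          ≈⟨ ∑ₓ-+ {suc n} {n} (λ x → t 0F x when toℕ (proj₁ x) ≡ᵇ 0) (λ x → t 1F x when toℕ (proj₁ x) ≡ᵇ n) ⟩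
        ∑[ x ∈B n ] (t 0F x when toℕ (proj₁ x) ≡ᵇ 0) + ∑[ x ∈B n ] (t 1F x when toℕ (proj₁ x) ≡ᵇ n)
          ≈⟨ +-cong
               (trans (∑-comm {suc n} {n} (λ i j → t 0F (i , j) when toℕ i ≡ᵇ 0)) (sum-cong (λ j → ∑-first n (λ i → t 0F (i , j)))))
               (trans (∑-comm {suc n} {n} (λ i j → t 1F (i , j) when toℕ i ≡ᵇ n)) (sum-cong (λ j → ∑-last n (λ i → t 1F (i , j))))) ⟩
        ∑[ j < n ] t 0F (zero , j) + ∑[ j < n ] t 1F (fromℕ n , j)
          ≈⟨ +-congˡ (sym (+-identityʳ _)) ⟩
        ∑[ κ < 2 ] ∑[ j < n ] t κ (sideᴮ κ j) ∎
        where
        t : Fin 2 → Black n → ℂ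
        t κ (i , j) = boundaryTerm κ (toℕ i) (toℕ j) * h (i , j)
        split : ∀ x → boundaryᴮ x * h x
                        ≈ (t 0F x when toℕ (proj₁ x) ≡ᵇ 0) + (t 1F x when toℕ (proj₁ x) ≡ᵇ n)
        split x@(i , j) = trans (ℂᴿ.distribʳ _ _ _)
          (+-cong (when-*ʳ (toℕ i ≡ᵇ 0) (boundaryTerm 0F (toℕ i) (toℕ j)) (h x))
                  (when-*ʳ (toℕ i ≡ᵇ n) (boundaryTerm 1F (toℕ i) (toℕ j)) (h x)))

  -- Symmetries of K and its inverse

  𝟙-sym : ∀ {k l} (x y : Fin k × Fin l) → 𝟙 x y ≈ 𝟙 y x
  𝟙-sym (i , j) (i′ , j′) = when-≡ 1# (≡.cong₂ _∧_ (≟-sym i i′) (≟-sym j j′))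

  𝟙-swap : ∀ {k l} (x y : Fin k × Fin l) → 𝟙 (swap x) (swap y) ≈ 𝟙 x y
  𝟙-swap (i , j) (i′ , j′) = when-≡ 1# (∧-comm (does (j Fin.≟ j′)) (does (i Fin.≟ i′)))

  𝟙-cong : ∀ {k l} (f : Fin k × Fin l → ℂ) x y → f x * 𝟙 x y ≈ f y * 𝟙 x y
  𝟙-cong f (i , j) (i′ , j′) with i Fin.≟ i′ | j Fin.≟ j′
  ... | yes ≡.refl | yes ≡.refl = refl
  ... | yes _      | no _       = trans (ℂᴿ.zeroʳ _) (sym (ℂᴿ.zeroʳ _))
  ... | no _       | _          = trans (ℂᴿ.zeroʳ _) (sym (ℂᴿ.zeroʳ _))

  ∑ₓ-swap : ∀ {k l} (f : Fin k × Fin l → ℂ) → ∑ₓ f ≈ ∑ₓ (λ x → f (swap x))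
  ∑ₓ-swap f = ∑-comm (λ i j → f (i , j))

  reflect : ∀ {k l} → Fin k × Fin l → Fin k × Fin l
  reflect (i , j) = opposite i , j

  ∑ₓ-reflect : ∀ {k l} (f : Fin k × Fin l → ℂ) → ∑ₓ f ≈ ∑ₓ (λ x → f (reflect x))
  ∑ₓ-reflect {k} {l} f = ∑-permute (λ i → ∑[ j < l ] f (i , j)) reverse

  𝟙-reflect : ∀ {k l} (x y : Fin k × Fin l) → 𝟙 (reflect x) (reflect y) ≈ 𝟙 x y
  𝟙-reflect (i , j) (i′ , j′) = when-≡ 1# (≡.cong (_∧ does (j Fin.≟ j′))
    (does-⇔ (mk⇔ injective (≡.cong opposite)) (opposite i Fin.≟ opposite i′) (i Fin.≟ i′)))
    where
    injective : opposite i ≡ opposite i′ → i ≡ i′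
    injective eq = ≡.trans (≡.sym (Fin.opposite-involutive i)) (≡.trans (≡.cong opposite eq) (Fin.opposite-involutive i′))

  module Inverse {n} (A : Black n → White n → ℂ) (A⁻¹ : White n → Black n → ℂ) (inv : IsInverse A A⁻¹) where

    resolveʳ : ∀ (v : White n → ℂ) x → ∑[ y ∈B n ] (A⁻¹ x y * (∑[ z ∈W n ] (A y z * v z))) ≈ v x
    resolveʳ v x = begin
      ∑[ y ∈B n ] (A⁻¹ x y * (∑[ z ∈W n ] (A y z * v z)))
        ≈⟨ ∑ₓ-cong (λ y → trans (∑ₓ-*ˡ (A⁻¹ x y) (λ z → A y z * v z)) (∑ₓ-cong (λ z → sym (*-assoc (A⁻¹ x y) (A y z) (v z))))) ⟩
      ∑[ y ∈B n ] ∑[ z ∈W n ] (A⁻¹ x y * A y z * v z)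
        ≈⟨ ∑ₓ-comm (λ y z → A⁻¹ x y * A y z * v z) ⟩
      ∑[ z ∈W n ] ∑[ y ∈B n ] (A⁻¹ x y * A y z * v z)
        ≈⟨ ∑ₓ-cong (λ z → trans (sym (∑ₓ-*ʳ (v z) (λ y → A⁻¹ x y * A y z))) (*-congʳ (proj₂ inv x z))) ⟩
      ∑[ z ∈W n ] (𝟙 x z * v z)
        ≈⟨ 𝟙-pick v x ⟩
      v x ∎

    resolveˡ : ∀ (u : Black n → ℂ) x → ∑[ z ∈W n ] ((∑[ y ∈B n ] (u y * A y z)) * A⁻¹ z x) ≈ u x
    resolveˡ u x = begin
      ∑[ z ∈W n ] ((∑[ y ∈B n ] (u y * A y z)) * A⁻¹ z x)
        ≈⟨ ∑ₓ-cong (λ z → trans (∑ₓ-*ʳ (A⁻¹ z x) (λ y → u y * A y z)) (∑ₓ-cong (λ y → *-assoc (u y) (A y z) (A⁻¹ z x)))) ⟩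
      ∑[ z ∈W n ] ∑[ y ∈B n ] (u y * (A y z * A⁻¹ z x))
        ≈⟨ ∑ₓ-comm (λ z y → u y * (A y z * A⁻¹ z x)) ⟩
      ∑[ y ∈B n ] ∑[ z ∈W n ] (u y * (A y z * A⁻¹ z x))
        ≈⟨ ∑ₓ-cong (λ y → trans (sym (∑ₓ-*ˡ (u y) (λ z → A y z * A⁻¹ z x)))
             (trans (*-congˡ (proj₁ inv y x)) (trans (*-comm _ _) (*-congʳ (𝟙-sym y x))))) ⟩
      ∑[ y ∈B n ] (𝟙 x y * u y)
        ≈⟨ 𝟙-pick u x ⟩
      u x ∎

    -- By `A⁻¹ = A⁻¹ (A B) = B` it suffices to exhibit a right inverse; both symmetries pass from
    -- `K` to its inverse in this way.
    unique : ∀ (B : White n → Black n → ℂ) →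
      (∀ x z → ∑[ y ∈W n ] (A x y * B y z) ≈ 𝟙 x z) → ∀ x z → A⁻¹ x z ≈ B x z
    unique B AB≈𝟙 x z = begin
      A⁻¹ x z
        ≈⟨ 𝟙-pick (A⁻¹ x) z ⟨
      ∑[ y ∈B n ] (𝟙 z y * A⁻¹ x y)
        ≈⟨ ∑ₓ-cong (λ y → trans (*-comm _ _) (*-congˡ {A⁻¹ x y} (trans (𝟙-sym z y) (sym (AB≈𝟙 y z))))) ⟩
      ∑[ y ∈B n ] (A⁻¹ x y * (∑[ w ∈W n ] (A y w * B w z)))
        ≈⟨ resolveʳ (λ w → B w z) x ⟩
      B x z ∎

  -- The entries need to agree only where the guard holds, so the coordinate equations of the edge
  -- may be used to compare them.
  when-== : ∀ {x₁ x₂ y₁ y₂} {z w : ℂ} {b} → ((x₁ ≡ᵇ y₁) ∧ (x₂ ≡ᵇ y₂)) ≡ b →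
    (x₁ ≡ y₁ → x₂ ≡ y₂ → z ≈ w) → (z when (x₁ , x₂) == (y₁ , y₂)) ≈ (w when b)
  when-== {x₁} {x₂} {y₁} {y₂} ≡.refl z≈w with x₁ ≡ᵇ y₁ in eq₁ | x₂ ≡ᵇ y₂ in eq₂
  ... | true  | true  = z≈w (ℕₚ.≡ᵇ⇒≡ x₁ y₁ (≡.subst T (≡.sym eq₁) _)) (ℕₚ.≡ᵇ⇒≡ x₂ y₂ (≡.subst T (≡.sym eq₂) _))
  ... | true  | false = refl
  ... | false | _     = refl

  when-swap : ∀ {x₁ x₂ y₁ y₂} {z w : ℂ} → (x₁ ≡ y₁ → x₂ ≡ y₂ → z ≈ w) →
    (z when (x₁ , x₂) == (y₁ , y₂)) ≈ (w when (y₂ , y₁) == (x₂ , x₁))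
  when-swap {x₁} {x₂} {y₁} {y₂} = when-== (≡.trans (∧-comm (x₁ ≡ᵇ y₁) (x₂ ≡ᵇ y₂))
    (≡.cong₂ _∧_ (≡ᵇ-⇔ {x₂} {y₂} {y₂} {x₂} ≡.sym ≡.sym) (≡ᵇ-⇔ {x₁} {y₁} {y₁} {x₁} ≡.sym ≡.sym)))

  odd-injective : ∀ {i k} → 2 ℕ.* i ℕ.+ 1 ≡ 2 ℕ.* k ℕ.+ 1 → i ≡ k
  odd-injective eq = ℕₚ.*-cancelˡ-≡ _ _ 2 (ℕₚ.+-cancelʳ-≡ 1 _ _ eq)

  odd+1-injective : ∀ {i k} → 2 ℕ.* i ℕ.+ 1 ℕ.+ 1 ≡ 2 ℕ.* k → suc i ≡ k
  odd+1-injective {i} eq = ℕₚ.*-cancelˡ-≡ _ _ 2 (≡.trans (≡.sym (odd+1 i)) eq)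

  -- Signs, odd powers of the imaginary unit and the gauge

  σ : ℕ → ℂ
  σ zero    = 1#
  σ (suc n) = - σ n

  σ-+ : ∀ m n → σ (m ℕ.+ n) ≈ σ m * σ n
  σ-+ zero    n = sym (*-identityˡ (σ n))
  σ-+ (suc m) n = trans (-‿cong (σ-+ m n)) (solve 2 (λ x y → :- (x :* y) := :- x :* y) refl (σ m) (σ n))

  σ*σ : ∀ n → σ n * σ n ≈ 1#
  σ*σ zero    = *-identityˡ 1#
  σ*σ (suc n) = trans (solve 1 (λ x → :- x :* :- x := x :* x) refl (σ n)) (σ*σ n)

  σ-double : ∀ r → σ (2 ℕ.* r) ≈ 1#
  σ-double r = trans (σ-+ r (r ℕ.+ 0)) (trans (*-congˡ (ℂᴿ.reflexive (≡.cong σ (ℕₚ.+-identityʳ r)))) (σ*σ r))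

  𝕚^odd : ∀ m → 𝕚 ^ (2 ℕ.* m ℕ.+ 1) ≈ 𝕚 * σ m
  𝕚^odd zero    = refl
  𝕚^odd (suc m) = trans (ℂᴿ.reflexive (≡.cong (𝕚 ^_) (lemma m))) (trans
    (sym (*-assoc 𝕚 𝕚 _))
    (trans (*-cong 𝕚*𝕚 (𝕚^odd m)) (solve 2 (λ i s → :- con (+ 1) :* (i :* s) := i :* :- s) refl 𝕚 (σ m))))
    where
    lemma : ∀ m → 2 ℕ.* suc m ℕ.+ 1 ≡ suc (suc (2 ℕ.* m ℕ.+ 1))
    lemma = solve-∀

  -- Here `m` and `m′` are the index sums of the ends of an edge: they agree in the directions `±e₂`
  -- and differ by one in the directions `±e₁`.
  gauge-equal : ∀ {m m′} → m ≡ m′ → - 𝕚 * (σ m * σ m′) ≈ - 𝕚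
  gauge-equal {m} ≡.refl = trans (*-congˡ (σ*σ m)) (*-identityʳ _)

  gauge-before : ∀ {m m′} → suc m ≡ m′ → - 𝕚 * (σ m * σ m′) ≈ 𝕚
  gauge-before {m} ≡.refl = trans
    (solve 2 (λ i s → :- i :* (s :* :- s) := i :* (s :* s)) refl 𝕚 (σ m))
    (trans (*-congˡ (σ*σ m)) (*-identityʳ _))

  gauge-after : ∀ {m m′} → m ≡ suc m′ → - 𝕚 * (σ m * σ m′) ≈ 𝕚
  gauge-after eq = trans (*-congˡ (*-comm _ _)) (gauge-before (≡.sym eq))

  𝕚*-𝕚 : ∀ z → z * 𝕚 * - 𝕚 ≈ z
  𝕚*-𝕚 z = trans
    (solve 2 (λ z i → z :* i :* :- i := z :* :- (i :* i)) refl z 𝕚)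
    (trans (*-congˡ (-‿cong 𝕚*𝕚)) (solve 1 (λ z → z :* :- :- con (+ 1) := z) refl z))

  module Symmetries (n r : ℕ) (n≡2r : n ≡ 2 ℕ.* r) where
    module _ (α β : ℝ₊) where
      out inn : Fin 2 → ℂ
      out ε = ⌜ mixed n α β α β ε ⌝
      inn ε = ⌜ mixed′ n α β α β ε ⌝

      out-opposite : ∀ ε → out ε ≈ inn (opposite ε)
      out-opposite 0F = ⌜⌝-cong (ℝ.trans (mixed-0 (proj₁ α) (proj₁ β)) (ℝ.sym (mixed′-1 (proj₁ α) (proj₁ β))))
      out-opposite 1F = ⌜⌝-cong (ℝ.trans (mixed-1 (proj₁ α) (proj₁ β)) (ℝ.sym (mixed′-0 (proj₁ α) (proj₁ β))))

      -- The exchange of coordinates also exchanges the colours, so edges are reversed: `e₁` and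
      -- `-e₁` trade places while `±e₂` stay. Along `±e₁` the new black vertex has the other class,
      -- which compensates for trading the outer weight for the inner one.
      K-swap : ∀ x y → K n α β x y ≈ K n α β (swap y) (swap x)
      K-swap (i , j) (k , l) = trans
        (+-cong (+-cong (+-cong (when-swap e₁) (when-swap e₂)) (when-swap e₃)) (when-swap e₄))
        (solve 4 (λ a b c d → a :+ b :+ c :+ d := c :+ b :+ a :+ d) refl _ _ _ _)
        where
        I = toℕ i
        J = toℕ j
        K′ = toℕ k
        L′ = toℕ l
        X₋ = 2 ℕ.* I
        X₊ = X₋ ℕ.+ 1
        Y₋ = 2 ℕ.* J ℕ.+ 1
        Y₊ = Y₋ ℕ.+ 1
        Z₋ = 2 ℕ.* K′ ℕ.+ 1
        Z₊ = Z₋ ℕ.+ 1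
        T₋ = 2 ℕ.* L′
        T₊ = T₋ ℕ.+ 1
        e₁ : X₊ ≡ Z₋ → Y₊ ≡ T₋ → out (cls I J) ≈ inn (cls L′ K′)
        e₁ p q with odd-injective {I} {K′} p | odd+1-injective {J} {L′} q
        ... | I≡K | 1+J≡L = trans (out-opposite (cls I J)) (ℂᴿ.reflexive (≡.cong inn
          (≡.trans (≡.cong opposite (cls-comm I J)) (≡.trans (≡.sym (cls-sucˡ J I)) (≡.cong₂ cls 1+J≡L I≡K)))))
        e₂ : X₋ ≡ Z₊ → Y₊ ≡ T₋ → inn (cls I J) * 𝕚 ≈ inn (cls L′ K′) * 𝕚
        e₂ p q with odd+1-injective {K′} {I} (≡.sym p) | odd+1-injective {J} {L′} q
        ... | 1+K≡I | 1+J≡L = *-congʳ (ℂᴿ.reflexive (≡.cong inn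
          (≡.trans (≡.cong (λ i → cls i J) (≡.sym 1+K≡I)) (≡.trans (cls-sucˡ K′ J) (≡.trans (≡.sym (cls-sucʳ K′ J))
            (≡.trans (≡.cong (cls K′) 1+J≡L) (cls-comm K′ L′)))))))
        e₃ : X₋ ≡ Z₊ → Y₋ ≡ T₊ → inn (cls I J) ≈ out (cls L′ K′)
        e₃ p q with odd+1-injective {K′} {I} (≡.sym p) | odd-injective {J} {L′} q
        ... | 1+K≡I | J≡L = trans (ℂᴿ.reflexive (≡.cong inn
          (≡.trans (≡.cong₂ cls (≡.sym 1+K≡I) J≡L) (≡.trans (cls-sucˡ K′ L′) (≡.cong opposite (cls-comm K′ L′))))))
          (sym (out-opposite (cls L′ K′)))
        e₄ : X₊ ≡ Z₋ → Y₋ ≡ T₊ → out (cls I J) * 𝕚 ≈ out (cls L′ K′) * 𝕚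
        e₄ p q with odd-injective {I} {K′} p | odd-injective {J} {L′} q
        ... | I≡K | J≡L = *-congʳ (ℂᴿ.reflexive (≡.cong out (≡.trans (cls-comm I J) (≡.cong₂ cls J≡L I≡K))))

      K⁻¹-swap : ∀ x y → K⁻¹ n α β x y ≈ K⁻¹ n α β (swap y) (swap x)
      K⁻¹-swap = Inverse.unique (K n α β) (K⁻¹ n α β) (K⁻¹-isInverse n α β) (λ x y → K⁻¹ n α β (swap y) (swap x)) λ x z → begin
        ∑[ y ∈W n ] (K n α β x y * K⁻¹ n α β (swap z) (swap y))
          ≈⟨ ∑ₓ-cong (λ y → trans (*-congʳ (K-swap x y)) (*-comm (K n α β (swap y) (swap x)) (K⁻¹ n α β (swap z) (swap y)))) ⟩
        ∑[ y ∈W n ] (K⁻¹ n α β (swap z) (swap y) * K n α β (swap y) (swap x))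
          ≈⟨ ∑ₓ-swap (λ y → K⁻¹ n α β (swap z) y * K n α β y (swap x)) ⟨
        ∑[ y ∈B n ] (K⁻¹ n α β (swap z) y * K n α β y (swap x))
          ≈⟨ proj₂ (K⁻¹-isInverse n α β) (swap z) (swap x) ⟩
        𝟙 (swap z) (swap x)
          ≈⟨ trans (𝟙-swap z x) (𝟙-sym z x) ⟩
        𝟙 x z ∎

    -- The two indices sum to `n - 1`, which is odd.
    σ-opposite : ∀ (i : Fin n) → σ (toℕ (opposite i)) ≈ - σ (toℕ i)
    σ-opposite i = begin
      σ i°
        ≈⟨ trans (sym (*-identityʳ _)) (*-congˡ (sym (σ*σ (toℕ i)))) ⟩
      σ i° * (σ (toℕ i) * σ (toℕ i))
        ≈⟨ solve 2 (λ x y → x :* (y :* y) := x :* :- y :* :- y) refl (σ i°) (σ (toℕ i)) ⟩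
      σ i° * σ (suc (toℕ i)) * - σ (toℕ i)
        ≈⟨ *-congʳ (trans (sym (σ-+ i° (suc (toℕ i)))) (trans (ℂᴿ.reflexive (≡.cong σ (≡.trans (opposite-+ i) n≡2r))) (σ-double r))) ⟩
      1# * - σ (toℕ i)
        ≈⟨ *-identityˡ _ ⟩
      - σ (toℕ i) ∎
      where i° = toℕ (opposite i)

    σ-n+ : ∀ j → σ (n ℕ.+ j) ≈ σ j
    σ-n+ j = trans (σ-+ n j) (trans (*-congʳ (trans (ℂᴿ.reflexive (≡.cong σ n≡2r)) (σ-double r))) (*-identityˡ _))

    module _ (α β : ℝ₊) where
      out≈inn : ∀ ε → out α β ε ≈ inn β α ε
      out≈inn ε = ⌜⌝-cong (ℝ.+-comm _ _)

      inn≈out : ∀ ε → inn α β ε ≈ out β α ε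
      inn≈out ε = ⌜⌝-cong (ℝ.+-comm _ _)

      -- On an edge this is 𝕚 in the directions ±e₁ and -𝕚 in the directions ±e₂.
      gauge : Black n → White n → ℂ
      gauge (i , j) (k , l) = - 𝕚 * (σ (toℕ i ℕ.+ toℕ j) * σ (toℕ k ℕ.+ toℕ l))

      -- The reflection exchanges `e₁` with `e₂` and `-e₁` with `-e₂`, hence outer with inner
      -- weights, and exchanging `α` with `β` undoes this. Classes survive because `n` is even. The
      -- gauge moves the factor `𝕚` to the other pair of directions.
      K-reflect : ∀ x y → K n α β x y * gauge x y ≈ K n β α (reflect x) (reflect y)
      K-reflect x@(i , j) y@(k , l) = begin
        (t₁ + t₂ + t₃ + t₄) * g
          ≈⟨ solve 5 (λ a b c d g → (a :+ b :+ c :+ d) :* g := b :* g :+ a :* g :+ d :* g :+ c :* g) refl t₁ t₂ t₃ t₄ g ⟩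
        t₂ * g + t₁ * g + t₄ * g + t₃ * g
          ≈⟨ +-cong (+-cong (+-cong
               (regroup X₋ Y₊ Z₊ T₋ (inn α β (cls I J) * 𝕚) (≡.cong (_∧ (Y₊ ≡ᵇ T₋)) even⇒odd) e₂)
               (regroup X₊ Y₊ Z₋ T₋ (out α β (cls I J)) (≡.cong (_∧ (Y₊ ≡ᵇ T₋)) odd⇒even) e₁))
               (regroup X₊ Y₋ Z₋ T₊ (out α β (cls I J) * 𝕚) (≡.cong (_∧ (Y₋ ≡ᵇ T₊)) odd⇒even) e₄))
               (regroup X₋ Y₋ Z₊ T₊ (inn α β (cls I J)) (≡.cong (_∧ (Y₋ ≡ᵇ T₊)) even⇒odd) e₃) ⟩
        K n β α (reflect x) (reflect y) ∎
        where
        I = toℕ i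
        J = toℕ j
        K′ = toℕ k
        L′ = toℕ l
        X₋ = 2 ℕ.* I
        X₊ = X₋ ℕ.+ 1
        Y₋ = 2 ℕ.* J ℕ.+ 1
        Y₊ = Y₋ ℕ.+ 1
        Z₋ = 2 ℕ.* K′ ℕ.+ 1
        Z₊ = Z₋ ℕ.+ 1
        T₋ = 2 ℕ.* L′
        T₊ = T₋ ℕ.+ 1
        I° = toℕ (opposite i)
        K° = toℕ (opposite k)
        g = gauge x y
        regroup : ∀ x₁ x₂ y₁ y₂ (z : ℂ) {w b} → ((x₁ ≡ᵇ y₁) ∧ (x₂ ≡ᵇ y₂)) ≡ b →
          (x₁ ≡ y₁ → x₂ ≡ y₂ → z * g ≈ w) → (z when (x₁ , x₂) == (y₁ , y₂)) * g ≈ (w when b)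
        regroup x₁ x₂ y₁ y₂ z eq zg≈w = trans (when-*ʳ ((x₁ , x₂) == (y₁ , y₂)) z g) (when-== eq zg≈w)
        t₁ = out α β (cls I J)     when (X₊ , Y₊) == (Z₋ , T₋)
        t₂ = inn α β (cls I J) * 𝕚 when (X₋ , Y₊) == (Z₊ , T₋)
        t₃ = inn α β (cls I J)     when (X₋ , Y₋) == (Z₊ , T₊)
        t₄ = out α β (cls I J) * 𝕚 when (X₊ , Y₋) == (Z₋ , T₊)
        complement : I° ℕ.+ I ≡ K° ℕ.+ suc K′
        complement = ≡.trans (opposite-+′ i) (≡.sym (opposite-+ k))
        complement′ : I° ℕ.+ I ≡ suc K° ℕ.+ K′
        complement′ = ≡.trans complement (ℕₚ.+-suc K° K′)
        even⇒odd : (X₋ ≡ᵇ Z₊) ≡ (2 ℕ.* I° ℕ.+ 1 ≡ᵇ 2 ℕ.* K° ℕ.+ 1)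
        even⇒odd = ≡.trans (even-odd+1 I K′) (≡.trans
          (≡ᵇ-⇔ {I} {suc K′} {I°} {K°} (cancelʳ-by complement) (cancelˡ-by complement))
          (≡.sym (odd-odd I° K°)))
        odd⇒even : (X₊ ≡ᵇ Z₋) ≡ (2 ℕ.* I° ≡ᵇ 2 ℕ.* K° ℕ.+ 1 ℕ.+ 1)
        odd⇒even = ≡.trans (odd-odd I K′) (≡.trans
          (≡ᵇ-⇔ {I} {K′} {I°} {suc K°} (cancelʳ-by complement′) (cancelˡ-by complement′))
          (≡.sym (even-odd+1 I° K°)))
        cls-reflect : cls I J ≡ cls I° J
        cls-reflect = ≡.trans (cls-parity I J) (≡.trans
          (≡.sym (parity-+-double (I ℕ.+ J) r))
          (≡.trans (≡.cong parity same) (≡.trans (parity-+-double (I° ℕ.+ J) I) (≡.sym (cls-parity I° J)))))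
          where
          rearrange : ∀ I J I° → I ℕ.+ J ℕ.+ (I° ℕ.+ I) ≡ I° ℕ.+ J ℕ.+ 2 ℕ.* I
          rearrange = solve-∀
          same : I ℕ.+ J ℕ.+ 2 ℕ.* r ≡ I° ℕ.+ J ℕ.+ 2 ℕ.* I
          same = ≡.trans (≡.cong (I ℕ.+ J ℕ.+_) (≡.trans (≡.sym n≡2r) (≡.sym (opposite-+′ i)))) (rearrange I J I°)
        e₁ : X₊ ≡ Z₋ → Y₊ ≡ T₋ → out α β (cls I J) * g ≈ inn β α (cls I° J) * 𝕚
        e₁ p q = *-cong (trans (out≈inn (cls I J)) (ℂᴿ.reflexive (≡.cong (inn β α) cls-reflect)))
          (gauge-before (≡.trans (≡.sym (ℕₚ.+-suc I J)) (≡.cong₂ ℕ._+_ (odd-injective {I} {K′} p) (odd+1-injective {J} {L′} q))))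
        e₂ : X₋ ≡ Z₊ → Y₊ ≡ T₋ → inn α β (cls I J) * 𝕚 * g ≈ out β α (cls I° J)
        e₂ p q = trans (*-congˡ (gauge-equal
            (≡.trans (≡.cong (ℕ._+ J) (≡.sym (odd+1-injective {K′} {I} (≡.sym p))))
              (≡.trans (≡.sym (ℕₚ.+-suc K′ J)) (≡.cong (K′ ℕ.+_) (odd+1-injective {J} {L′} q))))))
          (trans (𝕚*-𝕚 _) (trans (inn≈out (cls I J)) (ℂᴿ.reflexive (≡.cong (out β α) cls-reflect))))
        e₃ : X₋ ≡ Z₊ → Y₋ ≡ T₊ → inn α β (cls I J) * g ≈ out β α (cls I° J) * 𝕚
        e₃ p q = *-cong (trans (inn≈out (cls I J)) (ℂᴿ.reflexive (≡.cong (out β α) cls-reflect)))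
          (gauge-after (≡.cong₂ ℕ._+_ (≡.sym (odd+1-injective {K′} {I} (≡.sym p))) (odd-injective {J} {L′} q)))
        e₄ : X₊ ≡ Z₋ → Y₋ ≡ T₊ → out α β (cls I J) * 𝕚 * g ≈ inn β α (cls I° J)
        e₄ p q = trans (*-congˡ (gauge-equal (≡.cong₂ ℕ._+_ (odd-injective {I} {K′} p) (odd-injective {J} {L′} q))))
          (trans (𝕚*-𝕚 _) (trans (out≈inn (cls I J)) (ℂᴿ.reflexive (≡.cong (inn β α) cls-reflect))))

      -- The gauge is a constant times a sign for each end. In `K B` the white sign complements `K`
      -- to `K-reflect` once `σᴮ x * σᴮ x ≈ 1` is inserted; the signs of the black vertices leave
      -- the sum and cancel on the diagonal.
      K⁻¹-reflect : ∀ y x → K⁻¹ n α β y x ≈ gauge x y * K⁻¹ n β α (reflect y) (reflect x)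
      K⁻¹-reflect = Inverse.unique (K n α β) (K⁻¹ n α β) (K⁻¹-isInverse n α β) B λ x z → begin
        ∑[ y ∈W n ] (K n α β x y * B y z)
          ≈⟨ ∑ₓ-cong (λ y → trans (regauge x z y) (*-congˡ (*-congʳ (K-reflect x y)))) ⟩
        ∑[ y ∈W n ] (σᴮ z * σᴮ x * (K n β α (reflect x) (reflect y) * K⁻¹ n β α (reflect y) (reflect z)))
          ≈⟨ ∑ₓ-*ˡ (σᴮ z * σᴮ x) (λ y → K n β α (reflect x) (reflect y) * K⁻¹ n β α (reflect y) (reflect z)) ⟨
        σᴮ z * σᴮ x * (∑[ y ∈W n ] (K n β α (reflect x) (reflect y) * K⁻¹ n β α (reflect y) (reflect z)))
          ≈⟨ *-congˡ (trans (sym (∑ₓ-reflect (λ y → K n β α (reflect x) y * K⁻¹ n β α y (reflect z))))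
               (trans (proj₁ (K⁻¹-isInverse n β α) (reflect x) (reflect z)) (𝟙-reflect x z))) ⟩
        σᴮ z * σᴮ x * 𝟙 x z
          ≈⟨ trans (*-assoc _ _ _) (*-congˡ (𝟙-cong σᴮ x z)) ⟩
        σᴮ z * (σᴮ z * 𝟙 x z)
          ≈⟨ trans (sym (*-assoc _ _ _)) (trans (*-congʳ (σ*σ (index z))) (*-identityˡ _)) ⟩
        𝟙 x z ∎
        where
        index : Black n → ℕ
        index (i , j) = toℕ i ℕ.+ toℕ j
        σᴮ : Black n → ℂ
        σᴮ x = σ (index x)
        B : White n → Black n → ℂ
        B y x = gauge x y * K⁻¹ n β α (reflect y) (reflect x)
        regauge : ∀ x z y → K n α β x y * B y z
          ≈ σᴮ z * σᴮ x * ((K n α β x y * gauge x y) * K⁻¹ n β α (reflect y) (reflect z))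
        regauge x z y@(k , l) = begin
          K n α β x y * (- 𝕚 * (σᴮ z * s) * k⁻¹)
            ≈⟨ *-congˡ (*-congʳ (*-congˡ (*-congʳ (trans (sym (*-identityʳ _)) (*-congˡ (sym (σ*σ (index x)))))))) ⟩
          K n α β x y * (- 𝕚 * (σᴮ z * (σᴮ x * σᴮ x) * s) * k⁻¹)
            ≈⟨ solve 6 (λ k i z x s k⁻¹ → k :* (:- i :* (z :* (x :* x) :* s) :* k⁻¹) := z :* x :* ((k :* (:- i :* (x :* s))) :* k⁻¹))
                 refl (K n α β x y) 𝕚 (σᴮ z) (σᴮ x) s k⁻¹ ⟩
          σᴮ z * σᴮ x * ((K n α β x y * gauge x y) * k⁻¹) ∎
          where
          s = σ (toℕ k ℕ.+ toℕ l)
          k⁻¹ = K⁻¹ n β α (reflect y) (reflect z)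

      bottom-right : ∀ (i j : Fin n) → K⁻¹ n α β (i , zero) (fromℕ n , j)
        ≈ 𝕚 * σ (toℕ (opposite i) ℕ.+ toℕ j) * L n β α (opposite i) j
      bottom-right i j = trans (K⁻¹-reflect (i , zero) (fromℕ n , j)) (*-cong
        (begin
          - 𝕚 * (σ (toℕ (fromℕ n) ℕ.+ toℕ j) * σ (toℕ i ℕ.+ 0))
            ≈⟨ *-congˡ (*-cong
                 (trans (ℂᴿ.reflexive (≡.cong (λ k → σ (k ℕ.+ toℕ j)) (Fin.toℕ-fromℕ n))) (σ-n+ (toℕ j)))
                 (ℂᴿ.reflexive (≡.cong σ (ℕₚ.+-identityʳ (toℕ i))))) ⟩
          - 𝕚 * (σ (toℕ j) * σ (toℕ i))
            ≈⟨ solve 3 (λ i x y → :- i :* (x :* y) := i :* (:- y :* x)) refl 𝕚 (σ (toℕ j)) (σ (toℕ i)) ⟩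
          𝕚 * (- σ (toℕ i) * σ (toℕ j))
            ≈⟨ *-congˡ (trans (*-congʳ (sym (σ-opposite i))) (sym (σ-+ (toℕ (opposite i)) (toℕ j)))) ⟩
          𝕚 * σ (toℕ (opposite i) ℕ.+ toℕ j) ∎)
        (ℂᴿ.reflexive (≡.cong (λ k → K⁻¹ n β α (opposite i , zero) (k , j)) (opposite-fromℕ n))))

      L-sym : ∀ (i j : Fin n) → L n α β i j ≈ L n α β j i
      L-sym i j = K⁻¹-swap α β (i , zero) (zero , j)

    module _ (α β : ℝ₊) where
      -- The exchange of coordinates carries this pair of sides to that of `bottom-right`.
      top-left : ∀ (i j : Fin n) → K⁻¹ n α β (i , fromℕ n) (zero , j)
        ≈ 𝕚 * σ (toℕ (opposite j) ℕ.+ toℕ i) * L n β α i (opposite j)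
      top-left i j = trans (K⁻¹-swap α β (i , fromℕ n) (zero , j))
        (trans (bottom-right α β j i) (*-congˡ (L-sym β α (opposite j) i)))

    module _ (α β : ℝ₊) where
      -- One reflection leads to `top-left`, which contains another: `α` and `β` return to their
      -- places and the two gauge factors multiply to `1`.
      top-right : ∀ (i j : Fin n) → K⁻¹ n α β (i , fromℕ n) (fromℕ n , j) ≈ L n α β (opposite i) (opposite j)
      top-right i j = begin
        K⁻¹ n α β (i , fromℕ n) (fromℕ n , j)
          ≈⟨ K⁻¹-reflect α β (i , fromℕ n) (fromℕ n , j) ⟩
        - 𝕚 * (σ (toℕ (fromℕ n) ℕ.+ J) * σ (I ℕ.+ toℕ (fromℕ n))) * K⁻¹ n β α (opposite i , fromℕ n) (opposite (fromℕ n) , j)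
          ≈⟨ *-cong (*-congˡ (*-cong
               (trans (ℂᴿ.reflexive (≡.cong (λ k → σ (k ℕ.+ J)) (Fin.toℕ-fromℕ n))) (σ-n+ J))
               (trans (ℂᴿ.reflexive (≡.cong σ (≡.trans (≡.cong (I ℕ.+_) (Fin.toℕ-fromℕ n)) (ℕₚ.+-comm I n)))) (σ-n+ I))))
               (trans (ℂᴿ.reflexive (≡.cong (λ k → K⁻¹ n β α (opposite i , fromℕ n) (k , j)) (opposite-fromℕ n)))
                 (top-left β α (opposite i) j)) ⟩
        - 𝕚 * (σ J * σ I) * (𝕚 * σ (J° ℕ.+ I°) * l)
          ≈⟨ *-congˡ (*-congʳ (*-congˡ (trans (σ-+ J° I°) (*-cong (σ-opposite j) (σ-opposite i))))) ⟩
        - 𝕚 * (σ J * σ I) * (𝕚 * (- σ J * - σ I) * l)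
          ≈⟨ solve 4 (λ i x y l → :- i :* (x :* y) :* (i :* (:- x :* :- y) :* l) := :- (i :* i) :* ((x :* x) :* (y :* y)) :* l) refl 𝕚 (σ J) (σ I) l ⟩
        - (𝕚 * 𝕚) * ((σ J * σ J) * (σ I * σ I)) * l
          ≈⟨ *-congʳ (*-cong (-‿cong 𝕚*𝕚) (*-cong (σ*σ J) (σ*σ I))) ⟩
        - (- 1#) * (1# * 1#) * l
          ≈⟨ solve 1 (λ l → :- :- con (+ 1) :* (con (+ 1) :* con (+ 1)) :* l := l) refl l ⟩
        l ∎
        where
        I = toℕ i
        J = toℕ j
        I° = toℕ (opposite i)
        J° = toℕ (opposite j)
        l = L n α β (opposite i) (opposite j)

    -- The index `i` forces `0 < n`, so the subtraction is not truncated; as a sum it lets the later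
    -- subtractions cancel exactly.
    2n∸1 : ∀ (i : Fin n) → 2 ℕ.* n ∸ 1 ≡ 2 ℕ.* toℕ (opposite i) ℕ.+ (2 ℕ.* toℕ i ℕ.+ 1)
    2n∸1 i = ≡.cong (_∸ 1) (≡.trans (≡.cong (2 ℕ.*_) (≡.sym (opposite-+ i))) (split (toℕ (opposite i)) (toℕ i)))
      where
      split : ∀ p q → 2 ℕ.* (p ℕ.+ suc q) ≡ 1 ℕ.+ (2 ℕ.* p ℕ.+ (2 ℕ.* q ℕ.+ 1))
      split = solve-∀

    exponent : ∀ (i : Fin n) → 2 ℕ.* n ∸ 1 ∸ (2 ℕ.* toℕ i ℕ.+ 1) ≡ 2 ℕ.* toℕ (opposite i)
    exponent i = ≡.trans (≡.cong (_∸ (2 ℕ.* toℕ i ℕ.+ 1)) (2n∸1 i)) (ℕₚ.m+n∸n≡m _ (2 ℕ.* toℕ i ℕ.+ 1))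

    𝕚-bottom-right : ∀ (i j : Fin n) → 𝕚 ^ (2 ℕ.* n ∸ 1 ∸ (2 ℕ.* toℕ i ℕ.+ 1) ℕ.+ (2 ℕ.* toℕ j ℕ.+ 1))
      ≈ 𝕚 * σ (toℕ (opposite i) ℕ.+ toℕ j)
    𝕚-bottom-right i j = trans
      (ℂᴿ.reflexive (≡.cong (𝕚 ^_) (≡.trans (≡.cong (ℕ._+ (2 ℕ.* toℕ j ℕ.+ 1)) (exponent i)) (position-sum (toℕ (opposite i)) (toℕ j)))))
      (𝕚^odd (toℕ (opposite i) ℕ.+ toℕ j))

    𝕚-top-left : ∀ (i j : Fin n) → 𝕚 ^ (2 ℕ.* n ∸ 1 ℕ.+ (2 ℕ.* toℕ i ℕ.+ 1) ∸ (2 ℕ.* toℕ j ℕ.+ 1))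
      ≈ 𝕚 * σ (toℕ (opposite j) ℕ.+ toℕ i)
    𝕚-top-left i j = trans
      (ℂᴿ.reflexive (≡.cong (𝕚 ^_) (ℕₚ.+-∸-comm (2 ℕ.* toℕ i ℕ.+ 1)
        (≡.subst (2 ℕ.* toℕ j ℕ.+ 1 ℕ.≤_) (≡.sym (2n∸1 j)) (ℕₚ.m≤n+m _ (2 ℕ.* toℕ (opposite j)))))))
      (𝕚-bottom-right j i)

    symmetries : ∀ α β (i j : Fin n) →
         let x₁ = 2 ℕ.* toℕ i ℕ.+ 1
             y₂ = 2 ℕ.* toℕ j ℕ.+ 1 in
           (K⁻¹ n α β (sideᵂ 0F i) (sideᴮ 0F j) ≈ L n α β i j)
         × (K⁻¹ n α β (sideᵂ 0F i) (sideᴮ 1F j)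
              ≈ 𝕚 ^ (2 ℕ.* n ∸ 1 ∸ x₁ ℕ.+ y₂) * L n β α (opposite i) j)
         × (K⁻¹ n α β (sideᵂ 1F i) (sideᴮ 0F j)
              ≈ 𝕚 ^ (2 ℕ.* n ∸ 1 ℕ.+ x₁ ∸ y₂) * L n β α i (opposite j))
         × (K⁻¹ n α β (sideᵂ 1F i) (sideᴮ 1F j) ≈ L n α β (opposite i) (opposite j))
    symmetries α β i j =
        refl
      , trans (bottom-right α β i j) (*-congʳ (sym (𝕚-bottom-right i j)))
      , trans (top-left α β i j) (*-congʳ (sym (𝕚-top-left i j)))
      , top-right α β i j

  -- The generating function

  f-*-1-t : ∀ k t ⦃ _ : NonZero (1# - t) ⦄ → f k t * (1# - t) ≈ 1# - t ^ k
  f-*-1-t k t = trans (*-assoc _ _ _) (trans (*-congˡ (⁻¹-inverseˡ (1# - t))) (*-identityʳ _))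

  f-suc : ∀ k t ⦃ _ : NonZero (1# - t) ⦄ → f (suc k) t ≈ 1# + t * f k t
  f-suc k t = begin
    (1# - t * t ^ k) * u
      ≈⟨ *-congʳ (solve 2 (λ t p → con (+ 1) :- t :* p := (con (+ 1) :- t) :+ t :* (con (+ 1) :- p)) refl t (t ^ k)) ⟩
    ((1# - t) + t * (1# - t ^ k)) * u
      ≈⟨ solve 4 (λ t d p u → (d :+ t :* p) :* u := u :* d :+ t :* (p :* u)) refl t (1# - t) (1# - t ^ k) u ⟩
    u * (1# - t) + t * f k t
      ≈⟨ +-congʳ (⁻¹-inverseˡ (1# - t)) ⟩
    1# + t * f k t ∎
    where u = (1# - t) ⁻¹

  f-zero : ∀ t ⦃ _ : NonZero (1# - t) ⦄ → f 0 t ≈ 0#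
  f-zero t = trans (*-congʳ (ℂᴿ.-‿inverseʳ 1#)) (ℂᴿ.zeroˡ _)

  -- Pairing consecutive terms leaves a geometric series with `r` terms and ratio `x * x`. The ratio
  -- is a separate `t` because the formula for `d` writes it as a product of fourth powers.
  periodic-sum : ∀ r {n} → n ≡ 2 ℕ.* r → ∀ x t ⦃ _ : NonZero (1# - t) ⦄ → t ≈ x * x →
    ∀ (g : ℕ → ℂ) → (∀ i → g (2 ℕ.+ i) ≈ g i) →
    ∑[ i < n ] (x ^ toℕ i * g (toℕ i)) ≈ f r t * (g 0 + x * g 1)
  periodic-sum zero    ≡.refl x t t≈x² g periodic = sym (trans (*-congʳ (f-zero t)) (ℂᴿ.zeroˡ _))
  periodic-sum (suc r) n≡ x t t≈x² g periodic with ≡.trans n≡ (ℕₚ.*-suc 2 r)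
  ... | ≡.refl = begin
    1# * g 0 + (x * 1# * g 1 + (∑[ i < 2 ℕ.* r ] (x * (x * x ^ toℕ i) * g (2 ℕ.+ toℕ i))))
      ≈⟨ +-congˡ (+-congˡ (begin
           ∑[ i < 2 ℕ.* r ] (x * (x * x ^ toℕ i) * g (2 ℕ.+ toℕ i))
             ≈⟨ sum-cong {2 ℕ.* r} (λ i → trans
                  (solve 3 (λ x p g → x :* (x :* p) :* g := x :* x :* (p :* g)) refl x (x ^ toℕ i) (g (2 ℕ.+ toℕ i)))
                  (*-cong (sym t≈x²) (*-congˡ (periodic (toℕ i))))) ⟩
           ∑[ i < 2 ℕ.* r ] (t * (x ^ toℕ i * g (toℕ i)))
             ≈⟨ *-distribˡ-sum {2 ℕ.* r} t (λ i → x ^ toℕ i * g (toℕ i)) ⟨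
           t * (∑[ i < 2 ℕ.* r ] (x ^ toℕ i * g (toℕ i)))
             ≈⟨ *-congˡ (periodic-sum r ≡.refl x t t≈x² g periodic) ⟩
           t * (f r t * (g 0 + x * g 1)) ∎)) ⟩
    1# * g 0 + (x * 1# * g 1 + t * (f r t * (g 0 + x * g 1)))
      ≈⟨ solve 5 (λ g₀ g₁ x t f → con (+ 1) :* g₀ :+ (x :* con (+ 1) :* g₁ :+ t :* (f :* (g₀ :+ x :* g₁)))
           := (con (+ 1) :+ t :* f) :* (g₀ :+ x :* g₁)) refl (g 0) (g 1) x t (f r t) ⟩
    (1# + t * f r t) * (g 0 + x * g 1)
      ≈⟨ *-congʳ (sym (f-suc r t)) ⟩
    f (suc r) t * (g 0 + x * g 1) ∎

  ∑-snoc : ∀ n (g : ℕ → ℂ) → ∑[ i < suc n ] g (toℕ i) ≈ ∑[ i < n ] g (toℕ i) + g n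
  ∑-snoc zero    g = +-comm _ _
  ∑-snoc (suc n) g = trans (+-congˡ (∑-snoc n (λ i → g (suc i)))) (sym (+-assoc _ _ _))

  parity-periodic : ∀ (g : Fin 2 → ℂ) i → g (parity (2 ℕ.+ i)) ≈ g (parity i)
  parity-periodic g i = ℂᴿ.reflexive (≡.cong g (parity-2+ i))

  x-y≈0 : ∀ {x y} → x ≈ y → x - y ≈ 0#
  x-y≈0 {y = y} x≈y = trans (+-congʳ x≈y) (ℂᴿ.-‿inverseʳ y)

  fourth-power : ∀ x y → x ^ 4 * y ^ 4 ≈ (x ^ 2 * y ^ 2) * (x ^ 2 * y ^ 2)
  fourth-power = solve 2 (λ x y → let l = con (+ 1) in
    x :* (x :* (x :* (x :* l))) :* (y :* (y :* (y :* (y :* l))))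
      := (x :* (x :* l) :* (y :* (y :* l))) :* (x :* (x :* l) :* (y :* (y :* l)))) refl

  gather : ∀ n (g : Fin 2 → Fin 2 → Fin 2 → Fin n → Fin n → ℂ) →
    ∑[ δ < 2 ] ∑[ k < 2 ] ∑[ l < 2 ] ∑[ i < n ] ∑[ j < n ] g δ k l i j
      ≈ ∑[ k < 2 ] ∑[ l < 2 ] ∑[ i < n ] ∑[ j < n ] ∑[ δ < 2 ] g δ k l i j
  gather n g = trans (∑-comm {2} {2} (λ δ k → ∑[ l < 2 ] ∑[ i < n ] ∑[ j < n ] g δ k l i j)) (sum-cong {2} λ k →
    trans (∑-comm {2} {2} (λ δ l → ∑[ i < n ] ∑[ j < n ] g δ k l i j)) (sum-cong {2} λ l →
    trans (∑-comm {2} {n} (λ δ i → ∑[ j < n ] g δ k l i j)) (sum-cong {n} λ i →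
    ∑-comm {2} {n} (λ δ j → g δ k l i j))))

  -- The class sums move inside the sums over sides and positions, since the class of a vertex is
  -- determined only once its side and position are fixed.
  collapse-classes : ∀ n z (t : Fin 2 → Fin 2 → Fin 2 → Fin 2 → Fin n → Fin n → ℂ)
    (e : Fin 2 → Fin 2 → Fin n → Fin n → ℂ) →
    (∀ k l i j → ∑[ ε < 2 ] ∑[ δ < 2 ] t ε δ k l i j ≈ z * e k l i j) →
    ∑[ ε < 2 ] ∑[ δ < 2 ] ∑[ k < 2 ] ∑[ l < 2 ] ∑[ i < n ] ∑[ j < n ] t ε δ k l i j
      ≈ z * (∑[ k < 2 ] ∑[ l < 2 ] ∑[ i < n ] ∑[ j < n ] e k l i j)
  collapse-classes n z t e eq = begin
    ∑[ ε < 2 ] ∑[ δ < 2 ] ∑[ k < 2 ] ∑[ l < 2 ] ∑[ i < n ] ∑[ j < n ] t ε δ k l i j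
      ≈⟨ sum-cong {2} (λ ε → gather n (t ε)) ⟩
    ∑[ ε < 2 ] ∑[ k < 2 ] ∑[ l < 2 ] ∑[ i < n ] ∑[ j < n ] ∑[ δ < 2 ] t ε δ k l i j
      ≈⟨ gather n (λ ε k l i j → ∑[ δ < 2 ] t ε δ k l i j) ⟩
    ∑[ k < 2 ] ∑[ l < 2 ] ∑[ i < n ] ∑[ j < n ] ∑[ ε < 2 ] ∑[ δ < 2 ] t ε δ k l i j
      ≈⟨ sum-cong {2} (λ k → trans (sum-cong {2} (λ l → trans (sum-cong {n} (λ i →
           trans (sum-cong {n} (λ j → eq k l i j)) (sym (*-distribˡ-sum {n} z (e k l i)))))
           (sym (*-distribˡ-sum {n} z (λ i → ∑[ j < n ] e k l i j)))))
           (sym (*-distribˡ-sum {2} z (λ l → ∑[ i < n ] ∑[ j < n ] e k l i j)))) ⟩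
    ∑[ k < 2 ] (z * (∑[ l < 2 ] ∑[ i < n ] ∑[ j < n ] e k l i j))
      ≈⟨ *-distribˡ-sum {2} z (λ k → ∑[ l < 2 ] ∑[ i < n ] ∑[ j < n ] e k l i j) ⟨
    z * (∑[ k < 2 ] ∑[ l < 2 ] ∑[ i < n ] ∑[ j < n ] e k l i j) ∎

  when-∧ : ∀ p q z → (z when p ∧ q) ≈ ((z when q) when p)
  when-∧ true  q z = refl
  when-∧ false q z = refl

  ∑-when : ∀ p (g : Fin 2 → ℂ) → ∑[ δ < 2 ] (g δ when p) ≈ (∑[ δ < 2 ] g δ when p)
  ∑-when true  g = refl
  ∑-when false g = sum-replicate-zero 2

  ∑-classes : ∀ x m → proj₁ x ℕ.+ proj₂ x ≡ 2 ℕ.* m ℕ.+ 1 → ∀ y m′ → proj₁ y ℕ.+ proj₂ y ≡ 2 ℕ.* m′ ℕ.+ 1 →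
    ∀ (g : Fin 2 → Fin 2 → ℂ) →
    ∑[ ε < 2 ] ∑[ δ < 2 ] (g ε δ when (x ∈ᵇ ε) ∧ (y ∈ᵇ δ)) ≈ g (parity m) (parity m′)
  ∑-classes x m eq y m′ eq′ g = trans
    (sum-cong {2} (λ ε → trans
       (sum-cong {2} (λ δ → when-∧ (x ∈ᵇ ε) (y ∈ᵇ δ) (g ε δ)))
       (trans (∑-when (x ∈ᵇ ε) (λ δ → g ε δ when y ∈ᵇ δ))
         (when-cong (x ∈ᵇ ε) (∑-class y m′ eq′ (g ε))))))
    (∑-class x m eq (λ ε → g ε (parity m′)))

  -- Elimination of the intermediate sum

  solve-for : ∀ {u z} → u * z ≈ 1# → ∀ {x y t} → z * x + y ≈ t → x ≈ u * (t - y)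
  solve-for {u} {z} uz≈1 {x} {y} {t} eq = begin
    x
      ≈⟨ trans (*-congʳ uz≈1) (*-identityˡ x) ⟨
    u * z * x
      ≈⟨ solve 4 (λ u z x y → u :* z :* x := u :* (z :* x :+ y :- y)) refl u z x y ⟩
    u * (z * x + y - y)
      ≈⟨ *-congˡ (+-congʳ eq) ⟩
    u * (t - y) ∎

  -- The quotient in the formula divides by the product of the two `c∂` through a reciprocal of its
  -- own, to be compared with the product of the separate ones.
  recip-unique : ∀ {u v w x y} → u * x ≈ 1# → v * y ≈ 1# → w * (x * y) ≈ 1# → u * v ≈ w
  recip-unique {u} {v} {w} {x} {y} ux≈1 vy≈1 wxy≈1 = begin
    u * v
      ≈⟨ trans (*-congʳ wxy≈1) (*-identityˡ _) ⟨
    w * (x * y) * (u * v)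
      ≈⟨ solve 5 (λ u v w x y → w :* (x :* y) :* (u :* v) := w :* ((u :* x) :* (v :* y))) refl u v w x y ⟩
    w * ((u * x) * (v * y))
      ≈⟨ *-congˡ (*-cong ux≈1 vy≈1) ⟩
    w * (1# * 1#)
      ≈⟨ solve 1 (λ w → w :* (con (+ 1) :* con (+ 1)) := w) refl w ⟩
    w ∎

  -- Applied with `g` the generating function, `h` the sum of `s K⁻¹ b`, `e` that of `s K⁻¹ s`, `t`
  -- the sum of `U b` and `δ * φ` that of `s V`. The bracket in the result is then `d`.
  eliminate : ∀ {u v w z y g h e t δ φ} →
    u * z ≈ 1# → v * y ≈ 1# → w * (z * y) ≈ 1# →
    z * g + h ≈ t → δ * φ ≈ y * h + e →
    g ≈ (t - δ * v * φ) * u + w * e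
  eliminate {u} {v} {w} {z} {y} {g} {h} {e} {t} {δ} {φ} uz≈1 vy≈1 wzy≈1 g-eq h-eq = begin
    g
      ≈⟨ solve-for uz≈1 g-eq ⟩
    u * (t - h)
      ≈⟨ *-congˡ (+-congˡ (-‿cong (solve-for vy≈1 (sym h-eq)))) ⟩
    u * (t - v * (δ * φ - e))
      ≈⟨ solve 6 (λ u v t δ φ e → u :* (t :- v :* (δ :* φ :- e)) := (t :- δ :* v :* φ) :* u :+ u :* v :* e) refl u v t δ φ e ⟩
    (t - δ * v * φ) * u + u * v * e
      ≈⟨ +-congˡ (*-congʳ (recip-unique uz≈1 vy≈1 wzy≈1)) ⟩
    (t - δ * v * φ) * u + w * e ∎

  -- The two geometric sums that make up `d`

  module Expansion (n r : ℕ) (n≡2r : n ≡ 2 ℕ.* r) (a₊ : ℝ₊) (w₁ w₂ b₁ b₂ : ℂ)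
    ⦃ _ : NonZero w₁ ⦄ ⦃ _ : NonZero w₂ ⦄ ⦃ _ : NonZero b₁ ⦄ ⦃ _ : NonZero b₂ ⦄
    where
    open Formulas n r a₊
    open Boundary n r a₊
    module 𝐛 = Monomials b₁ b₂
    -- Rows of `K` are treated as columns after the exchange of coordinates, hence the reversed
    -- arguments.
    module 𝐰 = Monomials w₂ w₁

    X Y : ℂ
    X = w₁ ^ 2 * b₁ ^ 2
    Y = w₂ ^ 2 * b₂ ^ 2

    U : Black n → ℂ
    U y = 𝐰.Vᵂ (swap y)

    mᵇ : Black n → ℂ
    mᵇ y = b₁ ^ Y₁ y * b₂ ^ Y₂ y

    -- One period of the sum over the black vertices with a fixed first coordinate.
    C : Fin 2 → ℂ
    C ε = 𝐰.core ε + Y * 𝐰.core (opposite ε)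

    U-term : ∀ i j → 𝐰.V j i * (b₁ ^ (2 ℕ.* i) * b₂ ^ (2 ℕ.* j ℕ.+ 1))
      ≈ b₂ * X ^ i * (Y ^ j * 𝐰.core (parity (j ℕ.+ i)))
    U-term i j = begin
      (w₂ ^ 2) ^ j * (w₁ ^ 2) ^ i * e * (b₁ ^ (2 ℕ.* i) * b₂ ^ (2 ℕ.* j ℕ.+ 1))
        ≈⟨ *-congˡ (*-cong (even-power b₁ i) (odd-power b₂ j)) ⟨
      (w₂ ^ 2) ^ j * (w₁ ^ 2) ^ i * e * ((b₁ ^ 2) ^ i * ((b₂ ^ 2) ^ j * b₂))
        ≈⟨ solve 6 (λ p q e r s b → p :* q :* e :* (r :* (s :* b)) := b :* (q :* r) :* ((p :* s) :* e)) refl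
             ((w₂ ^ 2) ^ j) ((w₁ ^ 2) ^ i) e ((b₁ ^ 2) ^ i) ((b₂ ^ 2) ^ j) b₂ ⟩
      b₂ * ((w₁ ^ 2) ^ i * (b₁ ^ 2) ^ i) * (((w₂ ^ 2) ^ j * (b₂ ^ 2) ^ j) * e)
        ≈⟨ *-cong (*-congˡ (^-distrib-* (w₁ ^ 2) (b₁ ^ 2) i)) (*-congʳ (^-distrib-* (w₂ ^ 2) (b₂ ^ 2) j)) ⟨
      b₂ * X ^ i * (Y ^ j * e) ∎
      where e = 𝐰.core (parity (j ℕ.+ i))

    module _ ⦃ _ : NonZero (1# - w₁ ^ 4 * b₁ ^ 4) ⦄ ⦃ _ : NonZero (1# - w₂ ^ 4 * b₂ ^ 4) ⦄ where

      F₁ F₂ : ℂ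
      F₁ = f r (w₁ ^ 4 * b₁ ^ 4)
      F₂ = f r (w₂ ^ 4 * b₂ ^ 4)

      bulk edges : ℂ
      bulk = F₂ * F₁ * b₂ * w₁
            * (a + w₁ ^ 2 * b₁ ^ 2 + w₂ ^ 2 * b₂ ^ 2 * (1# + a * w₁ ^ 2 * b₁ ^ 2))
            * (w₂ ^ 2 + b₁ ^ 2 - 𝕚 * (1# + w₂ ^ 2 * b₁ ^ 2))
      edges = ((1# - 𝕚 * w₂ ^ 2) * w₁ ^- 1 * b₂ * (1# + a * w₂ ^ 2 * b₂ ^ 2)
            + (w₂ ^ 2 - 𝕚) * w₁ ^ (2 ℕ.* n ℕ.+ 1) * b₁ ^ (2 ℕ.* n) * b₂ * (a + w₂ ^ 2 * b₂ ^ 2))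
            * F₂

      F₁-X : F₁ * (1# - X * X) ≈ 1# - (w₁ ^ 2) ^ n * (b₁ ^ 2) ^ n
      F₁-X = trans (*-congˡ (+-congˡ (-‿cong (sym (fourth-power w₁ b₁)))))
        (trans (f-*-1-t r (w₁ ^ 4 * b₁ ^ 4)) (+-congˡ (-‿cong (begin
          (w₁ ^ 4 * b₁ ^ 4) ^ r
            ≈⟨ ^-congˡ r (trans (fourth-power w₁ b₁) (*-congˡ (sym (*-identityʳ X)))) ⟩
          (X ^ 2) ^ r
            ≈⟨ ^-assocʳ X 2 r ⟩
          X ^ (2 ℕ.* r)
            ≡⟨ ≡.cong (X ^_) (≡.sym n≡2r) ⟩
          X ^ n
            ≈⟨ ^-distrib-* (w₁ ^ 2) (b₁ ^ 2) n ⟩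
          (w₁ ^ 2) ^ n * (b₁ ^ 2) ^ n ∎))))

      inner-sum : ∀ i → ∑[ j < n ] (Y ^ toℕ j * 𝐰.core (parity (toℕ j ℕ.+ i))) ≈ F₂ * C (parity i)
      inner-sum i = periodic-sum r n≡2r Y (w₂ ^ 4 * b₂ ^ 4) (fourth-power w₂ b₂)
        (λ j → 𝐰.core (parity (j ℕ.+ i))) (λ j → parity-periodic 𝐰.core (j ℕ.+ i))

      -- Black vertices have `n + 1` first coordinates: `n` of them form `r` periods, and the last,
      -- of even index, is left over.
      outer-sum : ∑[ i < suc n ] (X ^ toℕ i * C (parity (toℕ i)))
        ≈ F₁ * (C 0F + X * C 1F) + (w₁ ^ 2) ^ n * (b₁ ^ 2) ^ n * C 0F
      outer-sum = trans (∑-snoc n (λ i → X ^ i * C (parity i))) (+-cong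
        (periodic-sum r n≡2r X (w₁ ^ 4 * b₁ ^ 4) (fourth-power w₁ b₁) (λ i → C (parity i)) (parity-periodic C))
        (*-cong (^-distrib-* (w₁ ^ 2) (b₁ ^ 2) n)
          (ℂᴿ.reflexive (≡.cong C (≡.trans (≡.cong parity n≡2r) (parity-+-double 0 r))))))

      U-sum : ∑[ y ∈B n ] (U y * mᵇ y) ≈ bulk + edges
      U-sum = begin
        ∑[ y ∈B n ] (U y * mᵇ y)
          ≈⟨ sum-cong {suc n} (λ i → trans
               (sum-cong {n} (λ j → U-term (toℕ i) (toℕ j)))
               (trans (sym (*-distribˡ-sum {n} (b₂ * X ^ toℕ i) (λ j → Y ^ toℕ j * 𝐰.core (parity (toℕ j ℕ.+ toℕ i)))))
                 (trans (*-congˡ (inner-sum (toℕ i)))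
                   (solve 4 (λ b x f c → b :* x :* (f :* c) := b :* f :* (x :* c)) refl b₂ (X ^ toℕ i) F₂ (C (parity (toℕ i))))))) ⟩
        ∑[ i < suc n ] (b₂ * F₂ * (X ^ toℕ i * C (parity (toℕ i))))
          ≈⟨ *-distribˡ-sum {suc n} (b₂ * F₂) (λ i → X ^ toℕ i * C (parity (toℕ i))) ⟨
        b₂ * F₂ * (∑[ i < suc n ] (X ^ toℕ i * C (parity (toℕ i))))
          ≈⟨ *-congˡ outer-sum ⟩
        b₂ * F₂ * (F₁ * (C 0F + X * C 1F) + (w₁ ^ 2) ^ n * (b₁ ^ 2) ^ n * C 0F)
          -- In `C 0F + X * C 1F` the coefficient of `w₁ ⁻¹ * (1 - 𝕚 w₂²)` is `(1 + aY)(1 - X²) +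
          -- X((a + Y) + X(1 + aY))`. Times `F₁`, the first part telescopes and, with the leftover
          -- term, yields `edges`; the second joins `bulk` because `X w₁⁻¹ = w₁ b₁²`.
          ≈⟨ modulo
               (b₂ * F₂ * (w₁ ⁻¹ * (1# - 𝕚 * w₂ ^ 2)) * (1# + a * Y))
               (b₂ * F₂ * F₁ * ((a + Y) + X * (1# + a * Y)) * w₁ * b₁ ^ 2 * (1# - 𝕚 * w₂ ^ 2))
               (x-y≈0 F₁-X) 𝐰.b₂*b₂⁻¹-1
               (solve 11 (λ w v W B b i F₁ F₂ Wⁿ Bⁿ a →
                 let l = con (+ 1) ; w² = w :* (w :* l) ; B² = B :* (B :* l) ; W² = W :* (W :* l) ; b² = b :* (b :* l)
                     X = w² :* B² ; Y = W² :* b²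
                     P = l :- i :* W² ; Q = W² :- i
                     k₀ = l :* v :* P :+ a :* w :* Q ; k₁ = a :* v :* P :+ l :* w :* Q
                     C₀ = k₀ :+ Y :* k₁ ; C₁ = k₁ :+ Y :* k₀ in
                 b :* F₂ :* (F₁ :* (C₀ :+ X :* C₁) :+ Wⁿ :* Bⁿ :* C₀)
                   := F₂ :* F₁ :* b :* w :* (a :+ w² :* B² :+ W² :* b² :* (l :+ a :* w² :* B²)) :* (W² :+ B² :- i :* (l :+ W² :* B²))
                      :+ (P :* (v :* l) :* b :* (l :+ a :* W² :* b²) :+ Q :* (Wⁿ :* w) :* Bⁿ :* b :* (a :+ W² :* b²)) :* F₂
                      :+ b :* F₂ :* (v :* P) :* (l :+ a :* Y) :* (F₁ :* (l :- X :* X) :- (l :- Wⁿ :* Bⁿ))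
                      :+ b :* F₂ :* F₁ :* ((a :+ Y) :+ X :* (l :+ a :* Y)) :* w :* B² :* P :* (w :* v :- l))
                 refl w₁ (w₁ ⁻¹) w₂ b₁ b₂ 𝕚 F₁ F₂ ((w₁ ^ 2) ^ n) ((b₁ ^ 2) ^ n) a) ⟩
        bulk + ((1# - 𝕚 * w₂ ^ 2) * w₁ ^- 1 * b₂ * (1# + a * w₂ ^ 2 * b₂ ^ 2)
            + (w₂ ^ 2 - 𝕚) * ((w₁ ^ 2) ^ n * w₁) * (b₁ ^ 2) ^ n * b₂ * (a + w₂ ^ 2 * b₂ ^ 2)) * F₂
          ≈⟨ +-congˡ (*-congʳ (+-congˡ (*-congʳ (*-congʳ (*-cong (*-congˡ (odd-power w₁ n)) (even-power b₁ n)))))) ⟩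
        bulk + edges ∎

      -- For n = 0 the exponent 2n ∸ 1 is truncated, but then F₁ is zero.
      b₂^[2n]/b₂ : (b₂ ^ 2) ^ n * b₂ ⁻¹ * F₁ ≈ b₂ ^ (2 ℕ.* n ∸ 1) * F₁
      b₂^[2n]/b₂ = helper n r n≡2r
        where
        helper : ∀ n r → n ≡ 2 ℕ.* r →
          (b₂ ^ 2) ^ n * b₂ ⁻¹ * f r (w₁ ^ 4 * b₁ ^ 4) ≈ b₂ ^ (2 ℕ.* n ∸ 1) * f r (w₁ ^ 4 * b₁ ^ 4)
        helper n       zero    _  = trans (*-congˡ F≈0) (trans (ℂᴿ.zeroʳ _) (sym (trans (*-congˡ F≈0) (ℂᴿ.zeroʳ _))))
          where F≈0 = f-zero (w₁ ^ 4 * b₁ ^ 4)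
        helper (suc n) (suc r) _ = *-congʳ (begin
          b₂ ^ 2 * (b₂ ^ 2) ^ n * b₂ ⁻¹
            ≈⟨ solve 3 (λ b v p → b :* (b :* con (+ 1)) :* p :* v := v :* b :* (p :* b)) refl b₂ (b₂ ⁻¹) ((b₂ ^ 2) ^ n) ⟩
          b₂ ⁻¹ * b₂ * ((b₂ ^ 2) ^ n * b₂)
            ≈⟨ trans (*-cong (⁻¹-inverseˡ b₂) (odd-power b₂ n)) (*-identityˡ _) ⟩
          b₂ ^ (2 ℕ.* n ℕ.+ 1)
            ≡⟨ ≡.cong (b₂ ^_) (lemma n) ⟩
          b₂ ^ (2 ℕ.* suc n ∸ 1) ∎)
          where
          lemma : ∀ n → 2 ℕ.* n ℕ.+ 1 ≡ n ℕ.+ suc (n ℕ.+ 0)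
          lemma = solve-∀

      side-sum : Fin 2 → ℂ → ℂ
      side-sum κ z = s 0F κ w₁ w₂ * (w₁ * z * 𝐛.core 0F) + X * (s 1F κ w₁ w₂ * (w₁ * z * 𝐛.core 1F))

      -- Both sides have even second index, `0` or `n`, so the class at position `j` is the parity
      -- of `j` and the terms along a side have period two up to powers of `X`.
      side-terms : ∀ κ k → parity k ≡ 0F →
        ∑[ j < n ] (𝐰.boundaryTerm κ k (toℕ j) * 𝐛.V (toℕ j) k) ≈ F₁ * side-sum κ ((b₂ ^ 2) ^ k)
      side-terms κ k even = trans (sum-cong {n} (λ j → term (toℕ j)))
        (periodic-sum r n≡2r X (w₁ ^ 4 * b₁ ^ 4) (fourth-power w₁ b₁)
          (λ j → g (parity j)) (parity-periodic g))
        where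
        g : Fin 2 → ℂ
        g ε = s ε κ w₁ w₂ * (w₁ * (b₂ ^ 2) ^ k * 𝐛.core ε)
        parity-even+ : ∀ m → parity m ≡ 0F → ∀ j → parity (j ℕ.+ m) ≡ parity j
        parity-even+ m even zero    = even
        parity-even+ m even (suc j) = ≡.cong opposite (parity-even+ m even j)
        term : ∀ j → 𝐰.boundaryTerm κ k j * 𝐛.V j k ≈ X ^ j * g (parity j)
        term j = begin
          s (parity (k ℕ.+ j)) κ w₁ w₂ * w₁ ^ (2 ℕ.* j ℕ.+ 1) * ((b₁ ^ 2) ^ j * (b₂ ^ 2) ^ k * 𝐛.core (parity (j ℕ.+ k)))
            ≡⟨ ≡.cong₂ (λ ε η → s ε κ w₁ w₂ * w₁ ^ (2 ℕ.* j ℕ.+ 1) * ((b₁ ^ 2) ^ j * (b₂ ^ 2) ^ k * 𝐛.core η))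
                 (≡.trans (≡.cong parity (ℕₚ.+-comm k j)) (parity-even+ k even j)) (parity-even+ k even j) ⟩
          s (parity j) κ w₁ w₂ * w₁ ^ (2 ℕ.* j ℕ.+ 1) * ((b₁ ^ 2) ^ j * (b₂ ^ 2) ^ k * 𝐛.core (parity j))
            ≈⟨ *-congʳ (*-congˡ (sym (odd-power w₁ j))) ⟩
          s (parity j) κ w₁ w₂ * ((w₁ ^ 2) ^ j * w₁) * ((b₁ ^ 2) ^ j * (b₂ ^ 2) ^ k * 𝐛.core (parity j))
            ≈⟨ solve 6 (λ s p w q z e → s :* (p :* w) :* (q :* z :* e) := (p :* q) :* (s :* (w :* z :* e))) refl
                 (s (parity j) κ w₁ w₂) ((w₁ ^ 2) ^ j) w₁ ((b₁ ^ 2) ^ j) ((b₂ ^ 2) ^ k) (𝐛.core (parity j)) ⟩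
          ((w₁ ^ 2) ^ j * (b₁ ^ 2) ^ j) * g (parity j)
            ≈⟨ *-congʳ (^-distrib-* (w₁ ^ 2) (b₁ ^ 2) j) ⟨
          X ^ j * g (parity j) ∎

      V-sum : ∑[ x ∈W n ] (𝐰.boundaryᴮ (swap x) * 𝐛.Vᵂ x) ≈ d-sides w₁ w₂ b₁ b₂ * F₁
      V-sum = begin
        ∑[ x ∈W n ] (𝐰.boundaryᴮ (swap x) * 𝐛.Vᵂ x)
          ≈⟨ ∑ₓ-swap {suc n} {n} (λ x → 𝐰.boundaryᴮ x * 𝐛.Vᵂ (swap x)) ⟨
        ∑[ x ∈B n ] (𝐰.boundaryᴮ x * 𝐛.Vᵂ (swap x))
          ≈⟨ 𝐰.boundary-sum (λ x → 𝐛.Vᵂ (swap x)) ⟩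
        ∑[ j < n ] (𝐰.boundaryTerm 0F 0 (toℕ j) * 𝐛.V (toℕ j) 0)
          + (∑[ j < n ] (𝐰.boundaryTerm 1F (toℕ (fromℕ n)) (toℕ j) * 𝐛.V (toℕ j) (toℕ (fromℕ n))) + 0#)
          ≈⟨ +-cong (side-terms 0F 0 ≡.refl) (+-congʳ (trans
               (ℂᴿ.reflexive (≡.cong (λ k → ∑[ j < n ] (𝐰.boundaryTerm 1F k (toℕ j) * 𝐛.V (toℕ j) k)) (Fin.toℕ-fromℕ n)))
               (side-terms 1F n (≡.trans (≡.cong parity n≡2r) (parity-+-double 0 r))))) ⟩
        F₁ * side-sum 0F 1# + (F₁ * side-sum 1F ((b₂ ^ 2) ^ n) + 0#)
          -- The relation for the exponent `2n ∸ 1` already contains `F₁`, so its cofactor does not.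
          ≈⟨ modulo
               (s 0F 1F w₁ w₂ * (1# - 𝕚 * b₁ ^ 2) * w₁ + s 1F 1F w₁ w₂ * a * (1# - 𝕚 * b₁ ^ 2) * w₁ ^ 3 * b₁ ^ 2)
               (F₁ * (s 0F 1F w₁ w₂ * a * w₁ * (b₁ ^ 2 - 𝕚) + s 1F 1F w₁ w₂ * w₁ ^ 3 * b₁ ^ 2 * (b₁ ^ 2 - 𝕚)))
               (x-y≈0 b₂^[2n]/b₂) (x-y≈0 (odd-power b₂ n))
               (solve 14 (λ s₀₀ s₁₀ s₀₁ s₁₁ w B b v i a F N N⁻ N⁺ →
                 let l = con (+ 1) ; w² = w :* (w :* l) ; w³ = w :* (w :* (w :* l)) ; B² = B :* (B :* l)
                     P = l :- i :* B² ; Q = B² :- i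
                     k₀ = l :* v :* P :+ a :* b :* Q ; k₁ = a :* v :* P :+ l :* b :* Q in
                 F :* (s₀₀ :* (w :* l :* k₀) :+ w² :* B² :* (s₁₀ :* (w :* l :* k₁)))
                   :+ (F :* (s₀₁ :* (w :* N :* k₀) :+ w² :* B² :* (s₁₁ :* (w :* N :* k₁))) :+ con (+ 0))
                   := (s₀₀ :* (a :* Q :* w :* b :+ w :* (v :* l) :* P)
                       :+ s₁₀ :* (Q :* w³ :* B² :* b :+ a :* w³ :* B² :* (v :* l) :* P)
                       :+ s₀₁ :* (P :* w :* N⁻ :+ a :* w :* N⁺ :* Q)
                       :+ s₁₁ :* (a :* P :* w³ :* B² :* N⁻ :+ w³ :* B² :* N⁺ :* Q)) :* F
                      :+ (s₀₁ :* P :* w :+ s₁₁ :* a :* P :* w³ :* B²) :* (N :* v :* F :- N⁻ :* F)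
                      :+ F :* (s₀₁ :* a :* w :* Q :+ s₁₁ :* w³ :* B² :* Q) :* (N :* b :- N⁺))
                 refl (s 0F 0F w₁ w₂) (s 1F 0F w₁ w₂) (s 0F 1F w₁ w₂) (s 1F 1F w₁ w₂)
                      w₁ b₁ b₂ (b₂ ⁻¹) 𝕚 a F₁ ((b₂ ^ 2) ^ n) (b₂ ^ (2 ℕ.* n ∸ 1)) (b₂ ^ (2 ℕ.* n ℕ.+ 1))) ⟩
        d-sides w₁ w₂ b₁ b₂ * F₁ ∎

    -- Linear equations for the generating function and the sum over the sides

    open Symmetries n r n≡2r

    k⁻¹ : White n → Black n → ℂ
    k⁻¹ = K⁻¹ n a₊ 1₊

    open Inverse (K n a₊ 1₊) k⁻¹ (K⁻¹-isInverse n a₊ 1₊)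

    mʷ : White n → ℂ
    mʷ x = w₁ ^ X₁ x * w₂ ^ X₂ x

    c∂-comm : c∂ w₂ w₁ ≈ c∂ w₁ w₂
    c∂-comm = +-congˡ (solve 3 (λ a x y → a :* x :* y := a :* y :* x) refl a (w₂ ^ 2 + w₂ ^- 2) (w₁ ^ 2 + w₁ ^- 2))

    U-K : ∀ x → ∑[ y ∈B n ] (U y * K n a₊ 1₊ y x) ≈ c∂ w₁ w₂ * mʷ x + 𝐰.boundaryᴮ (swap x)
    U-K x@(i , j) = begin
      ∑[ y ∈B n ] (𝐰.Vᵂ (swap y) * K n a₊ 1₊ y x)
        ≈⟨ ∑ₓ-cong (λ y → trans (*-comm (𝐰.Vᵂ (swap y)) (K n a₊ 1₊ y x)) (*-congʳ (K-swap a₊ 1₊ y x))) ⟩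
      ∑[ y ∈B n ] (K n a₊ 1₊ (swap x) (swap y) * 𝐰.Vᵂ (swap y))
        ≈⟨ ∑ₓ-swap (λ y → K n a₊ 1₊ (swap x) y * 𝐰.Vᵂ y) ⟨
      ∑[ y ∈W n ] (K n a₊ 1₊ (swap x) y * 𝐰.Vᵂ y)
        ≈⟨ 𝐰.K-V (swap x) ⟩
      c∂ w₂ w₁ * (w₂ ^ X₂ x * w₁ ^ X₁ x) + 𝐰.boundaryᴮ (swap x)
        ≈⟨ +-congʳ (*-cong c∂-comm (*-comm _ _)) ⟩
      c∂ w₁ w₂ * mʷ x + 𝐰.boundaryᴮ (swap x) ∎

    H E : White n → ℂ
    H x = ∑[ y ∈B n ] (k⁻¹ x y * mᵇ y)
    E x = ∑[ y ∈B n ] (k⁻¹ x y * 𝐛.boundaryᴮ y)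

    H-equation : ∀ x → 𝐛.Vᵂ x ≈ c∂ b₁ b₂ * H x + E x
    H-equation x = begin
      𝐛.Vᵂ x
        ≈⟨ resolveʳ 𝐛.Vᵂ x ⟨
      ∑[ y ∈B n ] (k⁻¹ x y * (∑[ z ∈W n ] (K n a₊ 1₊ y z * 𝐛.Vᵂ z)))
        ≈⟨ ∑ₓ-cong (λ y → trans (*-congˡ (𝐛.K-V y))
             (solve 4 (λ k c m s → k :* (c :* m :+ s) := c :* (k :* m) :+ k :* s) refl (k⁻¹ x y) (c∂ b₁ b₂) (mᵇ y) (𝐛.boundaryᴮ y))) ⟩
      ∑[ y ∈B n ] (c∂ b₁ b₂ * (k⁻¹ x y * mᵇ y) + k⁻¹ x y * 𝐛.boundaryᴮ y)
        ≈⟨ trans (∑ₓ-+ (λ y → c∂ b₁ b₂ * (k⁻¹ x y * mᵇ y)) (λ y → k⁻¹ x y * 𝐛.boundaryᴮ y))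
             (+-congʳ (sym (∑ₓ-*ˡ (c∂ b₁ b₂) (λ y → k⁻¹ x y * mᵇ y)))) ⟩
      c∂ b₁ b₂ * H x + E x ∎

    ∑∂ : (White n → ℂ) → ℂ
    ∑∂ h = ∑[ x ∈W n ] (𝐰.boundaryᴮ (swap x) * h x)

    -- Evaluates `U K K⁻¹ b` in two ways: `U-K` expands the product `U K`, and `resolveˡ` cancels
    -- `K K⁻¹`.
    G-equation : c∂ w₁ w₂ * G n a₊ 1₊ w₁ w₂ b₁ b₂ + ∑∂ H ≈ ∑[ y ∈B n ] (U y * mᵇ y)
    G-equation = begin
      c∂ w₁ w₂ * G n a₊ 1₊ w₁ w₂ b₁ b₂ + ∑∂ H
        ≈⟨ +-congʳ (trans (*-congˡ (∑ₓ-cong G-row)) (∑ₓ-*ˡ (c∂ w₁ w₂) (λ x → mʷ x * H x))) ⟩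
      ∑[ x ∈W n ] (c∂ w₁ w₂ * (mʷ x * H x)) + ∑∂ H
        ≈⟨ ∑ₓ-+ (λ x → c∂ w₁ w₂ * (mʷ x * H x)) (λ x → 𝐰.boundaryᴮ (swap x) * H x) ⟨
      ∑[ x ∈W n ] (c∂ w₁ w₂ * (mʷ x * H x) + 𝐰.boundaryᴮ (swap x) * H x)
        ≈⟨ ∑ₓ-cong (λ x → trans
             (solve 4 (λ c m h s → c :* (m :* h) :+ s :* h := (c :* m :+ s) :* h) refl (c∂ w₁ w₂) (mʷ x) (H x) (𝐰.boundaryᴮ (swap x)))
             (trans (*-congʳ (sym (U-K x))) (trans (∑ₓ-*ˡ (UK x) (λ y → k⁻¹ x y * mᵇ y))
               (∑ₓ-cong (λ y → sym (*-assoc (UK x) (k⁻¹ x y) (mᵇ y))))))) ⟩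
      ∑[ x ∈W n ] ∑[ y ∈B n ] (UK x * k⁻¹ x y * mᵇ y)
        ≈⟨ ∑ₓ-comm (λ x y → UK x * k⁻¹ x y * mᵇ y) ⟩
      ∑[ y ∈B n ] ∑[ x ∈W n ] (UK x * k⁻¹ x y * mᵇ y)
        ≈⟨ ∑ₓ-cong (λ y → trans (sym (∑ₓ-*ʳ (mᵇ y) (λ x → UK x * k⁻¹ x y))) (*-congʳ (resolveˡ U y))) ⟩
      ∑[ y ∈B n ] (U y * mᵇ y) ∎
      where
      UK : White n → ℂ
      UK x = ∑[ y ∈B n ] (U y * K n a₊ 1₊ y x)
      G-row : ∀ x → ∑[ y ∈B n ] (k⁻¹ x y * w₁ ^ X₁ x * w₂ ^ X₂ x * b₁ ^ Y₁ y * b₂ ^ Y₂ y) ≈ mʷ x * H x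
      G-row x = trans
        (∑ₓ-cong (λ y → solve 5 (λ k p q s t → k :* p :* q :* s :* t := p :* q :* (k :* (s :* t))) refl
          (k⁻¹ x y) (w₁ ^ X₁ x) (w₂ ^ X₂ x) (b₁ ^ Y₁ y) (b₂ ^ Y₂ y)))
        (sym (∑ₓ-*ˡ (mʷ x) (λ y → k⁻¹ x y * mᵇ y)))

    ∑∂-equation : ∑∂ 𝐛.Vᵂ ≈ c∂ b₁ b₂ * ∑∂ H + ∑∂ E
    ∑∂-equation = begin
      ∑∂ 𝐛.Vᵂ
        ≈⟨ ∑ₓ-cong (λ x → trans (*-congˡ (H-equation x))
             (solve 4 (λ s c h e → s :* (c :* h :+ e) := c :* (s :* h) :+ s :* e) refl (𝐰.boundaryᴮ (swap x)) (c∂ b₁ b₂) (H x) (E x))) ⟩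
      ∑[ x ∈W n ] (c∂ b₁ b₂ * (𝐰.boundaryᴮ (swap x) * H x) + 𝐰.boundaryᴮ (swap x) * E x)
        ≈⟨ trans (∑ₓ-+ (λ x → c∂ b₁ b₂ * (𝐰.boundaryᴮ (swap x) * H x)) (λ x → 𝐰.boundaryᴮ (swap x) * E x))
             (+-congʳ (sym (∑ₓ-*ˡ (c∂ b₁ b₂) (λ x → 𝐰.boundaryᴮ (swap x) * H x)))) ⟩
      c∂ b₁ b₂ * ∑∂ H + ∑∂ E ∎

    -- Half the constant coordinate of a side, `0` or `n`. It serves both colours, the white sides
    -- being the exchanged black ones.
    k̂ : Fin 2 → Fin n → ℕ
    k̂ κ j = toℕ (proj₁ (sideᴮ κ j))

    tʷ tᵇ : Fin 2 → Fin n → ℂ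
    tʷ κ i = 𝐰.boundaryTerm κ (k̂ κ i) (toℕ i)
    tᵇ κ j = 𝐛.boundaryTerm κ (k̂ κ j) (toℕ j)

    E-sum : ∑∂ E ≈ ∑[ k < 2 ] ∑[ l < 2 ] ∑[ i < n ] ∑[ j < n ] (tʷ k i * (tᵇ l j * k⁻¹ (sideᵂ k i) (sideᴮ l j)))
    E-sum = begin
      ∑∂ E
        ≈⟨ ∑ₓ-swap {suc n} {n} (λ x → 𝐰.boundaryᴮ x * E (swap x)) ⟨
      ∑[ x ∈B n ] (𝐰.boundaryᴮ x * E (swap x))
        ≈⟨ 𝐰.boundary-sum (λ x → E (swap x)) ⟩
      ∑[ k < 2 ] ∑[ i < n ] (tʷ k i * E (swap (sideᴮ k i)))
        ≈⟨ sum-cong {2} (λ k → sum-cong {n} (λ i → trans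
             (*-congˡ (trans (ℂᴿ.reflexive (≡.cong E (swap-side k i))) (E-expand (sideᵂ k i))))
             (trans (*-distribˡ-sum {2} (tʷ k i) (λ l → ∑[ j < n ] (tᵇ l j * k⁻¹ (sideᵂ k i) (sideᴮ l j))))
               (sum-cong {2} (λ l → *-distribˡ-sum {n} (tʷ k i) (λ j → tᵇ l j * k⁻¹ (sideᵂ k i) (sideᴮ l j))))))) ⟩
      ∑[ k < 2 ] ∑[ i < n ] ∑[ l < 2 ] ∑[ j < n ] (tʷ k i * (tᵇ l j * k⁻¹ (sideᵂ k i) (sideᴮ l j)))
        ≈⟨ sum-cong {2} (λ k → ∑-comm {n} {2} (λ i l → ∑[ j < n ] (tʷ k i * (tᵇ l j * k⁻¹ (sideᵂ k i) (sideᴮ l j))))) ⟩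
      ∑[ k < 2 ] ∑[ l < 2 ] ∑[ i < n ] ∑[ j < n ] (tʷ k i * (tᵇ l j * k⁻¹ (sideᵂ k i) (sideᴮ l j))) ∎
      where
      swap-side : ∀ k i → swap (sideᴮ {n} k i) ≡ sideᵂ k i
      swap-side 0F i = ≡.refl
      swap-side 1F i = ≡.refl
      E-expand : ∀ x → E x ≈ ∑[ l < 2 ] ∑[ j < n ] (tᵇ l j * k⁻¹ x (sideᴮ l j))
      E-expand x = trans (∑ₓ-cong (λ y → *-comm (k⁻¹ x y) (𝐛.boundaryᴮ y))) (𝐛.boundary-sum (k⁻¹ x))

    sideᵂ-sum : ∀ k i → proj₁ (posᵂ (sideᵂ k i)) ℕ.+ proj₂ (posᵂ (sideᵂ k i)) ≡ 2 ℕ.* (k̂ k i ℕ.+ toℕ i) ℕ.+ 1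
    sideᵂ-sum 0F i = ≡.trans (ℕₚ.+-comm (2 ℕ.* toℕ i ℕ.+ 1) 0) (position-sum 0 (toℕ i))
    sideᵂ-sum 1F i = ≡.trans (ℕₚ.+-comm (2 ℕ.* toℕ i ℕ.+ 1) _) (position-sum (toℕ (fromℕ n)) (toℕ i))

    sideᴮ-sum : ∀ l j → proj₁ (posᴮ (sideᴮ l j)) ℕ.+ proj₂ (posᴮ (sideᴮ l j)) ≡ 2 ℕ.* (k̂ l j ℕ.+ toℕ j) ℕ.+ 1
    sideᴮ-sum 0F j = position-sum 0 (toℕ j)
    sideᴮ-sum 1F j = position-sum (toℕ (fromℕ n)) (toℕ j)

    X₁-side : ∀ k i → X₁ (sideᵂ {n} k i) ≡ 2 ℕ.* toℕ i ℕ.+ 1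
    X₁-side 0F i = ≡.refl
    X₁-side 1F i = ≡.refl

    Y₂-side : ∀ l j → Y₂ (sideᴮ {n} l j) ≡ 2 ℕ.* toℕ j ℕ.+ 1
    Y₂-side 0F j = ≡.refl
    Y₂-side 1F j = ≡.refl

    module _ (u : ℂ) where
      summand : Fin 2 → Fin 2 → Fin n → Fin n → Fin 2 → Fin 2 → ℂ
      summand k l i j ε δ = s ε k w₁ w₂ * s δ l b₂ b₁ * k⁻¹ (sideᵂ k i) (sideᴮ l j) * u * w₁ ^ X₁ (sideᵂ k i) * b₂ ^ Y₂ (sideᴮ l j)

      summand-class : ∀ k l i j → summand k l i j (parity (k̂ k i ℕ.+ toℕ i)) (parity (k̂ l j ℕ.+ toℕ j))
        ≈ u * (tʷ k i * (tᵇ l j * k⁻¹ (sideᵂ k i) (sideᴮ l j)))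
      summand-class k l i j = trans
        (*-cong (*-congˡ (ℂᴿ.reflexive (≡.cong (w₁ ^_) (X₁-side k i)))) (ℂᴿ.reflexive (≡.cong (b₂ ^_) (Y₂-side l j))))
        (rearrange (s _ k w₁ w₂) (s _ l b₂ b₁) (k⁻¹ (sideᵂ k i) (sideᴮ l j)) (w₁ ^ (2 ℕ.* toℕ i ℕ.+ 1)) (b₂ ^ (2 ℕ.* toℕ j ℕ.+ 1)))
        where
        rearrange : ∀ s t k p q → s * t * k * u * p * q ≈ u * (s * p * (t * q * k))
        rearrange s t k p q = solve 6 (λ s t k u p q → s :* t :* k :* u :* p :* q := u :* (s :* p :* (t :* q :* k))) refl s t k u p q

      sides-sum :
        ∑[ ε < 2 ] ∑[ δ < 2 ] ∑[ k < 2 ] ∑[ l < 2 ] ∑[ i < n ] ∑[ j < n ]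
            (summand k l i j ε δ when (posᵂ (sideᵂ k i) ∈ᵇ ε) ∧ (posᴮ (sideᴮ l j) ∈ᵇ δ))
          ≈ u * ∑∂ E
      sides-sum = trans
        (collapse-classes n u
          (λ ε δ k l i j → summand k l i j ε δ when (posᵂ (sideᵂ k i) ∈ᵇ ε) ∧ (posᴮ (sideᴮ l j) ∈ᵇ δ))
          (λ k l i j → tʷ k i * (tᵇ l j * k⁻¹ (sideᵂ k i) (sideᴮ l j)))
          (λ k l i j → trans
            (∑-classes (posᵂ (sideᵂ k i)) (k̂ k i ℕ.+ toℕ i) (sideᵂ-sum k i)
                       (posᴮ (sideᴮ l j)) (k̂ l j ℕ.+ toℕ j) (sideᴮ-sum l j) (summand k l i j))
            (summand-class k l i j)))
        (*-congˡ (sym E-sum))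

    module _
      ⦃ _ : NonZero (c∂ w₁ w₂) ⦄ ⦃ _ : NonZero (c∂ b₁ b₂) ⦄
      ⦃ _ : NonZero (1# - w₁ ^ 4 * b₁ ^ 4) ⦄ ⦃ _ : NonZero (1# - w₂ ^ 4 * b₂ ^ 4) ⦄ where
      generating-function : ∀ u → u * (c∂ w₁ w₂ * c∂ b₁ b₂) ≈ 1# →
        G n a₊ 1₊ w₁ w₂ b₁ b₂ ≈ d w₁ w₂ b₁ b₂ / c∂ w₁ w₂ + u * ∑∂ E
      generating-function u uD≈1 = eliminate {z = c∂ w₁ w₂} {c∂ b₁ b₂}
        (⁻¹-inverseˡ (c∂ w₁ w₂)) (⁻¹-inverseˡ (c∂ b₁ b₂)) uD≈1
        (trans G-equation U-sum) (trans (sym V-sum) ∑∂-equation)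

      expansion : ⦃ nz : NonZero (c∂ w₁ w₂ * c∂ b₁ b₂) ⦄ → let u = _⁻¹ (c∂ w₁ w₂ * c∂ b₁ b₂) ⦃ nz ⦄ in
        G n a₊ 1₊ w₁ w₂ b₁ b₂
          ≈ d w₁ w₂ b₁ b₂ / c∂ w₁ w₂
            + ∑[ ε < 2 ] ∑[ δ < 2 ] ∑[ k < 2 ] ∑[ l < 2 ] ∑[ i < n ] ∑[ j < n ]
                (summand u k l i j ε δ when (posᵂ (sideᵂ k i) ∈ᵇ ε) ∧ (posᴮ (sideᴮ l j) ∈ᵇ δ))
      expansion ⦃ nz ⦄ = trans
        (generating-function u (⁻¹-inverseˡ (c∂ w₁ w₂ * c∂ b₁ b₂) ⦃ nz ⦄))
        (+-congˡ (sym (sides-sum u)))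
        where
        u = _⁻¹ (c∂ w₁ w₂ * c∂ b₁ b₂) ⦃ nz ⦄

theorem4 :
    ∀ {c ℓ₁ ℓ₂} (ℝ : RealNumbers c ℓ₁ ℓ₂) → let open TwoPeriodicAztec ℝ in
    ∀ (m n r : ℕ) → n ≡ 4 ℕ.* m → n ≡ 2 ℕ.* r →
    ∀ (a : ℝ₊) → let open Formulas n r a in
      (∀ (w₁ w₂ b₁ b₂ : ℂ)
         ⦃ _ : NonZero w₁ ⦄ ⦃ _ : NonZero w₂ ⦄ ⦃ _ : NonZero b₁ ⦄ ⦃ _ : NonZero b₂ ⦄
         ⦃ _ : NonZero (c∂ w₁ w₂) ⦄ ⦃ _ : NonZero (c∂ b₁ b₂) ⦄
         ⦃ _ : NonZero (1# - w₁ ^ 4 * b₁ ^ 4) ⦄ ⦃ _ : NonZero (1# - w₂ ^ 4 * b₂ ^ 4) ⦄ →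
         G n a 1₊ w₁ w₂ b₁ b₂
           ≈ d w₁ w₂ b₁ b₂ / c∂ w₁ w₂
             + ∑[ ε < 2 ] ∑[ δ < 2 ] ∑[ k < 2 ] ∑[ l < 2 ] ∑[ i < n ] ∑[ j < n ]
                 (let x = sideᵂ k i
                      y = sideᴮ l j in
                  (s ε k w₁ w₂ * s δ l b₂ b₁ * K⁻¹ n a 1₊ x y) / (c∂ w₁ w₂ * c∂ b₁ b₂)
                    * w₁ ^ X₁ x * b₂ ^ Y₂ y
                  when (posᵂ x ∈ᵇ ε) ∧ (posᴮ y ∈ᵇ δ)))
      × (∀ (i j : Fin n) →
         let x₁ = 2 ℕ.* toℕ i ℕ.+ 1
             y₂ = 2 ℕ.* toℕ j ℕ.+ 1 in
           (K⁻¹ n a 1₊ (sideᵂ 0F i) (sideᴮ 0F j) ≈ L n a 1₊ i j)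
         × (K⁻¹ n a 1₊ (sideᵂ 0F i) (sideᴮ 1F j)
              ≈ 𝕚 ^ (2 ℕ.* n ∸ 1 ∸ x₁ ℕ.+ y₂) * L n 1₊ a (opposite i) j)
         × (K⁻¹ n a 1₊ (sideᵂ 1F i) (sideᴮ 0F j)
              ≈ 𝕚 ^ (2 ℕ.* n ∸ 1 ℕ.+ x₁ ∸ y₂) * L n 1₊ a i (opposite j))
         × (K⁻¹ n a 1₊ (sideᵂ 1F i) (sideᴮ 1F j) ≈ L n a 1₊ (opposite i) (opposite j)))
-- Writing the instance nz out would make Agda compare the two occurrences of the
-- reciprocal by unfolding the proofs inside; unification finds it at once.
theorem4 ℝ m n r n≡4m n≡2r a =
    (λ w₁ w₂ b₁ b₂ → Expansion.expansion n r n≡2r a w₁ w₂ b₁ b₂ ⦃ nz = _ ⦄)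
  , Symmetries.symmetries n r n≡2r a 1₊
  where
  open TwoPeriodicAztec ℝ
  open Proof ℝ
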